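{- If $G$ is a Berge graph admitting a skew partition, then either $G$ admits a balanced skew partition, or one of $G,\overline G$ contains as an induced subgraph a long prism, or a double diamond, or $L(K_{3,3}\setminus e)$.
   Context: Graphs are finite and simple; Berge: all holes (induced cycles of length $\ge4$) and antiholes (induced subgraphs whose complement is a hole) are even. Paths are induced subgraphs that are paths; antipaths are induced subgraphs whose complement is a path; lengths count edges. Skew partition: partition $(A,B)$ of $V(G)$ with $G|A$ disconnected and $\overline G|B$ disconnected; it is balanced if there is no odd path between nonadjacent vertices of $B$ with interior in $A$ and no odd antipath between adjacent vertices of $A$ with interior in $B$. A prism is a graph consisting of two vertex-disjoint triangles $\{a_1,a_2,a_3\}$, $\{b_1,b_2,b_3\}$ and three paths $P_1,P_2,P_3$, $P_i$ with ends $a_i,b_i$, such that for $i\ne j$ the only edges between $V(P_i)$ and $V(P_j)$ are $a_ia_j$ and $b_ib_j$; it is long if at least one $P_i$ has length $>1$. The double diamond is the graph on $a_1,\dots,a_4,b_1,\dots,b_4$ in which every two $a_i$ are adjacent except $a_3a_4$, every two $b_i$ are adjacent except $b_3b_4$, $a_ib_i$ is an edge for $1\le i\le4$, and there are no other edges. $L(K_{3,3}\setminus e)$ is the line graph of the graph obtained from $K_{3,3}$ by deleting one edge. -}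

module Defs where

open import Level using (0ℓ)
open import Data.Fin.Base using (Fin; zero; suc; toℕ; fromℕ) renaming (_<_ to _<ᶠ_)
import Data.Fin.Properties as Fin
open import Data.Fin.Subset using (Subset; _∈_)
open import Data.Nat.Base using (ℕ; suc; _<_; _≤_)
import Data.Nat.Properties as ℕ
open import Data.Nat.Divisibility using (_∣_)
open import Data.Product using (Σ; ∃₂; ∃-syntax; _×_; _,_; proj₁; proj₂; map; swap)
open import Data.Sum.Base as Sum using (_⊎_; inj₁; inj₂)
open import Function.Base using (_∘_)
open import Function.Bundles using (_⇔_)
open import Function.Definitions using (Injective)
open import Relation.Binary.Construct.Closure.ReflexiveTransitive using (Star)
open import Relation.Binary.Core using (Rel)
open import Relation.Binary.Definitions
  using (Symmetric; Irreflexive; Decidable; DecidableEquality)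
open import Relation.Binary.PropositionalEquality using (_≡_; _≢_; refl; sym; cong)
open import Relation.Nullary using (¬_; yes; no; ¬?; _×-dec_; _⊎-dec_)

Odd Even : ℕ → Set
Even k = 2 ∣ k
Odd k = ¬ Even k

-- A finite graph is a SimpleGraph (Fin n); other vertex types are used
-- only for particular (still finite) graphs.

record SimpleGraph (V : Set) : Set₁ where
  field
    Adj        : Rel V 0ℓ
    adj-sym    : Symmetric Adj
    adj-irrefl : Irreflexive _≡_ Adj
    adj?       : Decidable Adj

open SimpleGraph public

complement : ∀ {n} → SimpleGraph (Fin n) → SimpleGraph (Fin n)
complement G = record
  { Adj        = λ u v → u ≢ v × ¬ Adj G u v
  ; adj-sym    = λ (u≢v , ¬uv) → u≢v ∘ sym , ¬uv ∘ adj-sym G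
  ; adj-irrefl = λ u≡v (u≢v , _) → u≢v u≡v
  ; adj?       = λ u v → ¬? (u Fin.≟ v) ×-dec ¬? (adj? G u v)
  }

infixl 6 _∣ᴳ_

_∣ᴳ_ : ∀ {n} → SimpleGraph (Fin n) → (X : Subset n) → SimpleGraph (∃[ v ] v ∈ X)
G ∣ᴳ X = record
  { Adj        = λ u v → Adj G (proj₁ u) (proj₁ v)
  ; adj-sym    = adj-sym G
  ; adj-irrefl = λ u≡v → adj-irrefl G (cong proj₁ u≡v)
  ; adj?       = λ u v → adj? G (proj₁ u) (proj₁ v)
  }

-- Some two vertices are not joined by a walk; in particular the graph
-- with no vertices is not disconnected.
Disconnected : ∀ {V} → SimpleGraph V → Set
Disconnected H = ∃₂ λ u v → ¬ Star (Adj H) u v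

infix 4 _↪_

-- An isomorphism of H onto an induced subgraph of G.
record _↪_ {W V : Set} (H : SimpleGraph W) (G : SimpleGraph V) : Set where
  field
    to        : W → V
    injective : Injective _≡_ _≡_ to
    induced   : ∀ u v → Adj H u v ⇔ Adj G (to u) (to v)

open _↪_ public using (to)

-- The path with k edges, hence k + 1 vertices.
pathGraph : ∀ k → SimpleGraph (Fin (suc k))
pathGraph k = record
  { Adj        = λ i j → suc (toℕ i) ≡ toℕ j ⊎ suc (toℕ j) ≡ toℕ i
  ; adj-sym    = Sum.swap
  ; adj-irrefl = λ { refl → Sum.[ ℕ.1+n≢n , ℕ.1+n≢n ] }
  ; adj?       = λ i j → (suc (toℕ i) ℕ.≟ toℕ j) ⊎-dec (suc (toℕ j) ℕ.≟ toℕ i)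
  }

Next : ∀ k → Rel (Fin k) 0ℓ
Next k i j = suc (toℕ i) ≡ toℕ j ⊎ (suc (toℕ i) ≡ k × toℕ j ≡ 0)

next? : ∀ k → Decidable (Next k)
next? k i j = (suc (toℕ i) ℕ.≟ toℕ j)
        ⊎-dec ((suc (toℕ i) ℕ.≟ k) ×-dec (toℕ j ℕ.≟ 0))

-- The cycle with k vertices (a cycle only when 3 ≤ k); i ≢ j only
-- matters for k = 1.
cycleGraph : ∀ k → SimpleGraph (Fin k)
cycleGraph k = record
  { Adj        = λ i j → i ≢ j × (Next k i j ⊎ Next k j i)
  ; adj-sym    = map (_∘ sym) Sum.swap
  ; adj-irrefl = λ i≡j (i≢j , _) → i≢j i≡j
  ; adj?       = λ i j → ¬? (i Fin.≟ j) ×-dec (next? k i j ⊎-dec next? k j i)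
  }

Hole : ∀ {n} → SimpleGraph (Fin n) → ℕ → Set
Hole G k = 4 ≤ k × cycleGraph k ↪ G

Antihole : ∀ {n} → SimpleGraph (Fin n) → ℕ → Set
Antihole G = Hole (complement G)

Berge : ∀ {n} → SimpleGraph (Fin n) → Set
Berge G = (∀ k → Hole G k → Even k) × (∀ k → Antihole G k → Even k)

-- An (induced) path of length k in G with ends u and v.
record Path {n} (G : SimpleGraph (Fin n)) (k : ℕ) (u v : Fin n) : Set where
  field
    embedding : pathGraph k ↪ G
    start     : to embedding zero ≡ u
    end       : to embedding (fromℕ k) ≡ v

  vertex : Fin (suc k) → Fin n
  vertex = to embedding

  InteriorIn : Subset n → Set
  InteriorIn X = ∀ i → i ≢ zero → i ≢ fromℕ k → vertex i ∈ X

open Path public using (vertex; InteriorIn)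

Antipath : ∀ {n} → SimpleGraph (Fin n) → ℕ → Rel (Fin n) 0ℓ
Antipath G = Path (complement G)

record SkewPartition {n} (G : SimpleGraph (Fin n)) (A B : Subset n) : Set where
  field
    cover          : ∀ v → v ∈ A ⊎ v ∈ B
    disjoint       : ∀ v → ¬ (v ∈ A × v ∈ B)
    A-disconnected : Disconnected (G ∣ᴳ A)
    B-disconnected : Disconnected (complement G ∣ᴳ B)

record Balanced {n} (G : SimpleGraph (Fin n)) (A B : Subset n) : Set where
  field
    noOddPath     : ∀ {u v k} → u ∈ B → v ∈ B → ¬ Adj G u v →
                    Odd k → (P : Path G k u v) → ¬ InteriorIn P A
    noOddAntipath : ∀ {u v k} → u ∈ A → v ∈ A → Adj G u v →
                    Odd k → (Q : Antipath G k u v) → ¬ InteriorIn Q B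

HasSkewPartition : ∀ {n} → SimpleGraph (Fin n) → Set
HasSkewPartition G = ∃₂ λ A B → SkewPartition G A B

HasBalancedSkewPartition : ∀ {n} → SimpleGraph (Fin n) → Set
HasBalancedSkewPartition G = ∃₂ λ A B → SkewPartition G A B × Balanced G A B

record Prism {n} (H : SimpleGraph (Fin n)) : Set where
  field
    a b       : Fin 3 → Fin n
    triangleᵃ : ∀ i j → i ≢ j → Adj H (a i) (a j)
    triangleᵇ : ∀ i j → i ≢ j → Adj H (b i) (b j)
    a≢b       : ∀ i j → a i ≢ b j
    len       : Fin 3 → ℕ
    path      : ∀ i → Path H (len i) (a i) (b i)
    cover     : ∀ v → ∃₂ λ i p → vertex (path i) p ≡ v
    disjoint  : ∀ i j → i ≢ j → ∀ p q → vertex (path i) p ≢ vertex (path j) q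
    onlyEdges : ∀ i j → i ≢ j → ∀ p q →
                Adj H (vertex (path i) p) (vertex (path j) q) →
                (vertex (path i) p ≡ a i × vertex (path j) q ≡ a j) ⊎
                (vertex (path i) p ≡ b i × vertex (path j) q ≡ b j)

LongPrism : ∀ {n} → SimpleGraph (Fin n) → Set
LongPrism H = Σ (Prism H) λ P → ∃[ i ] 1 < Prism.len P i

completeGraph : ∀ n → SimpleGraph (Fin n)
completeGraph n = record
  { Adj        = _≢_
  ; adj-sym    = _∘ sym
  ; adj-irrefl = λ u≡v u≢v → u≢v u≡v
  ; adj?       = λ u v → ¬? (u Fin.≟ v)
  }

deleteEdge : ∀ {n} → SimpleGraph (Fin n) → (x y : Fin n) → SimpleGraph (Fin n)
deleteEdge G x y = record
  { Adj        = λ u v → Adj G u v × ¬ (u ≡ x × v ≡ y) × ¬ (u ≡ y × v ≡ x)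
  ; adj-sym    = λ (uv , p , q) → adj-sym G uv , q ∘ swap , p ∘ swap
  ; adj-irrefl = λ u≡v (uv , _) → adj-irrefl G u≡v uv
  ; adj?       = λ u v → adj? G u v
               ×-dec ¬? ((u Fin.≟ x) ×-dec (v Fin.≟ y))
               ×-dec ¬? ((u Fin.≟ y) ×-dec (v Fin.≟ x))
  }

private
  pattern #2 = suc (suc zero)
  pattern #3 = suc (suc (suc zero))

diamond : SimpleGraph (Fin 4)
diamond = deleteEdge (completeGraph 4) #2 #3

-- inj₁ i is a_{i+1} and inj₂ i is b_{i+1}.
doubleDiamond : SimpleGraph (Fin 4 ⊎ Fin 4)
doubleDiamond = record
  { Adj        = DD
  ; adj-sym    = λ {u} {v} → symm u v
  ; adj-irrefl = λ { {u} refl → irr u }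
  ; adj?       = dec
  }
  where
  DD : Rel (Fin 4 ⊎ Fin 4) 0ℓ
  DD (inj₁ i) (inj₁ j) = Adj diamond i j
  DD (inj₁ i) (inj₂ j) = i ≡ j
  DD (inj₂ i) (inj₁ j) = i ≡ j
  DD (inj₂ i) (inj₂ j) = Adj diamond i j

  symm : ∀ u v → DD u v → DD v u
  symm (inj₁ _) (inj₁ _) = adj-sym diamond
  symm (inj₁ _) (inj₂ _) = sym
  symm (inj₂ _) (inj₁ _) = sym
  symm (inj₂ _) (inj₂ _) = adj-sym diamond

  irr : ∀ u → ¬ DD u u
  irr (inj₁ _) = adj-irrefl diamond refl
  irr (inj₂ _) = adj-irrefl diamond refl

  dec : Decidable DD
  dec (inj₁ i) (inj₁ j) = adj? diamond i j
  dec (inj₁ i) (inj₂ j) = i Fin.≟ j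
  dec (inj₂ i) (inj₁ j) = i Fin.≟ j
  dec (inj₂ i) (inj₂ j) = adj? diamond i j

-- The unordered pair {u , v} is represented with u < v; the proofs are
-- irrelevant so that an edge is determined by its ends.
record Edge {n} (H : SimpleGraph (Fin n)) : Set where
  constructor edge
  field
    u v  : Fin n
    .u<v : u <ᶠ v
    .uv  : Adj H u v

edge≟ : ∀ {n} {H : SimpleGraph (Fin n)} → DecidableEquality (Edge H)
edge≟ (edge u v _ _) (edge x y _ _) with u Fin.≟ x | v Fin.≟ y
... | yes refl | yes refl = yes refl
... | no  u≢x  | _        = no λ { refl → u≢x refl }
... | yes _    | no v≢y   = no λ { refl → v≢y refl }

ShareEnd : ∀ {n} {H : SimpleGraph (Fin n)} → Rel (Edge H) 0ℓ
ShareEnd (edge u v _ _) (edge x y _ _) = (u ≡ x ⊎ v ≡ y) ⊎ (u ≡ y ⊎ v ≡ x)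

lineGraph : ∀ {n} (H : SimpleGraph (Fin n)) → SimpleGraph (Edge H)
lineGraph H = record
  { Adj        = λ e f → e ≢ f × ShareEnd e f
  ; adj-sym    = map (_∘ sym)
                 (Sum.map (Sum.map sym sym) (Sum.swap ∘ Sum.map sym sym))
  ; adj-irrefl = λ e≡f (e≢f , _) → e≢f e≡f
  ; adj?       = λ e f → ¬? (edge≟ e f) ×-dec share? e f
  }
  where
  share? : Decidable (ShareEnd {H = H})
  share? (edge u v _ _) (edge x y _ _) =
    ((u Fin.≟ x) ⊎-dec (v Fin.≟ y)) ⊎-dec ((u Fin.≟ y) ⊎-dec (v Fin.≟ x))

-- Parts {0 , 1 , 2} and {3 , 4 , 5}.
K₃,₃ : SimpleGraph (Fin 6)
K₃,₃ = record
  { Adj        = λ u v → Cross u v ⊎ Cross v u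
  ; adj-sym    = Sum.swap
  ; adj-irrefl = λ { refl → Sum.[ irr , irr ] }
  ; adj?       = λ u v → cross? u v ⊎-dec cross? v u
  }
  where
  Cross : Rel (Fin 6) 0ℓ
  Cross u v = toℕ u < 3 × 3 ≤ toℕ v

  irr : ∀ {u} → ¬ Cross u u
  irr (u<3 , 3≤u) = ℕ.<⇒≱ u<3 3≤u

  cross? : Decidable Cross
  cross? u v = (toℕ u ℕ.<? 3) ×-dec (3 ℕ.≤? toℕ v)

-- All edges of K₃,₃ are equivalent under automorphisms; the one deleted
-- is {0 , 3}.
K₃,₃∖e : SimpleGraph (Fin 6)
K₃,₃∖e = deleteEdge K₃,₃ zero #3

L[K₃,₃∖e] : SimpleGraph (Edge K₃,₃∖e)
L[K₃,₃∖e] = lineGraph K₃,₃∖e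

ContainsLongPrism : ∀ {n} → SimpleGraph (Fin n) → Set₁
ContainsLongPrism G =
  ∃[ m ] Σ (SimpleGraph (Fin m)) λ H → LongPrism H × H ↪ G

ContainsExceptional : ∀ {n} → SimpleGraph (Fin n) → Set₁
ContainsExceptional G =
  ContainsLongPrism G ⊎ doubleDiamond ↪ G ⊎ L[K₃,₃∖e] ↪ G

{-# OPTIONS --safe #-}
module Submission where

-- Let (A , X) be a skew partition. If some vertex of X has no neighbour in a component of A (or dually),
-- the partition can be modified, moving vertices between A and X, until it is balanced. Otherwise
-- consider an odd path with ends in X and interior in a component of A. By the Roussel–Rubio lemma, applied
-- to an anticomponent of X not containing its ends, it yields a leap, hence a long prism, or it has length
-- three and its two inner vertices are joined by an odd antipath through that anticomponent. Repeating the argument in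
-- the complement and then once more in the graph produces eight vertices u-x-y-v, p-z-w-q, on which
-- the absence of holes and antiholes of length five leaves only the double diamond and L(K₃,₃ ∖ e).

open import Defs
open import Level using (0ℓ)
open import Data.Bool.Base using (Bool; true; false; not; _∧_; _∨_; _xor_)
open import Data.Bool.Properties using (not-involutive; not-distribˡ-xor; not-distribʳ-xor)
open import Data.Empty using (⊥; ⊥-elim)
open import Data.Fin.Base using (Fin)
import Data.Fin.Properties as Fin
open import Data.Fin.Subset using (Subset; _∈_; _∉_; _⊆_; _∪_; ⁅_⁆; ∣_∣; ∁; _-_)
open import Data.Fin.Subset.Properties
  using ( _∈?_; x∈⁅x⁆; x∈⁅y⁆⇒x≡y; p⊆p∪q; q⊆p∪q; x∈p∪q⁻; p⊂q⇒∣p∣<∣q∣; p⊆q⇒∣p∣≤∣q∣; ∣p∣≤n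
        ; x∈∁p⇒x∉p; x∉p⇒x∈∁p; x∉∁p⇒x∈p; x∈p⇒∣p-x∣<∣p∣; p─q⊆p; x∈p∧x≢y⇒x∈p-y)
open import Data.Nat.Base hiding (parity)
open import Data.Nat.Divisibility using (divides; ∣m∣n⇒∣m+n; ∣-refl)
open import Data.Nat.Properties
open import Data.Product using (Σ; ∃; _×_; _,_; proj₁; proj₂)
open import Data.Sum.Base using (_⊎_; inj₁; inj₂; [_,_]′)
open import Data.Vec.Base using (tabulate)
open import Data.Vec.Properties using (lookup∘tabulate; lookup⇒[]=; []=⇒lookup)
open import Function.Base using (_∘_; case_of_)
open import Relation.Binary.Construct.Closure.ReflexiveTransitive
  using (Star; ε; _◅_; _◅◅_; reverse; map; gmap)
open import Relation.Binary.Core using (Rel)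
open import Relation.Binary.Definitions using (Symmetric; Decidable; DecidableEquality; tri<; tri≈; tri>)
open import Relation.Binary.PropositionalEquality
open import Relation.Nullary
  using (¬_; yes; no; Dec; does; contradiction; recompute; ¬?; _×-dec_; _→-dec_; _⊎-dec_)
open import Relation.Nullary.Decidable using (dec-true; from-yes; True; toWitness)
import Relation.Unary as U

-- Parity of lengths

-- The Roussel-Rubio lemma rests on a count. Mark the path vertices complete to a set R. If no two
-- consecutive marks are at odd distance three or more, the number of edges with both ends marked
-- has the parity of the length of the path. For two sets with union T, no inner vertex carries both
-- marks, so on an odd path of length at least five the counts for the two sets add up to an even
-- count for the union. Hence some odd gap is bounded by one mark of each kind. The pairs of sets
-- used are T without a non-cut vertex x together with the set of x alone, and T without each of two
-- non-cut vertices; induction on the size of T removes the other gaps. Every argument is needed in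
-- the graph and in its complement, so edges and non-edges are a pair of relations that can be
-- exchanged. Arguments end in a fixed goal `Q` instead of a disjunction, because a leap or a
-- balanced partition may turn up at any depth. The final iteration uses two components of A and two
-- anticomponents of X alternately: the ends of each link avoid the set against which it is tested,
-- so they are complete to it.

parity : ℕ → Bool
parity zero    = false
parity (suc n) = not (parity n)

parity-+ : ∀ a b → parity (a + b) ≡ parity a xor parity b
parity-+ zero    b = refl
parity-+ (suc a) b =
  trans (cong not (parity-+ a b)) (not-distribˡ-xor (parity a) (parity b))

even⇒parity : ∀ {k} → Even k → parity k ≡ false
even⇒parity (divides zero    refl) = refl
even⇒parity (divides (suc q) refl) =
  trans (not-involutive _) (even⇒parity (divides q refl))

parity⇒even : ∀ k → parity k ≡ false → Even k
parity⇒even zero          _ = divides 0 refl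
parity⇒even (suc (suc k)) p =
  ∣m∣n⇒∣m+n ∣-refl (parity⇒even k (trans (sym (not-involutive _)) p))

odd⇒parity : ∀ {k} → Odd k → parity k ≡ true
odd⇒parity {k} o with parity k in eq
... | true  = refl
... | false = contradiction (parity⇒even k eq) o

true≢false : true ≡ false → ⊥
true≢false ()

odd-cases : ∀ {d} → parity d ≡ true → d ≡ 1 ⊎ d ≡ 3 ⊎ 5 ≤ d
odd-cases {1} _ = inj₁ refl
odd-cases {3} _ = inj₂ (inj₁ refl)
odd-cases {suc (suc (suc (suc (suc d))))} _ =
  inj₂ (inj₂ (s≤s (s≤s (s≤s (s≤s (s≤s z≤n))))))

-- Gaps between marked positions of a path

-- The parity of the number of positions j below m such that j and j + 1 are both marked.
edgeParity : (ℕ → Bool) → ℕ → Bool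
edgeParity D zero    = false
edgeParity D (suc m) = (D m ∧ D (suc m)) xor edgeParity D m

record OddGap (D : ℕ → Bool) (k : ℕ) : Set where
  field
    i d  : ℕ
    fits : i + d ≤ k
    lo   : D i ≡ true
    hi   : D (i + d) ≡ true
    none : ∀ c → 0 < c → c < d → D (i + c) ≡ false
    odd  : parity d ≡ true
    3≤d  : 3 ≤ d

-- The second alternative records the last marked position l up to m = l + d.
scan : ∀ D → D 0 ≡ true → ∀ m → OddGap D m ⊎
  Σ ℕ λ l → Σ ℕ λ d → l + d ≡ m × D l ≡ true ×
  (∀ c → 0 < c → c ≤ d → D (l + c) ≡ false) × edgeParity D m ≡ parity l
scan D D0 zero = inj₂ (0 , 0 , refl , D0 , (λ { (suc _) _ () }) , refl)
scan D D0 (suc m) with scan D D0 m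
... | inj₁ g = inj₁ record { OddGap g ; fits = m≤n⇒m≤1+n (OddGap.fits g) }
... | inj₂ (l , d , refl , Dl , none , e) with D (suc (l + d)) in eq
...   | false = inj₂ (l , suc d , +-suc l d , Dl , none′ , e′)
  where
  none′ : ∀ c → 0 < c → c ≤ suc d → D (l + c) ≡ false
  none′ c 0<c c≤ with m≤n⇒m<n∨m≡n c≤
  ... | inj₁ (s≤s c≤d) = none c 0<c c≤d
  ... | inj₂ refl      = trans (cong D (+-suc l d)) eq
  e′ : (D (l + d) ∧ false) xor edgeParity D (l + d) ≡ parity l
  e′ with D (l + d)
  ... | true  = e
  ... | false = e
scan D D0 (suc m) | inj₂ (l , zero , refl , Dl , none , e) | true =
  inj₂ (suc (l + 0) , 0 , +-identityʳ _ , eq , (λ { (suc _) _ () }) , e′)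
  where
  e′ : (D (l + 0) ∧ true) xor edgeParity D (l + 0) ≡ not (parity (l + 0))
  e′ rewrite +-identityʳ l | Dl = cong not e
scan D D0 (suc m) | inj₂ (l , suc d , refl , Dl , none , e) | true with parity (suc (suc d)) in pd
... | true = inj₁ record
  { i = l ; d = suc (suc d) ; fits = ≤-reflexive (+-suc l (suc d)) ; lo = Dl
  ; hi = trans (cong D (+-suc l (suc d))) eq
  ; none = λ { c 0<c (s≤s c≤d) → none c 0<c c≤d } ; odd = pd ; 3≤d = 3≤ d pd }
  where
  3≤ : ∀ d → parity (suc (suc d)) ≡ true → 3 ≤ suc (suc d)
  3≤ (suc d) _ = s≤s (s≤s (s≤s z≤n))
-- A gap of even length contains no edge with both ends marked and does not change the parity of the
-- last marked position.
... | false = inj₂ (suc (l + suc d) , 0 , +-identityʳ _ , eq , (λ { (suc _) _ () }) , e′)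
  where
  e′ : (D (l + suc d) ∧ true) xor edgeParity D (l + suc d) ≡ not (parity (l + suc d))
  e′ rewrite none (suc d) (s≤s z≤n) ≤-refl | e | parity-+ l (suc d) =
    sym (trans (cong (λ b → not (parity l xor b)) (trans (sym (not-involutive _)) (cong not pd))) (lem (parity l)))
    where
    lem : ∀ b → not (b xor true) ≡ b
    lem true  = refl
    lem false = refl

-- The marks cut the interval from 0 to k into gaps. If none is odd of length at least three, the
-- odd gaps are exactly the edges with both ends marked, so their number has the parity of k.
gap-or-parity : ∀ D k → D 0 ≡ true → D k ≡ true → OddGap D k ⊎ edgeParity D k ≡ parity k
gap-or-parity D k D0 Dk with scan D D0 k
... | inj₁ g = inj₁ g
... | inj₂ (l , zero  , refl , _ , _ , e) = inj₂ (trans e (cong parity (sym (+-identityʳ l))))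
... | inj₂ (l , suc d , refl , _ , none , _)
  with () ← trans (sym Dk) (none (suc d) (s≤s z≤n) ≤-refl)

edge-exists : ∀ D k → edgeParity D k ≡ true →
  Σ ℕ λ j → j < k × D j ≡ true × D (suc j) ≡ true
edge-exists D (suc k) p with D k in eq | D (suc k) in eq′
... | true  | true  = k , ≤-refl , eq , eq′
... | true  | false = let j , j<k , a , b = edge-exists D k p in j , m≤n⇒m≤1+n j<k , a , b
... | false | _     = let j , j<k , a , b = edge-exists D k p in j , m≤n⇒m≤1+n j<k , a , b

-- Two markings of the same path

record CrossGap (V W : ℕ → Bool) (k : ℕ) : Set where
  field
    i d  : ℕ
    fits : i + d ≤ k
    loᵛ  : V i ≡ true
    loʷ  : W i ≡ false
    hiᵛ  : V (i + d) ≡ false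
    hiʷ  : W (i + d) ≡ true
    noneᵛ : ∀ c → 0 < c → c < d → V (i + c) ≡ false
    noneʷ : ∀ c → 0 < c → c < d → W (i + c) ≡ false
    odd  : parity d ≡ true

data Interleaving (V W : ℕ → Bool) (k : ℕ) : Set where
  gapˡ   : OddGap V k → Interleaving V W k
  gapʳ   : OddGap W k → Interleaving V W k
  both   : ∀ m → m < k → V m ≡ true → W m ≡ true →
           V (suc m) ≡ true → W (suc m) ≡ true → Interleaving V W k
  crossˡ : CrossGap V W k → Interleaving V W k
  crossʳ : CrossGap W V k → Interleaving V W k

∨-false : ∀ {a b} → a ∨ b ≡ false → a ≡ false × b ≡ false
∨-false {false} {false} _ = refl , refl

module _ (V W : ℕ → Bool) where
  private
    U : ℕ → Bool
    U i = V i ∨ W i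

    -- An edge of the union that belongs to neither marking has one end marked only in V and the
    -- other only in W, a cross gap of length one. An edge of both markings is the case `both`.
    -- Otherwise each edge of the union is counted exactly once.
    edge-split : ∀ k → edgeParity U k ≡ edgeParity V k xor edgeParity W k ⊎ Interleaving V W k
    edge-split zero    = inj₁ refl
    edge-split (suc m) with edge-split m
    ... | inj₂ r = inj₂ (weaken r)
      where
      weaken : Interleaving V W m → Interleaving V W (suc m)
      weaken (gapˡ g) = gapˡ record { OddGap g ; fits = m≤n⇒m≤1+n (OddGap.fits g) }
      weaken (gapʳ g) = gapʳ record { OddGap g ; fits = m≤n⇒m≤1+n (OddGap.fits g) }
      weaken (both m m<k a b c d) = both m (m≤n⇒m≤1+n m<k) a b c d
      weaken (crossˡ g) = crossˡ record { CrossGap g ; fits = m≤n⇒m≤1+n (CrossGap.fits g) }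
      weaken (crossʳ g) = crossʳ record { CrossGap g ; fits = m≤n⇒m≤1+n (CrossGap.fits g) }
    ... | inj₁ e rewrite e with V m in vm | W m in wm | V (suc m) in vm′ | W (suc m) in wm′
    ... | true | true | true | true = inj₂ (both m ≤-refl vm wm vm′ wm′)
    ... | true | false | false | true = inj₂ (crossˡ (record
      { i = m ; d = 1 ; fits = ≤-reflexive (+-comm m 1) ; loᵛ = vm ; loʷ = wm
      ; hiᵛ = trans (cong V (+-comm m 1)) vm′ ; hiʷ = trans (cong W (+-comm m 1)) wm′
      ; noneᵛ = λ { (suc _) _ (s≤s ()) } ; noneʷ = λ { (suc _) _ (s≤s ()) } ; odd = refl }))
    ... | false | true | true | false = inj₂ (crossʳ (record
      { i = m ; d = 1 ; fits = ≤-reflexive (+-comm m 1) ; loᵛ = wm ; loʷ = vm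
      ; hiᵛ = trans (cong W (+-comm m 1)) wm′ ; hiʷ = trans (cong V (+-comm m 1)) vm′
      ; noneᵛ = λ { (suc _) _ (s≤s ()) } ; noneʷ = λ { (suc _) _ (s≤s ()) } ; odd = refl }))
    ... | true | true | true | false = inj₁ (not-distribˡ-xor (edgeParity V m) (edgeParity W m))
    ... | true | true | false | true = inj₁ (not-distribʳ-xor (edgeParity V m) (edgeParity W m))
    ... | true | true | false | false = inj₁ refl
    ... | true | false | true | true = inj₁ (not-distribˡ-xor (edgeParity V m) (edgeParity W m))
    ... | true | false | true | false = inj₁ (not-distribˡ-xor (edgeParity V m) (edgeParity W m))
    ... | true | false | false | false = inj₁ refl
    ... | false | true | true | true = inj₁ (not-distribʳ-xor (edgeParity V m) (edgeParity W m))
    ... | false | true | false | true = inj₁ (not-distribʳ-xor (edgeParity V m) (edgeParity W m))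
    ... | false | true | false | false = inj₁ refl
    ... | false | false | _ | _ = inj₁ refl

  -- Without odd gaps in V and W both edge counts are odd, so by `edge-split` the count for the
  -- union is even, while k is odd. Hence the union has an odd gap. If one marking holds at both
  -- ends, the gap is an odd gap of that marking, otherwise it is a cross gap.
  interleave : ∀ k → parity k ≡ true → V 0 ≡ true → W 0 ≡ true → V k ≡ true → W k ≡ true →
               Interleaving V W k
  interleave k pk V0 W0 Vk Wk
    with gap-or-parity V k V0 Vk | gap-or-parity W k W0 Wk | edge-split k
       | gap-or-parity U k (cong (_∨ W 0) V0) (cong (_∨ W k) Vk)
  ... | inj₁ g | _ | _ | _ = gapˡ g
  ... | _ | inj₁ g | _ | _ = gapʳ g
  ... | _ | _ | inj₂ r | _ = r
  ... | inj₂ v | inj₂ w | inj₁ e | inj₂ u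
    with () ← trans (sym (trans u pk)) (trans e (cong₂ _xor_ (trans v pk) (trans w pk)))
  interleave k pk V0 W0 Vk Wk | inj₂ v | inj₂ w | inj₁ e | inj₁ g = classify
    where
    open OddGap g
    noneᵛ : ∀ c → 0 < c → c < d → V (i + c) ≡ false
    noneᵛ c 0<c c<d = proj₁ (∨-false (none c 0<c c<d))
    noneʷ : ∀ c → 0 < c → c < d → W (i + c) ≡ false
    noneʷ c 0<c c<d = proj₂ (∨-false {V (i + c)} (none c 0<c c<d))
    classify : Interleaving V W k
    classify with V i in vi | W i in wi | V (i + d) in vj | W (i + d) in wj | lo | hi
    ... | true | _ | true | _ | _ | _ = gapˡ record
      { i = i ; d = d ; fits = fits ; lo = vi ; hi = vj ; none = noneᵛ ; odd = odd ; 3≤d = 3≤d }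
    ... | _ | true | _ | true | _ | _ = gapʳ record
      { i = i ; d = d ; fits = fits ; lo = wi ; hi = wj ; none = noneʷ ; odd = odd ; 3≤d = 3≤d }
    ... | true | false | false | true | _ | _ = crossˡ record
      { i = i ; d = d ; fits = fits ; loᵛ = vi ; loʷ = wi ; hiᵛ = vj ; hiʷ = wj
      ; noneᵛ = noneᵛ ; noneʷ = noneʷ ; odd = odd }
    ... | false | true | true | false | _ | _ = crossʳ record
      { i = i ; d = d ; fits = fits ; loᵛ = wi ; loʷ = vi ; hiᵛ = wj ; hiʷ = vj
      ; noneᵛ = noneʷ ; noneʷ = noneᵛ ; odd = odd }
    ... | false | false | _ | _ | () | _
    ... | _ | _ | false | false | _ | ()

-- E and N stand for adjacency and non-adjacency of distinct vertices; exchanging them is complementation.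

record IsPath {V : Set} (E N : Rel V 0ℓ) (f : ℕ → V) (k : ℕ) : Set where
  field
    step : ∀ i → i < k → E (f i) (f (suc i))
    far  : ∀ i j → suc i < j → j ≤ k → N (f i) (f j)

infixr 5 _◂_
_◂_ : {V : Set} → V → (ℕ → V) → ℕ → V
(v ◂ f) zero    = v
(v ◂ f) (suc i) = f i

-- The joint is supplied by `g 0`: `f k` is left out, and the two must agree wherever paths are
-- joined.
glue : {V : Set} → ℕ → (ℕ → V) → (ℕ → V) → ℕ → V
glue zero    f g = g
glue (suc k) f g = f 0 ◂ glue k (f ∘ suc) g

glue-all : {V : Set} (P : V → Set) (k l : ℕ) (f g : ℕ → V) →
           (∀ i → i < k → P (f i)) → (∀ i → i ≤ l → P (g i)) →
           ∀ i → i ≤ k + l → P (glue k f g i)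
glue-all P zero    l f g pf pg i       i≤  = pg i i≤
glue-all P (suc k) l f g pf pg zero    i≤  = pf 0 (s≤s z≤n)
glue-all P (suc k) l f g pf pg (suc i) (s≤s i≤) =
  glue-all P k l (f ∘ suc) g (λ i i<k → pf (suc i) (s≤s i<k)) pg i i≤

glue-start : {V : Set} (k : ℕ) (f g : ℕ → V) → f k ≡ g 0 → glue k f g 0 ≡ f 0
glue-start zero    f g eq = sym eq
glue-start (suc k) f g eq = refl

glue-end : {V : Set} (k l : ℕ) (f g : ℕ → V) → glue k f g (k + l) ≡ g l
glue-end zero    l f g = refl
glue-end (suc k) l f g = glue-end k l (f ∘ suc) g

module _ {V : Set} {E N : Rel V 0ℓ} where

  single : ∀ v → IsPath E N (λ _ → v) 0
  single v = record { step = λ _ () ; far = λ { i .0 (()) z≤n } }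

  cons : ∀ {f k v} → E v (f 0) → (∀ i → 0 < i → i ≤ k → N v (f i)) →
         IsPath E N f k → IsPath E N (v ◂ f) (suc k)
  cons {f} {k} {v} e n p = record { step = st ; far = fr }
    where
    open IsPath p
    st : ∀ i → i < suc k → E ((v ◂ f) i) (f i)
    st zero    _         = e
    st (suc i) (s≤s i<k) = step i i<k
    fr : ∀ i j → suc i < j → j ≤ suc k → N ((v ◂ f) i) ((v ◂ f) j)
    fr zero    (suc j) (s≤s 0<j) (s≤s j≤k) = n j 0<j j≤k
    fr (suc i) (suc j) (s≤s i<j) (s≤s j≤k) = far i j i<j j≤k

  segment : ∀ {f k} i {d} → i + d ≤ k → IsPath E N f k → IsPath E N (λ c → f (i + c)) d
  segment {f} i {d} i+d≤k p = record
    { step = λ c c<d → subst (E _) (cong f (sym (+-suc i c)))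
               (step (i + c) (<-≤-trans (+-monoʳ-< i c<d) i+d≤k))
    ; far = λ a b a<b b≤d → far (i + a) (i + b)
               (subst (_< i + b) (+-suc i a) (+-monoʳ-< i a<b)) (≤-trans (+-monoʳ-≤ i b≤d) i+d≤k)
    }
    where open IsPath p

  prefix : ∀ {f k d} → d ≤ k → IsPath E N f k → IsPath E N f d
  prefix d≤k p = segment 0 d≤k p

  reversed : Symmetric E → Symmetric N → ∀ {f k} → IsPath E N f k → IsPath E N (λ i → f (k ∸ i)) k
  reversed E-sym N-sym {f} {k} p = record
    { step = λ i i<k → E-sym (subst (λ j → E (f (k ∸ suc i)) (f j)) (sym (∸-suc′ i k i<k))
               (step (k ∸ suc i) (∸-monoʳ-< (s≤s z≤n) i<k)))
    ; far = λ i j i<j j≤k → N-sym (far (k ∸ j) (k ∸ i)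
               (≤-trans (s≤s (s≤s (∸-monoʳ-≤ k i<j)))
                 (subst (λ c → suc c ≤ k ∸ i)
                   (∸-suc′ (suc i) k (<-≤-trans i<j j≤k))
                   (subst (_≤ k ∸ i) (∸-suc′ i k (<-trans (n<1+n i) (<-≤-trans i<j j≤k))) ≤-refl)))
               (m∸n≤m k i))
    }
    where
    open IsPath p
    ∸-suc′ : ∀ i k → i < k → k ∸ i ≡ suc (k ∸ suc i)
    ∸-suc′ zero    (suc k) _         = refl
    ∸-suc′ (suc i) (suc k) (s≤s i<k) = ∸-suc′ i k i<k

  glued : ∀ {f g} k {l} → IsPath E N f k → IsPath E N g l → f k ≡ g 0 →
          (∀ i j → i < k → 0 < j → j ≤ l → N (f i) (g j)) → IsPath E N (glue k f g) (k + l)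
  glued zero    p q eq n = q
  glued {f} {g} (suc k) {l} p q eq n = cons
    (subst (E (f 0)) (sym (glue-start k (f ∘ suc) g eq)) (IsPath.step p 0 (s≤s z≤n)))
    far₀
    (glued k (segment 1 ≤-refl p) q eq (λ i j i<k → n (suc i) j (s≤s i<k)))
    where
    far₀ : ∀ i → 0 < i → i ≤ k + l → N (f 0) (glue k (f ∘ suc) g i)
    far₀ i 0<i i≤ = go k p eq n i 0<i i≤
      where
      go : ∀ k → IsPath E N f (suc k) → f (suc k) ≡ g 0 →
           (∀ i j → i < suc k → 0 < j → j ≤ l → N (f i) (g j)) →
           ∀ i → 0 < i → i ≤ k + l → N (f 0) (glue k (f ∘ suc) g i)
      go zero    p eq n i       0<i i≤       = n 0 i (s≤s z≤n) 0<i i≤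
      go (suc k) p eq n (suc i) _   (s≤s i≤) = glue-all (N (f 0)) k l (f ∘ suc ∘ suc) g
        (λ c c<k → IsPath.far p 0 (suc (suc c)) (s≤s (s≤s z≤n)) (s≤s (s≤s (<⇒≤ c<k))))
        (λ { zero _ → subst (N (f 0)) eq (IsPath.far p 0 (suc (suc k)) (s≤s (s≤s z≤n)) ≤-refl)
           ; (suc c) c≤l → n 0 (suc c) (s≤s z≤n) (s≤s z≤n) c≤l }) i i≤

-- The hole conditions are stated for a path closed up by one further vertex.
EvenHoles : {V : Set} (E N : Rel V 0ℓ) → Set
EvenHoles E N = ∀ k f v → 2 ≤ k → IsPath E N f k → E v (f 0) → E v (f k) →
  (∀ i → 0 < i → i < k → N v (f i)) → parity k ≡ false

-- Parities forced by holes

module Holes {V : Set} {E N : Rel V 0ℓ} (E-sym : Symmetric E) (N-sym : Symmetric N)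
             (even : EvenHoles E N) where

  -- The hole is v, `f 0`, ..., `f k`, w, of length k + 3.
  close₂ : ∀ {k f v w} → 1 ≤ k → IsPath E N f k →
           E v (f 0) → (∀ i → 0 < i → i ≤ k → N v (f i)) →
           E w (f k) → (∀ i → i < k → N w (f i)) → E v w → parity k ≡ true
  close₂ {k} {f} {v} {w} 1≤k p v0 vn wk wn vw =
    not-false (even (suc k) (v ◂ f) w (s≤s 1≤k) (cons v0 vn p) (E-sym vw) wk
      (λ { (suc i) _ (s≤s i<k) → wn i i<k }))
    where
    not-false : ∀ {b} → not b ≡ false → b ≡ true
    not-false {true} _ = refl

  -- The hole is e, v, `f 0`, ..., `f k`, w, of length k + 4.
  close₃ : ∀ {k f v w e} → 1 ≤ k → IsPath E N f k →
           E v (f 0) → (∀ i → 0 < i → i ≤ k → N v (f i)) →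
           E w (f k) → (∀ i → i < k → N w (f i)) → N v w →
           E e v → E e w → (∀ i → i ≤ k → N e (f i)) → parity k ≡ false
  close₃ {k} {f} {v} {w} {e} 1≤k p v0 vn wk wn nvw ev ew en =
    not-true (close₂ {suc k} {v ◂ f} {e} {w} (s≤s z≤n) (cons v0 vn p) ev
      (λ { (suc i) _ (s≤s i≤k) → en i i≤k }) wk
      (λ { zero _ → N-sym nvw ; (suc i) (s≤s i<k) → wn i i<k }) ew)
    where
    not-true : ∀ {b} → not b ≡ true → b ≡ false
    not-true {false} _ = refl

  -- The two paths form a hole of length k + l. It is cut open at the common start: what remains
  -- runs along f from `f 1` to the common end and back along g to `g 1`.
  close-paths : ∀ {k l f g} → 2 ≤ k → 2 ≤ l → IsPath E N f k → IsPath E N g l →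
                f 0 ≡ g 0 → f k ≡ g l →
                (∀ i j → 0 < i → i < k → 0 < j → j < l → N (f i) (g j)) → parity k ≡ parity l
  close-paths {suc (suc k)} {suc (suc l)} {f} {g} (s≤s (s≤s _)) (s≤s (s≤s _)) p q eq₀ eq₁ n =
    same (even (suc k + suc l) h (g 0) (s≤s (m≤n⇒m≤o+n k (s≤s z≤n))) path start end mid)
    where
    open IsPath
    g⁻ : ℕ → V
    g⁻ i = g (suc (suc l ∸ i))
    q⁻ : IsPath E N g⁻ (suc l)
    q⁻ = reversed E-sym N-sym (segment 1 ≤-refl q)
    h : ℕ → V
    h = glue (suc k) (f ∘ suc) g⁻
    path : IsPath E N h (suc k + suc l)
    path = glued (suc k) (segment 1 ≤-refl p) q⁻ eq₁
      (λ i j i<k 0<j j≤l → n (suc i) (suc (suc l ∸ j)) (s≤s z≤n) (s≤s i<k) (s≤s z≤n)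
         (s≤s (∸-monoʳ-< 0<j j≤l)))
    start : E (g 0) (h 0)
    start = subst (λ v → E v (f 1)) eq₀ (step p 0 (s≤s z≤n))
    end : E (g 0) (h (suc k + suc l))
    end = subst (E (g 0)) (sym (trans (glue-end k (suc l) (f ∘ suc ∘ suc) g⁻) (cong (g ∘ suc) (n∸n≡0 (suc l)))))
                (step q 0 (s≤s z≤n))
    mid : ∀ i → 0 < i → i < suc k + suc l → N (g 0) (h i)
    mid (suc i) _ (s≤s i<) = glue-all (N (g 0)) k l (f ∘ suc ∘ suc) g⁻
      (λ c c<k → subst (λ v → N v _) eq₀ (far p 0 (suc (suc c)) (s≤s (s≤s z≤n)) (s≤s (s≤s (<⇒≤ c<k)))))
      (λ c c≤l → far q 0 (suc (suc l ∸ c)) (s≤s (m<n⇒0<n∸m (s≤s c≤l))) (s≤s (m∸n≤m (suc l) c)))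
      i (s≤s⁻¹ (subst (suc i ≤_) (+-suc k l) i<))
    same : parity (suc k + suc l) ≡ false → parity (suc (suc k)) ≡ parity (suc (suc l))
    same e rewrite +-suc k l | parity-+ k l with parity k | parity l
    ... | true  | true  = refl
    ... | false | false = refl
    ... | true  | false with () ← e
    same () | false | true

-- Subsets, connectedness and induced paths

module _ {n : ℕ} {P : Fin n → Set} (P? : U.Decidable P) where

  comprehension : Subset n
  comprehension = tabulate (λ v → does (P? v))

  ∈-comprehension⁺ : ∀ {v} → P v → v ∈ comprehension
  ∈-comprehension⁺ {v} p = lookup⇒[]= v comprehension (trans (lookup∘tabulate _ v) true-does)
    where
    true-does : does (P? v) ≡ true
    true-does with P? v
    ... | yes _ = refl
    ... | no ¬p = contradiction p ¬p

  ∈-comprehension⁻ : ∀ {v} → v ∈ comprehension → P v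
  ∈-comprehension⁻ {v} v∈ with P? v in eq
  ... | yes p = p
  ... | no _ with () ← trans (sym ([]=⇒lookup v∈)) (trans (lookup∘tabulate _ v) (cong does eq))

module _ {n : ℕ} where

  private V = Fin n

  Within : Rel V 0ℓ → (V → Set) → Rel V 0ℓ
  Within E X a b = E a b × X a × X b

  Connected : Rel V 0ℓ → Subset n → Set
  Connected E S = ∀ {u v} → u ∈ S → v ∈ S → Star (Within E (_∈ S)) u v

  within-mono : ∀ {E X Y} → (∀ {v} → X v → Y v) → ∀ {u v} → Star (Within E X) u v → Star (Within E Y) u v
  within-mono X⊆Y = map (λ (e , x , y) → e , X⊆Y x , X⊆Y y)

  crossing : ∀ {E X} (S : Subset n) {u v} → Star (Within E X) u v → u ∈ S → v ∉ S →
             ∃ λ a → ∃ λ b → a ∈ S × b ∉ S × E a b × X a × X b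
  crossing S ε u∈ v∉ = contradiction u∈ v∉
  crossing S (_◅_ {j = w} (e , x , y) ws) u∈ v∉ with w ∈? S
  ... | yes w∈ = crossing S ws w∈ v∉
  ... | no  w∉ = _ , _ , u∈ , w∉ , e , x , y

  ∪-insert : ∀ (S : Subset n) {b} → S ⊆ S ∪ ⁅ b ⁆
  ∪-insert S = p⊆p∪q _

  ∈-insert : ∀ (S : Subset n) b → b ∈ S ∪ ⁅ b ⁆
  ∈-insert S b = q⊆p∪q S _ (x∈⁅x⁆ b)

  insert⁻ : ∀ (S : Subset n) {b v} → v ∈ S ∪ ⁅ b ⁆ → v ∈ S ⊎ v ≡ b
  insert⁻ S {b} v∈ with x∈p∪q⁻ S ⁅ b ⁆ v∈
  ... | inj₁ v∈S = inj₁ v∈S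
  ... | inj₂ v∈b = inj₂ (x∈⁅y⁆⇒x≡y b v∈b)

  insert-⊆ : ∀ {S T : Subset n} {b} → S ⊆ T → b ∈ T → S ∪ ⁅ b ⁆ ⊆ T
  insert-⊆ {S} S⊆T b∈T v∈ with insert⁻ S v∈
  ... | inj₁ v∈S  = S⊆T v∈S
  ... | inj₂ refl = b∈T

  ∣insert∣ : ∀ (S : Subset n) {b} → b ∉ S → ∣ S ∣ < ∣ S ∪ ⁅ b ⁆ ∣
  ∣insert∣ S {b} b∉ = p⊂q⇒∣p∣<∣q∣ (∪-insert S , b , ∈-insert S b , b∉)

  image : ℕ → (ℕ → V) → Subset n
  image zero    g = ⁅ g 0 ⁆
  image (suc m) g = image m g ∪ ⁅ g (suc m) ⁆

  ∈-image⁺ : ∀ m g {i} → i ≤ m → g i ∈ image m g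
  ∈-image⁺ zero    g z≤n = x∈⁅x⁆ _
  ∈-image⁺ (suc m) g i≤ with m≤n⇒m<n∨m≡n i≤
  ... | inj₁ (s≤s i≤m) = ∪-insert (image m g) (∈-image⁺ m g i≤m)
  ... | inj₂ refl      = ∈-insert (image m g) _

  ∈-image⁻ : ∀ m g {v} → v ∈ image m g → ∃ λ i → i ≤ m × v ≡ g i
  ∈-image⁻ zero    g v∈ = 0 , z≤n , x∈⁅y⁆⇒x≡y _ v∈
  ∈-image⁻ (suc m) g v∈ with insert⁻ (image m g) v∈
  ... | inj₁ v∈′ = let i , i≤ , eq = ∈-image⁻ m g v∈′ in i , m≤n⇒m≤1+n i≤ , eq
  ... | inj₂ eq  = suc m , ≤-refl , eq

  subset? : ∀ (S T : Subset n) → S ⊆ T ⊎ ∃ λ v → v ∈ S × v ∉ T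
  subset? S T with Fin.any? (λ v → (v ∈? S) ×-dec ¬? (v ∈? T))
  ... | yes w = inj₂ w
  ... | no ¬w = inj₁
    (λ {v} v∈S → case v ∈? T of λ { (yes v∈T) → v∈T ; (no v∉T) → contradiction (v , v∈S , v∉T) ¬w })

last-index : {P : ℕ → Set} → U.Decidable P → ∀ k → P 0 →
             ∃ λ j → j ≤ k × P j × (∀ i → j < i → i ≤ k → ¬ P i)
last-index P? zero    p = 0 , z≤n , p , λ i 0<i i≤0 → contradiction i≤0 (<⇒≱ 0<i)
last-index P? (suc k) p with P? (suc k)
... | yes q = suc k , ≤-refl , q , λ i k<i i≤k → contradiction i≤k (<⇒≱ k<i)
... | no ¬q with last-index P? k p
... | j , j≤k , Pj , none = j , m≤n⇒m≤1+n j≤k , Pj , none′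
  where
  none′ : ∀ i → j < i → i ≤ suc k → ¬ _
  none′ i j<i i≤ with m≤n⇒m<n∨m≡n i≤
  ... | inj₁ (s≤s i≤k) = none i j<i i≤k
  ... | inj₂ refl      = ¬q

module Connectivity {n : ℕ} {E N : Rel (Fin n) 0ℓ} (E-sym : Symmetric E) (E? : Decidable E)
                    (notE : ∀ {u v} → u ≢ v → ¬ E u v → N u v) where

  private V = Fin n

  connected-single : ∀ a → Connected E ⁅ a ⁆
  connected-single a u∈ v∈ with refl ← x∈⁅y⁆⇒x≡y a u∈ | refl ← x∈⁅y⁆⇒x≡y a v∈ = ε

  connected-insert : ∀ {S : Subset n} {a b} → Connected E S → a ∈ S → E a b → Connected E (S ∪ ⁅ b ⁆)
  connected-insert {S} {a} {b} conn a∈ e u∈ v∈ = reverse flip (from u∈) ◅◅ from v∈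
    where
    S′ = S ∪ ⁅ b ⁆
    flip : ∀ {u v} → Within E (_∈ S′) u v → Within E (_∈ S′) v u
    flip (e , x , y) = E-sym e , y , x
    from : ∀ {v} → v ∈ S′ → Star (Within E (_∈ S′)) a v
    from v∈ with insert⁻ S v∈
    ... | inj₁ v∈S  = within-mono (∪-insert S) (conn a∈ v∈S)
    ... | inj₂ refl = (e , ∪-insert S a∈ , v∈) ◅ ε

  connected-image : ∀ {g} m → IsPath E N g m → Connected E (image m g)
  connected-image zero    p = connected-single _
  connected-image {g} (suc m) p = connected-insert (connected-image m (prefix (n≤1+n m) p))
    (∈-image⁺ m g ≤-refl) (IsPath.step p m ≤-refl)

  record Component (X : Subset n) (a : V) : Set where
    field
      S      : Subset n
      a∈S    : a ∈ S
      S⊆X    : S ⊆ X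
      conn   : Connected E S
      closed : ∀ {s v} → s ∈ S → v ∈ X → E s v → v ∈ S

  abstract
    component : ∀ X {a} → a ∈ X → Component X a
    component X {a} a∈X = grow n ⁅ a ⁆ (m≤m+n n _) (x∈⁅x⁆ a)
      (λ v∈ → subst (_∈ X) (sym (x∈⁅y⁆⇒x≡y a v∈)) a∈X) (connected-single a)
      where
      grow : ∀ m S → n ≤ m + ∣ S ∣ → a ∈ S → S ⊆ X → Connected E S → Component X a
      grow m S m≥ a∈S S⊆X conn
        with Fin.any? (λ v → ((v ∈? X) ×-dec ¬? (v ∈? S)) ×-dec Fin.any? (λ s → (s ∈? S) ×-dec E? s v))
      ... | no none = record { S = S ; a∈S = a∈S ; S⊆X = S⊆X ; conn = conn ; closed = closed }
        where
        closed : ∀ {s v} → s ∈ S → v ∈ X → E s v → v ∈ S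
        closed {s} {v} s∈ v∈X e with v ∈? S
        ... | yes v∈S = v∈S
        ... | no  v∉S = contradiction (v , (v∈X , v∉S) , s , s∈ , e) none
      grow zero    S m≥ a∈S S⊆X conn | yes (v , (v∈X , v∉S) , s , s∈ , e) =
        contradiction (≤-trans (∣insert∣ S v∉S) (∣p∣≤n (S ∪ ⁅ v ⁆))) (≤⇒≯ m≥)
      grow (suc m) S m≥ a∈S S⊆X conn | yes (v , (v∈X , v∉S) , s , s∈ , e) =
        grow m (S ∪ ⁅ v ⁆) (≤-trans m≥ (≤-trans (≤-reflexive (sym (+-suc m ∣ S ∣))) (+-monoʳ-≤ m (∣insert∣ S v∉S))))
          (∪-insert S a∈S) (insert-⊆ S⊆X v∈X) (connected-insert conn s∈ e)

  -- R is T without x. The neighbour s of x makes R nonempty; when the record is read in the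
  -- complement, s also shows that x is not complete to R.
  record NonCut (T : Subset n) (x : V) : Set where
    field
      R    : Subset n
      R⊆T  : R ⊆ T
      x∈T  : x ∈ T
      x∉R  : x ∉ R
      rest : ∀ {t} → t ∈ T → t ∈ R ⊎ t ≡ x
      conn : Connected E R
      s    : V
      s∈R  : s ∈ R
      sx   : E s x

    ∣R∣<∣T∣ : ∣ R ∣ < ∣ T ∣
    ∣R∣<∣T∣ = p⊂q⇒∣p∣<∣q∣ ((λ v∈ → R⊆T v∈) , x , x∈T , x∉R)

  abstract
    -- Grow S inside T one vertex at a time; the last vertex added is not a cut vertex.
    noncut-outside : ∀ {T S : Subset n} → Connected E T → S ⊆ T → Connected E S → (∃ λ a → a ∈ S) →
                     T ⊆ S ⊎ ∃ λ x → Σ (NonCut T x) λ c → S ⊆ NonCut.R c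
    noncut-outside {T} {S₀} connT S₀⊆T connS₀ (a₀ , a₀∈S₀) with subset? T S₀
    ... | inj₁ T⊆S = inj₁ T⊆S
    ... | inj₂ (v₀ , v₀∈T , v₀∉S₀) = inj₂ (grow n S₀ (m≤m+n n _) (λ v∈ → v∈) S₀⊆T connS₀ v₀∈T v₀∉S₀)
      where
      grow : ∀ m S → n ≤ m + ∣ S ∣ → S₀ ⊆ S → S ⊆ T → Connected E S →
             ∀ {v} → v ∈ T → v ∉ S → ∃ λ x → Σ (NonCut T x) λ c → S₀ ⊆ NonCut.R c
      grow m S m≥ S₀⊆S S⊆T connS v∈T v∉S with crossing S (connT (S₀⊆T a₀∈S₀) v∈T) (S₀⊆S a₀∈S₀) v∉S
      ... | a , b , a∈S , b∉S , e , _ , b∈T with subset? T (S ∪ ⁅ b ⁆)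
      ... | inj₁ T⊆ = b , record
        { R = S ; R⊆T = S⊆T ; x∈T = b∈T ; x∉R = b∉S ; rest = λ t∈ → insert⁻ S (T⊆ t∈)
        ; conn = connS ; s = a ; s∈R = a∈S ; sx = e } , S₀⊆S
      grow zero    S m≥ _ _ _ _ _ | a , b , a∈S , b∉S , e , _ , b∈T | inj₂ _ =
        contradiction (≤-trans (∣insert∣ S b∉S) (∣p∣≤n (S ∪ ⁅ b ⁆))) (≤⇒≯ m≥)
      grow (suc m) S m≥ S₀⊆S S⊆T connS _ _ | a , b , a∈S , b∉S , e , _ , b∈T | inj₂ (v , v∈T , v∉) =
        grow m (S ∪ ⁅ b ⁆) (≤-trans m≥ (≤-trans (≤-reflexive (sym (+-suc m ∣ S ∣))) (+-monoʳ-≤ m (∣insert∣ S b∉S))))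
          (λ v∈ → ∪-insert S (S₀⊆S v∈)) (insert-⊆ S⊆T b∈T) (connected-insert connS a∈S e) v∈T v∉

  record PathIn (X : V → Set) (a b : V) : Set where
    field
      len    : ℕ
      f      : ℕ → V
      isPath : IsPath E N f len
      start  : f 0 ≡ a
      end    : f len ≡ b
      inside : ∀ i → i ≤ len → X (f i)

  abstract
    -- The induced path obtained from the rest of the walk is entered at its last vertex equal or
    -- adjacent to a. Nothing beyond that vertex is adjacent to a, so prefixing a keeps the path
    -- induced.
    shorten : ∀ {X a b} → X a → Star (Within E X) a b → PathIn X a b
    shorten {a = a} Xa ε = record { len = 0 ; f = λ _ → a ; isPath = single a ; start = refl ; end = refl ; inside = λ _ _ → Xa }
    shorten {X} {a} {b} Xa (_◅_ {j = a′} (e , _ , Xa′) w) = extend (last-index near? len (inj₂ (subst (E a) (sym start) e)))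
      where
      open PathIn (shorten Xa′ w)
      Near : ℕ → Set
      Near i = a ≡ f i ⊎ E a (f i)
      near? : U.Decidable Near
      near? i = (a Fin.≟ f i) ⊎-dec E? a (f i)
      extend : (∃ λ j → j ≤ len × Near j × (∀ i → j < i → i ≤ len → ¬ Near i)) → PathIn X a b
      extend (j , j≤ , near , none) = go near
        where
        fits : j + (len ∸ j) ≤ len
        fits = ≤-reflexive (m+[n∸m]≡n j≤)
        q : IsPath E N (λ c → f (j + c)) (len ∸ j)
        q = segment j fits isPath
        f[j+0] : f (j + 0) ≡ f j
        f[j+0] = cong f (+-identityʳ j)
        f-end : f (j + (len ∸ j)) ≡ b
        f-end = trans (cong f (m+[n∸m]≡n j≤)) end
        in-range : ∀ c → c ≤ len ∸ j → j + c ≤ len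
        in-range c c≤ = ≤-trans (+-monoʳ-≤ j c≤) fits
        go : Near j → PathIn X a b
        go (inj₁ a≡) = record
          { len = len ∸ j ; f = λ c → f (j + c) ; isPath = q
          ; start = trans f[j+0] (sym a≡) ; end = f-end ; inside = λ c c≤ → inside (j + c) (in-range c c≤) }
        go (inj₂ e′) = record
          { len = suc (len ∸ j) ; f = a ◂ (λ c → f (j + c))
          ; isPath = cons (subst (E a) (sym f[j+0]) e′) away q
          ; start = refl ; end = f-end
          ; inside = λ { zero _ → Xa ; (suc c) (s≤s c≤) → inside (j + c) (in-range c c≤) } }
          where
          away : ∀ i → 0 < i → i ≤ len ∸ j → N a (f (j + i))
          away i 0<i i≤ = notE (¬near ∘ inj₁) (¬near ∘ inj₂)
            where
            ¬near : ¬ Near (j + i)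
            ¬near = none (j + i) (subst (_< j + i) (+-identityʳ j) (+-monoʳ-< j 0<i)) (in-range i i≤)

does-true : ∀ {P : Set} (P? : Dec P) → does P? ≡ true → P
does-true (yes p) _ = p

does-false : ∀ {P : Set} (P? : Dec P) → does P? ≡ false → ¬ P
does-false (no ¬p) _ = ¬p

-- Berge graphs as pairs of complementary relations

record BergePair (n : ℕ) : Set₁ where
  field
    E N   : Rel (Fin n) 0ℓ
    E-sym : Symmetric E
    N-sym : Symmetric N
    E?    : Decidable E
    N?    : Decidable N
    E-irr : ∀ {v} → ¬ E v v
    N-irr : ∀ {v} → ¬ N v v
    EN    : ∀ {u v} → E u v → N u v → ⊥
    notE  : ∀ {u v} → u ≢ v → ¬ E u v → N u v
    notN  : ∀ {u v} → u ≢ v → ¬ N u v → E u v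
    evenE : EvenHoles E N
    evenN : EvenHoles N E

op : ∀ {n} → BergePair n → BergePair n
op B = record
  { E = N ; N = E ; E-sym = N-sym ; N-sym = E-sym ; E? = N? ; N? = E?
  ; E-irr = N-irr ; N-irr = E-irr ; EN = λ e n → EN n e
  ; notE = notN ; notN = notE ; evenE = evenN ; evenN = evenE }
  where open BergePair B

module Basics {n : ℕ} (B : BergePair n) where

  open BergePair B
  private V = Fin n

  Complete : Subset n → V → Set
  Complete T v = ∀ t → t ∈ T → E v t

  complete? : ∀ T → U.Decidable (Complete T)
  complete? T v = Fin.all? (λ t → (t ∈? T) →-dec E? v t)

  incomplete : ∀ {T v} → ¬ Complete T v → ∃ λ t → t ∈ T × ¬ E v t
  incomplete {T} {v} ¬c with Fin.any? (λ t → (t ∈? T) ×-dec ¬? (E? v t))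
  ... | yes w = w
  ... | no ¬w = contradiction (λ t t∈ → case E? v t of
    λ { (yes e) → e ; (no ¬e) → contradiction (t , t∈ , ¬e) ¬w }) ¬c

  path-distinct : ∀ {f k i j} → IsPath E N f k → i < j → j ≤ k → f i ≢ f j
  path-distinct {f} {k} {i} {j} p i<j j≤k eq with m≤n⇒m<n∨m≡n i<j
  ... | inj₁ si<j = N-irr (subst (N (f i)) (sym eq) (IsPath.far p i j si<j j≤k))
  ... | inj₂ refl = E-irr (subst (E (f i)) (sym eq) (IsPath.step p i j≤k))

  record PathThrough (T : Subset n) (a b : V) : Set where
    field
      len    : ℕ
      f      : ℕ → V
      isPath : IsPath E N f len
      start  : f 0 ≡ a
      end    : f len ≡ b
      inner  : ∀ i → 0 < i → i < len → f i ∈ T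

  open Connectivity {E = E} {N = N} E-sym E? notE public

  -- The walk runs in T together with a and b and is shortened. The vertices of an induced path are
  -- distinct, so a and b occur only as its ends.
  path-through : ∀ {T a b s t} → Connected E T → s ∈ T → t ∈ T → E a s → E t b → PathThrough T a b
  path-through {T} {a} {b} {s} {t} conn s∈ t∈ as tb = record
    { len = len ; f = f ; isPath = isPath ; start = start ; end = end ; inner = inner }
    where
    X : V → Set
    X v = v ∈ T ⊎ (v ≡ a ⊎ v ≡ b)
    open PathIn (shorten {X} (inj₂ (inj₁ refl))
      ((as , inj₂ (inj₁ refl) , inj₁ s∈) ◅ (within-mono inj₁ (conn s∈ t∈) ◅◅ ((tb , inj₁ t∈ , inj₂ (inj₂ refl)) ◅ ε))))
    inner : ∀ i → 0 < i → i < len → f i ∈ T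
    inner i 0<i i< with inside i (<⇒≤ i<)
    ... | inj₁ i∈          = i∈
    ... | inj₂ (inj₁ eq) = contradiction (trans start (sym eq)) (path-distinct isPath 0<i (<⇒≤ i<))
    ... | inj₂ (inj₂ eq) = contradiction (trans eq (sym end)) (path-distinct isPath i< ≤-refl)

  nonadjacent-length : ∀ {f k} → IsPath E N f k → N (f 0) (f k) → 2 ≤ k
  nonadjacent-length {k = zero}        p nn = contradiction nn N-irr
  nonadjacent-length {k = suc zero}    p nn = contradiction nn (EN (IsPath.step p 0 (s≤s z≤n)))
  nonadjacent-length {k = suc (suc k)} p nn = s≤s (s≤s z≤n)

  open Holes {E = E} {N = N} E-sym N-sym evenE public

-- The triangles `a`, `f 0`, `f 1` and `b`, `f k`, `f (suc k)` are linked by the path from `f 1` to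
-- `f k` and by the edges from `a` to `f (suc k)` and from `f 0` to `b`. This is a prism.
record Leap {n : ℕ} (E N : Rel (Fin n) 0ℓ) : Set where
  field
    k    : ℕ
    4≤k  : 4 ≤ suc k
    f    : ℕ → Fin n
    path : IsPath E N f (suc k)
    a b  : Fin n
    ab   : N a b
    a₀   : E a (f 0)
    a₁   : E a (f 1)
    aₖ   : E a (f (suc k))
    a-   : ∀ i → 1 < i → i < suc k → N a (f i)
    b₀   : E b (f 0)
    bₖ₋₁ : E b (f k)
    bₖ   : E b (f (suc k))
    b-   : ∀ i → 0 < i → i < k → N b (f i)

-- The Roussel–Rubio lemma for graphs without leaps

module RousselRubio {n : ℕ} (B : BergePair n) where

  open BergePair B
  open Basics B
  private
    V = Fin n
    module C = Basics (op B)

  record OddAntipath (T : Subset n) (x y : V) : Set where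
    field
      through : C.PathThrough T x y
    open C.PathThrough through public
    field
      2≤len : 2 ≤ len
      odd   : parity len ≡ true

  -- Neither x nor y is complete to the anticonnected set T, so an antipath through T joins them.
  -- Since v misses only x on it, u misses only y, and u and v are nonadjacent, they close it to an
  -- antihole of length `len` + 3.
  square-antipath : ∀ {T u x y v} → Connected N T → E u x → E x y → E y v → N u y → N x v → N u v →
    Complete T u → Complete T v → ¬ Complete T x → ¬ Complete T y → OddAntipath T x y
  square-antipath {T} {u} {x} {y} {v} conn ux xy yv nuy nxv nuv cu cv ¬cx ¬cy
    with s , s∈ , ¬xs ← incomplete ¬cx | t , t∈ , ¬yt ← incomplete ¬cy = record
      { through = p
      ; 2≤len = 2≤
      ; odd = C.close₂ {v = v} {w = u} (<⇒≤ 2≤) isPath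
          (subst (N v) (sym start) (N-sym nxv)) (λ i 0<i i≤ → v-inner i 0<i (m≤n⇒m<n∨m≡n i≤))
          (subst (N u) (sym end) nuy) u-inner (N-sym nuv) }
    where
    x∉T : x ∉ T
    x∉T x∈ = EN (E-sym (cv x x∈)) nxv
    y∉T : y ∉ T
    y∉T y∈ = EN (cu y y∈) nuy
    p : C.PathThrough T x y
    p = C.path-through conn s∈ t∈
      (notE (λ { refl → x∉T s∈ }) ¬xs) (N-sym (notE (λ { refl → y∉T t∈ }) ¬yt))
    open C.PathThrough p
    2≤ : 2 ≤ len
    2≤ = C.nonadjacent-length isPath (subst₂ E (sym start) (sym end) xy)
    v-inner : ∀ i → 0 < i → i < len ⊎ i ≡ len → E v (f i)
    v-inner i 0<i (inj₁ i<)   = cv (f i) (inner i 0<i i<)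
    v-inner i 0<i (inj₂ refl) = subst (E v) (sym end) (E-sym yv)
    u-inner : ∀ i → i < len → E u (f i)
    u-inner zero    i< = subst (E u) (sym start) ux
    u-inner (suc i) i< = cu _ (inner (suc i) (s≤s z≤n) i<)

  -- The vertex e closes the antipath to an antihole of length `len` + 2.
  odd-antipath-closed : ∀ {T x y e} → OddAntipath T x y → Complete T e → N e x → N e y → ⊥
  odd-antipath-closed {e = e} p ce ex ey = true≢false (trans (sym odd)
    (evenN len f e 2≤len isPath (subst (N e) (sym start) ex) (subst (N e) (sym end) ey)
      (λ i 0<i i< → ce (f i) (inner i 0<i i<))))
    where open OddAntipath p

  module _ {Q : Set₁} (leap : Leap E N → Q) where

    -- The conclusion is the goal `Q` rather than falsity, because such a path does exist when there
    -- is a leap.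
    NoOddPath : Subset n → Set₁
    NoOddPath T = ∀ {f k} → IsPath E N f k → parity k ≡ true → 5 ≤ k →
      Complete T (f 0) → Complete T (f k) → (∀ i → 0 < i → i < k → ¬ Complete T (f i)) → Q

    module OddPath {f k} (path : IsPath E N f k) (oddₖ : parity k ≡ true) (5≤k : 5 ≤ k) where

      open IsPath path

      f₀-far : ∀ {i} → 1 < i → i ≤ k → N (f 0) (f i)
      f₀-far 1<i i≤k = far 0 _ 1<i i≤k

      fₖ-far : ∀ {i} → suc i < k → N (f k) (f i)
      fₖ-far si<k = N-sym (far _ k si<k ≤-refl)

      -- A gap of length three gives an odd antipath, which f 0 or f k closes to an odd antihole.
      no-gap : ∀ T → Connected N T → NoOddPath T → Complete T (f 0) → Complete T (f k) →
               OddGap (λ i → does (complete? T (f i))) k → Q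
      no-gap T conn rr c₀ cₖ g = by-length (odd-cases odd)
        where
        open OddGap g
        h : ℕ → V
        h c = f (i + c)
        hp : IsPath E N h d
        hp = segment i fits path
        h₀ : Complete T (h 0)
        h₀ = does-true (complete? T (h 0))
          (subst (λ j → does (complete? T (f j)) ≡ true) (sym (+-identityʳ i)) lo)
        h-end : Complete T (h d)
        h-end = does-true (complete? T (h d)) hi
        h-inner : ∀ c → 0 < c → c < d → ¬ Complete T (h c)
        h-inner c 0<c c<d = does-false (complete? T (h c)) (none c 0<c c<d)
        by-length : d ≡ 1 ⊎ d ≡ 3 ⊎ 5 ≤ d → Q
        by-length (inj₁ refl) with s≤s () ← 3≤d
        by-length (inj₂ (inj₂ 5≤d)) = rr hp odd 5≤d h₀ h-end h-inner
        by-length (inj₂ (inj₁ refl)) = ⊥-elim (outer i refl)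
          where
          module h = IsPath hp
          ap : OddAntipath T (h 1) (h 2)
          ap = square-antipath conn (h.step 0 (s≤s z≤n)) (h.step 1 (s≤s (s≤s z≤n))) (h.step 2 (s≤s (s≤s (s≤s z≤n))))
            (h.far 0 2 ≤-refl (s≤s (s≤s z≤n))) (h.far 1 3 ≤-refl ≤-refl) (h.far 0 3 (s≤s (s≤s z≤n)) ≤-refl)
            h₀ h-end (h-inner 1 (s≤s z≤n) (s≤s (s≤s z≤n))) (h-inner 2 (s≤s z≤n) ≤-refl)
          -- A gap starting at `f 0` has the inner vertices `f 1` and `f 2`, which `f k` misses as k
          -- is at least five. The inner vertices of any later gap are missed by `f 0`.
          outer : ∀ j → j ≡ i → ⊥
          outer zero refl = odd-antipath-closed ap cₖ
            (fₖ-far (≤-trans (s≤s (s≤s (s≤s z≤n))) 5≤k)) (fₖ-far (≤-trans (s≤s (s≤s (s≤s (s≤s z≤n)))) 5≤k))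
          outer (suc j) refl = odd-antipath-closed ap c₀
            (f₀-far (s≤s (≤-trans (s≤s z≤n) (≤-reflexive (+-comm 1 j)))) (≤-trans (+-monoʳ-≤ (suc j) (s≤s z≤n)) fits))
            (f₀-far (s≤s (≤-trans (s≤s z≤n) (≤-reflexive (+-comm 2 j)))) (≤-trans (+-monoʳ-≤ (suc j) (s≤s (s≤s z≤n))) fits))

      -- A cross gap turned so that its P-end comes first. The field `ends` separates the stretches
      -- missed entirely by an end of the path, which can then be used to close something, from the
      -- stretch that fills the whole interior and may come from a leap.
      record Stretch (P P′ : V → Set) : Set where
        field
          h    : ℕ → V
          d    : ℕ
          isPath : IsPath E N h d
          odd  : parity d ≡ true
          P₀   : P (h 0)
          ¬P   : ∀ c → 0 < c → c ≤ d → ¬ P (h c)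
          P′₁  : P′ (h d)
          ¬P′  : ∀ c → c < d → ¬ P′ (h c)
          f₀-inner : ∀ c → 0 < c → c < d → N (f 0) (h c)
          pos  : ∀ c → c ≤ d → ∃ λ j → 0 < j × j < k × h c ≡ f j
          ends : (∃ λ e → (e ≡ f 0 ⊎ e ≡ f k) × (∀ c → c ≤ d → N e (h c)))
               ⊎ (suc (suc d) ≡ k × ((∀ c → c ≤ d → h c ≡ f (suc c)) ⊎ (∀ c → c ≤ d → h c ≡ f (suc (d ∸ c)))))

      module _ {P P′ : V → Set} (P? : U.Decidable P) (P′? : U.Decidable P′)
               (P₀ : P (f 0)) (P′₀ : P′ (f 0)) (Pₖ : P (f k)) (P′ₖ : P′ (f k)) where

        private
          module Bounds (g : CrossGap (does ∘ P? ∘ f) (does ∘ P′? ∘ f) k) where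
            open CrossGap g
            -- An end of a cross gap carries exactly one mark, whereas `f 0` and `f k` carry both,
            -- so the gap lies strictly inside the path.
            0<i : 0 < i
            0<i with i | loʷ
            ... | zero  | ¬p = contradiction P′₀ (does-false (P′? (f 0)) ¬p)
            ... | suc _ | _  = s≤s z≤n
            i+d<k : i + d < k
            i+d<k with m≤n⇒m<n∨m≡n fits
            ... | inj₁ lt = lt
            ... | inj₂ eq = contradiction (subst (P ∘ f) (sym eq) Pₖ) (does-false (P? _) hiᵛ)
            pos : ∀ c → c ≤ d → 0 < i + c × i + c < k
            pos c c≤ = ≤-trans 0<i (m≤m+n i c) , ≤-<-trans (+-monoʳ-≤ i c≤) i+d<k
            f₀-inner : ∀ c → 0 < c → c ≤ d → N (f 0) (f (i + c))
            f₀-inner c 0<c c≤ = f₀-far (+-mono-≤ 0<i 0<c) (<⇒≤ (proj₂ (pos c c≤)))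
            ends : (∃ λ e → (e ≡ f 0 ⊎ e ≡ f k) × (∀ c → c ≤ d → N e (f (i + c)))) ⊎ (i ≡ 1 × suc (i + d) ≡ k)
            ends with m≤n⇒m<n∨m≡n 0<i | m≤n⇒m<n∨m≡n i+d<k
            ... | inj₁ 1<i | _ = inj₁ (f 0 , inj₁ refl , λ c c≤ →
              f₀-far (≤-trans 1<i (m≤m+n i c)) (<⇒≤ (proj₂ (pos c c≤))))
            ... | inj₂ _ | inj₁ lt = inj₁ (f k , inj₂ refl , λ c c≤ →
              fₖ-far (≤-<-trans (s≤s (+-monoʳ-≤ i c≤)) lt))
            ... | inj₂ eq | inj₂ eq′ = inj₂ (sym eq , eq′)
            P-lo : P (f i)
            P-lo = does-true (P? (f i)) loᵛ
            P′-hi : P′ (f (i + d))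
            P′-hi = does-true (P′? (f (i + d))) hiʷ
            ¬P : ∀ c → 0 < c → c ≤ d → ¬ P (f (i + c))
            ¬P c 0<c c≤ with m≤n⇒m<n∨m≡n c≤
            ... | inj₁ lt   = does-false (P? _) (noneᵛ c 0<c lt)
            ... | inj₂ refl = does-false (P? _) hiᵛ
            ¬P′ : ∀ c → c < d → ¬ P′ (f (i + c))
            ¬P′ zero    _   p = does-false (P′? (f i)) loʷ (subst (P′ ∘ f) (+-identityʳ i) p)
            ¬P′ (suc c) c<d = does-false (P′? _) (noneʷ (suc c) (s≤s z≤n) c<d)

        stretchˡ : CrossGap (does ∘ P? ∘ f) (does ∘ P′? ∘ f) k → Stretch P P′
        stretchˡ g = record
          { h = λ c → f (i + c) ; d = d ; isPath = segment i fits path ; odd = odd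
          ; P₀ = subst (P ∘ f) (sym (+-identityʳ i)) P-lo ; ¬P = ¬P ; P′₁ = P′-hi ; ¬P′ = ¬P′
          ; f₀-inner = λ c 0<c c<d → f₀-inner c 0<c (<⇒≤ c<d)
          ; pos = λ c c≤ → i + c , proj₁ (pos c c≤) , proj₂ (pos c c≤) , refl
          ; ends = [ inj₁ , (λ { (refl , eq) → inj₂ (eq , inj₁ (λ _ _ → refl)) }) ]′ ends }
          where
          open CrossGap g
          open Bounds g

        stretchʳ : CrossGap (does ∘ P? ∘ f) (does ∘ P′? ∘ f) k → Stretch P′ P
        stretchʳ g = record
          { h = λ c → f (i + (d ∸ c)) ; d = d
          ; isPath = reversed E-sym N-sym (segment i fits path) ; odd = odd
          ; P₀ = P′-hi
          ; ¬P = λ c 0<c c≤ → ¬P′ (d ∸ c) (∸-monoʳ-< 0<c c≤)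
          ; P′₁ = subst (P ∘ f) (sym (trans (cong (i +_) (n∸n≡0 d)) (+-identityʳ i))) P-lo
          ; ¬P′ = λ c c<d → ¬P (d ∸ c) (m<n⇒0<n∸m c<d) (m∸n≤m d c)
          ; f₀-inner = λ c 0<c c<d → f₀-inner (d ∸ c) (m<n⇒0<n∸m c<d) (m∸n≤m d c)
          ; pos = λ c c≤ → i + (d ∸ c) , proj₁ (pos (d ∸ c) (m∸n≤m d c)) , proj₂ (pos (d ∸ c) (m∸n≤m d c)) , refl
          ; ends = [ (λ (e , which , far) → inj₁ (e , which , λ c c≤ → far (d ∸ c) (m∸n≤m d c)))
                   , (λ { (refl , eq) → inj₂ (eq , inj₂ (λ _ _ → refl)) }) ]′ ends }
          where
          open CrossGap g
          open Bounds g

-- Induction on the size of the anticonnected set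

module Shortest {n : ℕ} (B : BergePair n) {Q : Set₁} (leap : Leap (BergePair.E B) (BergePair.N B) → Q) where

  open BergePair B
  open Basics B
  open RousselRubio B
  private
    V = Fin n
    module C = Basics (op B)

  module Minimal {T : Subset n} (connT : Connected N T)
    (smaller : ∀ T′ → ∣ T′ ∣ < ∣ T ∣ → Connected N T′ → NoOddPath leap T′)
    {f k} (path : IsPath E N f k) (oddₖ : parity k ≡ true) (5≤k : 5 ≤ k)
    (c₀ : Complete T (f 0)) (cₖ : Complete T (f k))
    (none : ∀ i → 0 < i → i < k → ¬ Complete T (f i)) where

    open OddPath leap path oddₖ 5≤k
    open IsPath path

    -- A vertex of T is adjacent to both ends of the path, and no vertex of a path of length at
    -- least five is.
    off-path : ∀ {t} i → i ≤ k → t ∈ T → f i ≢ t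
    off-path zero          _   t∈ refl = E-irr (c₀ _ t∈)
    off-path (suc zero)    _   t∈ refl = EN (cₖ _ t∈) (fₖ-far (≤-trans (s≤s (s≤s (s≤s z≤n))) 5≤k))
    off-path (suc (suc i)) i≤k t∈ refl = EN (c₀ _ t∈) (f₀-far (s≤s (s≤s z≤n)) i≤k)

    nonadjacent : ∀ {t i} → t ∈ T → i ≤ k → ¬ E t (f i) → N t (f i)
    nonadjacent t∈ i≤k ¬e = notE (λ eq → off-path _ i≤k t∈ (sym eq)) ¬e

    ends-complete : ∀ {e} → e ≡ f 0 ⊎ e ≡ f k → Complete T e
    ends-complete (inj₁ refl) = c₀
    ends-complete (inj₂ refl) = cₖ

    module _ {x} (cut : C.NonCut T x) where

      open C.NonCut cut

      restrict : ∀ {v} → Complete T v → Complete R v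
      restrict c t t∈ = c t (R⊆T t∈)

      combine : ∀ {v} → Complete R v → E x v → Complete T v
      combine c e t t∈ with rest t∈
      ... | inj₁ t∈R  = c t t∈R
      ... | inj₂ refl = E-sym e

      R-avoids : NoOddPath leap R
      R-avoids = smaller R ∣R∣<∣T∣ conn

      x-incomplete : ¬ Complete R x
      x-incomplete c = EN (c s s∈R) (N-sym sx)

      private
        inR? : U.Decidable (Complete R)
        inR? = complete? R
        toX? : U.Decidable (E x)
        toX? = E? x

        VR : ℕ → Bool
        VR = does ∘ inR? ∘ f
        VX : ℕ → Bool
        VX = does ∘ toX? ∘ f

        R₀ = restrict c₀
        Rₖ = restrict cₖ
        x₀ = E-sym (c₀ x x∈T)
        xₖ = E-sym (cₖ x x∈T)

      no-R-gap : OddGap VR k → Q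
      no-R-gap = no-gap R conn R-avoids R₀ Rₖ

      -- The vertex x closes such a gap to an odd hole.
      no-x-gap : OddGap VX k → ⊥
      no-x-gap g = true≢false (trans (sym odd)
        (evenE d (λ c → f (i + c)) x (≤-trans (s≤s (s≤s z≤n)) 3≤d) (segment i fits path)
          (does-true (toX? (f (i + 0))) (trans (cong VX (+-identityʳ i)) lo)) (does-true (toX? (f (i + d))) hi)
          (λ c 0<c c<d → nonadjacent x∈T (≤-trans (+-monoʳ-≤ i (<⇒≤ c<d)) fits)
            (does-false (toX? _) (OddGap.none g c 0<c c<d)))))
        where open OddGap g hiding (none)

      -- Otherwise every odd gap between a neighbour of x and an R-complete vertex has length one;
      -- a gap of length one confines the R-complete inner vertices to its two neighbours.
      complete-next-to-end : (∀ i → 0 < i → i < k → i ≡ 1 ⊎ suc i ≡ k → Complete R (f i) → Q) → Q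
      complete-next-to-end found =
        [ no-R-gap , parity-case ]′ (gap-or-parity VR k (dec-true (inR? (f 0)) R₀) (dec-true (inR? (f k)) Rₖ))
        where
        stretch : Stretch (E x) (Complete R) → (∃ λ j → j < k × VR j ≡ true × VR (suc j) ≡ true) → Q
        stretch st (j , j<k , vj , vj′) = by-length (odd-cases st.odd)
          where
          module st = Stretch st
          open Stretch st using (h; d; ends)
          hN : ∀ c → 0 < c → c ≤ d → N x (h c)
          hN c 0<c c≤ = let i , _ , i<k , eq = st.pos c c≤ in
            subst (N x) (sym eq) (nonadjacent x∈T (<⇒≤ i<k) (λ e → st.¬P c 0<c c≤ (subst (E x) (sym eq) e)))
          long : 3 ≤ d → Q
          long 3≤d with ends
          -- Prefixing e and x gives an odd path of length d + 2 with R-complete ends. No inner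
          -- vertex is R-complete, x because it has a non-neighbour in R, so the smaller set R
          -- applies.
          ... | inj₁ (e , which , far) = R-avoids {f = e ◂ x ◂ h}
            (cons (ce x x∈T) (λ { (suc i) _ (s≤s i≤) → far i i≤ }) (cons st.P₀ hN st.isPath))
            (trans (not-involutive _) st.odd) (s≤s (s≤s 3≤d)) (restrict ce) st.P′₁
            (λ { (suc zero) _ _ → x-incomplete ; (suc (suc c)) _ (s≤s (s≤s c<d)) → st.¬P′ c c<d })
            where ce = ends-complete which
          ... | inj₂ (ds , inj₁ fwd) = found (suc d) (s≤s z≤n) (≤-reflexive ds) (inj₂ ds)
            (subst (Complete R) (fwd d ≤-refl) st.P′₁)
          ... | inj₂ (ds , inj₂ bwd) = found 1 ≤-refl (≤-trans (s≤s (s≤s z≤n)) 5≤k) (inj₁ refl)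
            (subst (Complete R) (trans (bwd d ≤-refl) (cong (f ∘ suc) (n∸n≡0 d))) st.P′₁)
          short : d ≡ 1 → Q
          short refl with ends
          ... | inj₂ (ds , _) = contradiction (subst (5 ≤_) (sym ds) 5≤k) (λ { (s≤s (s≤s (s≤s ()))) })
          ... | inj₁ (e , which , far) = search
            where
            ce = ends-complete which
            a = proj₁ (st.pos 0 z≤n)
            a<k : a < k
            a<k = proj₁ (proj₂ (proj₂ (st.pos 0 z≤n)))
            h₀≡ : h 0 ≡ f a
            h₀≡ = proj₂ (proj₂ (proj₂ (st.pos 0 z≤n)))
            -- The vertices `h 1`, `h 0`, x, e form a path of length three whose ends are R-complete
            -- and whose inner vertices are not.
            ap : OddAntipath R (h 0) x
            ap = square-antipath conn (E-sym (IsPath.step st.isPath 0 ≤-refl)) (E-sym st.P₀) (E-sym (ce x x∈T))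
              (N-sym (hN 1 ≤-refl ≤-refl)) (N-sym (far 0 z≤n)) (N-sym (far 1 ≤-refl))
              st.P′₁ (restrict ce) (st.¬P′ 0 ≤-refl) x-incomplete
            -- An R-complete inner vertex misses x, since otherwise it would be T-complete. If it
            -- also misses `f a`, which is `h 0`, it closes the odd antipath.
            away : ∀ c → 0 < c → c < k → Complete R (f c) → N (f c) (f a) → ⊥
            away c 0<c c<k cc na = odd-antipath-closed ap cc (subst (N (f c)) (sym h₀≡) na)
              (N-sym (nonadjacent x∈T (<⇒≤ c<k) (λ e → none c 0<c c<k (combine cc e))))
            cj : Complete R (f j)
            cj = does-true (inR? (f j)) vj
            cj′ : Complete R (f (suc j))
            cj′ = does-true (inR? (f (suc j))) vj′
            ¬ca : ¬ Complete R (f a)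
            ¬ca c = st.¬P′ 0 ≤-refl (subst (Complete R) (sym h₀≡) c)
            -- The count provides an edge with both ends R-complete. If both ends are inner
            -- vertices, neither is `f a`, so one of them is at distance at least two from `f a`
            -- along the path.
            search : Q
            search with j ≟ 0 | suc j ≟ k
            ... | yes refl | _ = found 1 ≤-refl (≤-trans (s≤s (s≤s z≤n)) 5≤k) (inj₁ refl) cj′
            ... | no j≢0   | yes refl = found j (n≢0⇒n>0 j≢0) j<k (inj₂ refl) cj
            ... | no j≢0   | no j′≢k with <-cmp j a
            ... | tri≈ _ eq _ = ⊥-elim (¬ca (subst (Complete R ∘ f) eq cj))
            ... | tri> _ _ a<j = ⊥-elim (away (suc j) (s≤s z≤n) (≤∧≢⇒< j<k j′≢k) cj′
              (N-sym (IsPath.far path a (suc j) (s≤s a<j) j<k)))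
            ... | tri< j<a _ _ with m≤n⇒m<n∨m≡n j<a
            ... | inj₂ eq   = ⊥-elim (¬ca (subst (Complete R ∘ f) eq cj′))
            ... | inj₁ j′<a = ⊥-elim (away j (n≢0⇒n>0 j≢0) j<k cj (IsPath.far path j a j′<a (<⇒≤ a<k)))
          by-length : d ≡ 1 ⊎ d ≡ 3 ⊎ 5 ≤ d → Q
          by-length (inj₁ eq)          = short eq
          by-length (inj₂ (inj₁ refl)) = long ≤-refl
          by-length (inj₂ (inj₂ 5≤d))  = long (≤-trans (s≤s (s≤s (s≤s z≤n))) 5≤d)

        parity-case : edgeParity VR k ≡ parity k → Q
        parity-case e = go (interleave VR VX k oddₖ
          (dec-true (inR? (f 0)) R₀) (dec-true (toX? (f 0)) x₀) (dec-true (inR? (f k)) Rₖ) (dec-true (toX? (f k)) xₖ))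
          where
          R-edge = edge-exists VR k (trans e oddₖ)
          both⇒complete : ∀ m → VR m ≡ true → VX m ≡ true → Complete T (f m)
          both⇒complete m a b = combine (does-true (inR? (f m)) a) (does-true (toX? (f m)) b)
          go : Interleaving VR VX k → Q
          go (gapˡ g) = no-R-gap g
          go (gapʳ g) = ⊥-elim (no-x-gap g)
          go (both zero m<k a b c d) =
            ⊥-elim (none 1 ≤-refl (≤-trans (s≤s (s≤s z≤n)) 5≤k) (both⇒complete 1 c d))
          go (both (suc m) m<k a b c d) = ⊥-elim (none (suc m) (s≤s z≤n) m<k (both⇒complete (suc m) a b))
          go (crossˡ g) = stretch (stretchʳ inR? toX? R₀ x₀ Rₖ xₖ g) R-edge
          go (crossʳ g) = stretch (stretchˡ toX? inR? x₀ R₀ xₖ Rₖ g) R-edge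

    -- As x and y differ, T without x and T without y cover T.
    doubly-complete : ∀ {x y v} (cx : C.NonCut T x) (cy : C.NonCut T y) → x ≢ y →
      Complete (C.NonCut.R cx) v → Complete (C.NonCut.R cy) v → Complete T v
    doubly-complete cx cy x≢y c c′ t t∈ with C.NonCut.rest cx t∈
    ... | inj₁ t∈R = c t t∈R
    ... | inj₂ refl with C.NonCut.rest cy t∈
    ... | inj₁ t∈R = c′ t t∈R
    ... | inj₂ refl = contradiction refl x≢y

    -- Every non-cut vertex t takes one of f 1 and f (k ∸ 1) as a vertex complete to T ∖ t, and none is taken twice.
    three-noncut : ∀ {x y z} → C.NonCut T x → C.NonCut T y → C.NonCut T z → x ≢ y → x ≢ z → y ≢ z → Q
    three-noncut cx cy cz x≢y x≢z y≢z =
      complete-next-to-end cx λ i 0<i i<k pi ci →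
      complete-next-to-end cy λ j 0<j j<k pj cj →
      complete-next-to-end cz λ l 0<l l<k pl cl →
      ⊥-elim (pigeon 0<i i<k 0<j j<k pi ci pj cj pl cl)
      where
      same : ∀ {x y i j} (cx : C.NonCut T x) (cy : C.NonCut T y) → x ≢ y → 0 < i → i < k → i ≡ j →
             Complete (C.NonCut.R cx) (f i) → Complete (C.NonCut.R cy) (f j) → ⊥
      same cx cy x≢y 0<i i<k refl ci cj = none _ 0<i i<k (doubly-complete cx cy x≢y ci cj)
      pigeon : ∀ {i j l} → 0 < i → i < k → 0 < j → j < k →
        i ≡ 1 ⊎ suc i ≡ k → Complete (C.NonCut.R cx) (f i) →
        j ≡ 1 ⊎ suc j ≡ k → Complete (C.NonCut.R cy) (f j) →
        l ≡ 1 ⊎ suc l ≡ k → Complete (C.NonCut.R cz) (f l) → ⊥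
      pigeon 0<i i<k 0<j j<k (inj₁ a) ci (inj₁ b) cj _ _ = same cx cy x≢y 0<i i<k (trans a (sym b)) ci cj
      pigeon 0<i i<k 0<j j<k (inj₂ a) ci (inj₂ b) cj _ _ = same cx cy x≢y 0<i i<k (suc-injective (trans a (sym b))) ci cj
      pigeon 0<i i<k 0<j j<k (inj₁ a) ci _ _ (inj₁ b) cl = same cx cz x≢z 0<i i<k (trans a (sym b)) ci cl
      pigeon 0<i i<k 0<j j<k (inj₂ a) ci _ _ (inj₂ b) cl = same cx cz x≢z 0<i i<k (suc-injective (trans a (sym b))) ci cl
      pigeon 0<i i<k 0<j j<k _ _ (inj₁ a) cj (inj₁ b) cl = same cy cz y≢z 0<j j<k (trans a (sym b)) cj cl
      pigeon 0<i i<k 0<j j<k _ _ (inj₂ a) cj (inj₂ b) cl = same cy cz y≢z 0<j j<k (suc-injective (trans a (sym b))) cj cl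

    -- With only two non-cut vertices x and y left, T is the vertex set of an antipath g from x to y.
    module Antipath {g : ℕ → V} {m′ : ℕ} (gp : IsPath N E g (suc m′))
      (cx : C.NonCut T (g 0)) (cy : C.NonCut T (g (suc m′)))
      (inT : ∀ i → i ≤ suc m′ → g i ∈ T) (onto : ∀ {t} → t ∈ T → ∃ λ i → i ≤ suc m′ × t ≡ g i) where

      private
        m = suc m′
        x = g 0
        y = g m
        Rx = C.NonCut.R cx
        Ry = C.NonCut.R cy

        x≢y : x ≢ y
        x≢y = C.path-distinct gp (s≤s z≤n) ≤-refl

        ∈Rx : ∀ c → 0 < c → c ≤ m → g c ∈ Rx
        ∈Rx c 0<c c≤m with C.NonCut.rest cx (inT c c≤m)
        ... | inj₁ c∈ = c∈
        ... | inj₂ eq = contradiction (sym eq) (C.path-distinct gp 0<c c≤m)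

        ∈Ry : ∀ c → c < m → g c ∈ Ry
        ∈Ry c c<m with C.NonCut.rest cy (inT c (<⇒≤ c<m))
        ... | inj₁ c∈ = c∈
        ... | inj₂ eq = contradiction eq (C.path-distinct gp c<m ≤-refl)

        Rx-complete : ∀ {v} → (∀ c → 0 < c → c ≤ m → E v (g c)) → Complete Rx v
        Rx-complete e t t∈ with onto (C.NonCut.R⊆T cx t∈)
        ... | zero  , _  , refl = contradiction t∈ (C.NonCut.x∉R cx)
        ... | suc c , c≤ , refl = e (suc c) (s≤s z≤n) c≤

        Ry-complete : ∀ {v} → (∀ c → c < m → E v (g c)) → Complete Ry v
        Ry-complete e t t∈ with onto (C.NonCut.R⊆T cy t∈)
        ... | c , c≤ , refl with m≤n⇒m<n∨m≡n c≤
        ... | inj₁ c<m  = e c c<m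
        ... | inj₂ refl = contradiction t∈ (C.NonCut.x∉R cy)

        x-nonadjacent : ∀ {i} → 0 < i → i < k → Complete Rx (f i) → N x (f i)
        x-nonadjacent 0<i i<k c = nonadjacent (inT 0 z≤n) (<⇒≤ i<k) (λ e → none _ 0<i i<k (combine cx c e))

        y-nonadjacent : ∀ {i} → 0 < i → i < k → Complete Ry (f i) → N y (f i)
        y-nonadjacent 0<i i<k c = nonadjacent (inT m ≤-refl) (<⇒≤ i<k) (λ e → none _ 0<i i<k (combine cy c e))

      -- Of `f 1` and `f (k ∸ 1)`, one is complete to T without x and the other to T without y; no
      -- single vertex is both, as it would be T-complete. They are nonadjacent and close the
      -- antipath g to an antihole of length m + 3.
      odd-length : (parity m ≡ true → Q) → Q
      odd-length cont =
        complete-next-to-end cx λ i 0<i i<k pi ci →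
        complete-next-to-end cy λ j 0<j j<k pj cj →
        cont (C.close₂ {f = g} {v = f i} {w = f j} (s≤s z≤n) gp
          (N-sym (x-nonadjacent 0<i i<k ci)) (λ c 0<c c≤ → ci (g c) (∈Rx c 0<c c≤))
          (N-sym (y-nonadjacent 0<j j<k cj)) (λ c c<m → cj (g c) (∈Ry c c<m))
          (opposite 0<i i<k pi ci pj cj))
        where
        1≪k : ∀ {j} → suc j ≡ k → 2 < j
        1≪k eq = ≤-trans (s≤s (s≤s (s≤s z≤n))) (s≤s⁻¹ (subst (5 ≤_) (sym eq) 5≤k))
        opposite : ∀ {i j} → 0 < i → i < k → i ≡ 1 ⊎ suc i ≡ k → Complete Rx (f i) →
                   j ≡ 1 ⊎ suc j ≡ k → Complete Ry (f j) → N (f i) (f j)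
        opposite 0<i i<k (inj₁ refl) ci (inj₁ refl) cj = ⊥-elim (none _ 0<i i<k (doubly-complete cx cy x≢y ci cj))
        opposite 0<i i<k (inj₂ a) ci (inj₂ b) cj with refl ← suc-injective (trans a (sym b)) =
          ⊥-elim (none _ 0<i i<k (doubly-complete cx cy x≢y ci cj))
        opposite _ _ (inj₁ refl) _ (inj₂ b) _ = IsPath.far path 1 _ (1≪k b) (<⇒≤ (≤-reflexive b))
        opposite _ _ (inj₂ a) _ (inj₁ refl) _ = N-sym (IsPath.far path 1 _ (1≪k a) (<⇒≤ (≤-reflexive a)))

      module _ (oddₘ : parity m ≡ true) (st : Stretch (Complete Rx) (Complete Ry)) where

        private
          module st = Stretch st
          open Stretch st using (h; d; ends)

          h-nonadjacent : ∀ {t} c → t ∈ T → c ≤ d → ¬ E t (h c) → N t (h c)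
          h-nonadjacent {t} c t∈ c≤ ¬e = let i , _ , i<k , eq = st.pos c c≤ in
            subst (N t) (sym eq) (nonadjacent t∈ (<⇒≤ i<k) (λ e → ¬e (subst (E t) (sym eq) e)))

          h-incomplete : ∀ c → c ≤ d → ¬ Complete T (h c)
          h-incomplete c c≤ full = let i , 0<i , i<k , eq = st.pos c c≤ in none i 0<i i<k (subst (Complete T) eq full)

          x-start : N x (h 0)
          x-start = h-nonadjacent 0 (inT 0 z≤n) z≤n (λ e → h-incomplete 0 z≤n (combine cx st.P₀ e))

          y-end : N y (h d)
          y-end = h-nonadjacent d (inT m ≤-refl) ≤-refl (λ e → h-incomplete d ≤-refl (combine cy st.P′₁ e))

          -- On T the vertex `h 0` misses only x and `h 1` misses only y, while e is complete to T
          -- and misses `h 0` and `h 1`. Together with g they form an antihole of length m + 4,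
          -- which is odd.
          adjacent-pair : d ≡ 1 → ⊥
          adjacent-pair refl with ends
          ... | inj₂ (ds , _) = contradiction (subst (5 ≤_) (sym ds) 5≤k) (λ { (s≤s (s≤s (s≤s ()))) })
          ... | inj₁ (e , which , far) = true≢false (trans (sym oddₘ)
            (C.close₃ {f = g} {v = h 0} {w = h 1} {e = e} (s≤s z≤n) gp
              (N-sym x-start) (λ c 0<c c≤ → st.P₀ (g c) (∈Rx c 0<c c≤))
              (N-sym y-end) (λ c c<m → st.P′₁ (g c) (∈Ry c c<m))
              (IsPath.step st.isPath 0 ≤-refl) (far 0 z≤n) (far 1 ≤-refl)
              (λ c c≤ → ends-complete which (g c) (inT c c≤))))

          -- Here T consists of the nonadjacent vertices x and y; the only neighbour of y on the
          -- stretch is `h 0`, that of x is `h d`. An end e missing the stretch closes e, y, `h 0`,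
          -- ..., `h d`, x to an odd hole of length d + 4. If the stretch fills the interior, x and
          -- y form a leap.
          single-edge : m′ ≡ 0 → 3 ≤ d → Q
          single-edge refl 3≤d = by-ends ends
            where
            y-start : E y (h 0)
            y-start = E-sym (st.P₀ y (∈Rx 1 ≤-refl ≤-refl))
            y-away : ∀ c → 0 < c → c ≤ d → N y (h c)
            y-away c 0<c c≤ = h-nonadjacent c (inT 1 ≤-refl) c≤
              (λ e → st.¬P c 0<c c≤ (Rx-complete (λ { (suc zero) _ _ → E-sym e ; (suc (suc _)) _ (s≤s ()) })))
            x-end : E x (h d)
            x-end = E-sym (st.P′₁ x (∈Ry 0 ≤-refl))
            x-away : ∀ c → c < d → N x (h c)
            x-away c c<d = h-nonadjacent c (inT 0 z≤n) (<⇒≤ c<d)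
              (λ e → st.¬P′ c c<d (Ry-complete (λ { zero _ → E-sym e ; (suc _) (s≤s ()) })))
            module _ (ds : suc (suc d) ≡ k) where
              end : ∀ {t} → t ∈ T → E t (f (suc (suc d)))
              end {t} t∈ = subst (E t ∘ f) (sym ds) (E-sym (cₖ t t∈))
              oriented : (∀ c → c ≤ d → h c ≡ f (suc c)) ⊎ (∀ c → c ≤ d → h c ≡ f (suc (d ∸ c))) → Leap E N
              oriented (inj₁ fwd) = record
                { k = suc d ; 4≤k = s≤s (s≤s (≤-trans (s≤s (s≤s z≤n)) 3≤d)) ; f = f ; path = subst (IsPath E N f) (sym ds) path
                ; a = y ; b = x ; ab = N-sym (IsPath.step gp 0 ≤-refl)
                ; a₀ = E-sym (c₀ y (inT 1 ≤-refl)) ; a₁ = subst (E y) (fwd 0 z≤n) y-start ; aₖ = end (inT 1 ≤-refl)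
                ; a- = λ { (suc c) (s≤s 0<c) (s≤s (s≤s c≤)) → subst (N y) (fwd c c≤) (y-away c 0<c c≤) }
                ; b₀ = E-sym (c₀ x (inT 0 z≤n)) ; bₖ₋₁ = subst (E x) (fwd d ≤-refl) x-end ; bₖ = end (inT 0 z≤n)
                ; b- = λ { (suc c) _ (s≤s c<d) → subst (N x) (fwd c (<⇒≤ c<d)) (x-away c c<d) } }
              oriented (inj₂ bwd) = record
                { k = suc d ; 4≤k = s≤s (s≤s (≤-trans (s≤s (s≤s z≤n)) 3≤d)) ; f = f ; path = subst (IsPath E N f) (sym ds) path
                ; a = x ; b = y ; ab = IsPath.step gp 0 ≤-refl
                ; a₀ = E-sym (c₀ x (inT 0 z≤n)) ; a₁ = subst (E x) (back 0 d≤d (n∸n≡0 d)) x-end ; aₖ = end (inT 0 z≤n)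
                ; a- = λ { (suc c) (s≤s 0<c) (s≤s (s≤s c≤)) →
                           subst (N x) (back c (m∸n≤m d c) (m∸[m∸n]≡n c≤)) (x-away (d ∸ c) (∸-monoʳ-< 0<c c≤)) }
                ; b₀ = E-sym (c₀ y (inT 1 ≤-refl)) ; bₖ₋₁ = subst (E y) (bwd 0 z≤n) y-start ; bₖ = end (inT 1 ≤-refl)
                ; b- = λ { (suc c) _ (s≤s c<d) →
                           subst (N y) (back c (m∸n≤m d c) (m∸[m∸n]≡n (<⇒≤ c<d))) (y-away (d ∸ c) (m<n⇒0<n∸m c<d) (m∸n≤m d c)) } }
                where
                d≤d = ≤-refl {d}
                back : ∀ c {c′} → c′ ≤ d → d ∸ c′ ≡ c → h c′ ≡ f (suc c)
                back c c′≤ refl = bwd _ c′≤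
            by-ends : _ → Q
            by-ends (inj₁ (e , which , far)) = ⊥-elim (true≢false (trans (sym st.odd)
              (close₃ {f = h} {v = y} {w = x} {e = e} (≤-trans (s≤s z≤n) 3≤d) st.isPath
                y-start y-away x-end x-away (N-sym (IsPath.step gp 0 ≤-refl))
                (ends-complete which y (inT 1 ≤-refl)) (ends-complete which x (inT 0 z≤n)) far)))
            by-ends (inj₂ (ds , dir)) = leap (oriented ds dir)

          -- The inner vertices of g form a smaller anticonnected set `T*`, to which both ends of
          -- the stretch are complete. An inner vertex of the stretch complete to `T*` would miss
          -- both x and y and close g to an odd antihole, so the induction hypothesis applies to the
          -- stretch and `T*`.
          interior : ∀ m″ → m′ ≡ suc m″ → 3 ≤ d → d ≡ 3 ⊎ 5 ≤ d → Q
          interior m″ refl 3≤d cases = by-length cases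
            where
            T* : Subset n
            T* = image m″ (g ∘ suc)
            conn* : Connected N T*
            conn* = C.connected-image m″ (segment 1 (s≤s (n≤1+n m″)) gp)
            T*⊆T : T* ⊆ T
            T*⊆T t∈ with ∈-image⁻ m″ (g ∘ suc) t∈
            ... | c , c≤ , refl = inT (suc c) (s≤s (m≤n⇒m≤1+n c≤))
            x∉T* : x ∉ T*
            x∉T* x∈ with ∈-image⁻ m″ (g ∘ suc) x∈
            ... | c , c≤ , eq = C.path-distinct gp (s≤s z≤n) (s≤s (m≤n⇒m≤1+n c≤)) eq
            avoid : NoOddPath leap T*
            avoid = smaller T* (p⊂q⇒∣p∣<∣q∣ ((λ v∈ → T*⊆T v∈) , x , inT 0 z≤n , x∉T*)) conn*
            from : ∀ {v} → (∀ c → 0 < c → c < m → E v (g c)) → Complete T* v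
            from e t t∈ with ∈-image⁻ m″ (g ∘ suc) t∈
            ... | c , c≤ , refl = e (suc c) (s≤s z≤n) (s≤s (s≤s c≤))
            into : ∀ {v} → Complete T* v → ∀ c → 0 < c → c < m → E v (g c)
            into cv (suc c) _ (s≤s (s≤s c≤)) = cv _ (∈-image⁺ m″ (g ∘ suc) c≤)
            start* : Complete T* (h 0)
            start* = from (λ c 0<c c<m → st.P₀ (g c) (∈Rx c 0<c (<⇒≤ c<m)))
            end* : Complete T* (h d)
            end* = from (λ c 0<c c<m → st.P′₁ (g c) (∈Ry c c<m))
            inner* : ∀ c → 0 < c → c < d → ¬ Complete T* (h c)
            inner* c 0<c c<d cv = true≢false (trans (sym oddₘ)
              (evenN m g (h c) (s≤s (s≤s z≤n)) gp (N-sym nx) (N-sym ny) (into cv)))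
              where
              nx : N x (h c)
              nx = h-nonadjacent c (inT 0 z≤n) (<⇒≤ c<d) (λ e → st.¬P′ c c<d (Ry-complete
                (λ { zero _ → E-sym e ; (suc i) i<m → into cv (suc i) (s≤s z≤n) i<m })))
              ny : N y (h c)
              ny = h-nonadjacent c (inT m ≤-refl) (<⇒≤ c<d) (λ e → st.¬P c 0<c (<⇒≤ c<d) (Rx-complete
                (λ i 0<i i≤m → [ into cv i 0<i , (λ { refl → E-sym e }) ]′ (m≤n⇒m<n∨m≡n i≤m))))
            by-length : d ≡ 3 ⊎ 5 ≤ d → Q
            by-length (inj₂ 5≤d) = avoid st.isPath st.odd 5≤d start* end* inner*
            -- The stretch is too short for the induction hypothesis. It yields an odd antipath from
            -- `h 1` to `h 2` through `T*`, closed by `f 0`.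
            by-length (inj₁ d≡3) = ⊥-elim (odd-antipath-closed
              (square-antipath conn* (h.step 0 (s≤s z≤n)) (h.step 1 (s≤s (s≤s z≤n))) (h.step 2 (s≤s (s≤s (s≤s z≤n))))
                (h.far 0 2 ≤-refl (s≤s (s≤s z≤n))) (h.far 1 3 ≤-refl ≤-refl) (h.far 0 3 (s≤s (s≤s z≤n)) ≤-refl)
                start* (subst (Complete T* ∘ h) d≡3 end*) (inner* 1 (s≤s z≤n) (≤-trans (s≤s (s≤s z≤n)) 3≤d)) (inner* 2 (s≤s z≤n) 3≤d))
              (λ t t∈ → c₀ t (T*⊆T t∈)) (st.f₀-inner 1 (s≤s z≤n) (≤-trans (s≤s (s≤s z≤n)) 3≤d)) (st.f₀-inner 2 (s≤s z≤n) 3≤d))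
              where module h = IsPath (subst (IsPath E N h) d≡3 st.isPath)

        stretch-impossible : Q
        stretch-impossible = by-length (odd-cases st.odd)
          where
          long : 3 ≤ d → d ≡ 3 ⊎ 5 ≤ d → Q
          long 3≤d cases = by-antipath m′ refl
            where
            by-antipath : ∀ j → m′ ≡ j → Q
            by-antipath zero    eq = single-edge eq 3≤d
            by-antipath (suc j) eq = interior j eq 3≤d cases
          by-length : d ≡ 1 ⊎ d ≡ 3 ⊎ 5 ≤ d → Q
          by-length (inj₁ eq)          = ⊥-elim (adjacent-pair eq)
          by-length (inj₂ (inj₁ eq))   = long (≤-reflexive (sym eq)) (inj₁ eq)
          by-length (inj₂ (inj₂ 5≤d))  = long (≤-trans (s≤s (s≤s (s≤s z≤n))) 5≤d) (inj₂ 5≤d)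

      antipath-impossible : Q
      antipath-impossible = odd-length λ oddₘ → go oddₘ (interleave (VR Rx) (VR Ry) k oddₖ
          (dec-true (complete? Rx (f 0)) (restrict cx c₀)) (dec-true (complete? Ry (f 0)) (restrict cy c₀))
          (dec-true (complete? Rx (f k)) (restrict cx cₖ)) (dec-true (complete? Ry (f k)) (restrict cy cₖ)))
        where
        VR : Subset n → ℕ → Bool
        VR R = does ∘ complete? R ∘ f
        both⇒complete : ∀ m → VR Rx m ≡ true → VR Ry m ≡ true → Complete T (f m)
        both⇒complete m a b =
          doubly-complete cx cy x≢y (does-true (complete? Rx (f m)) a) (does-true (complete? Ry (f m)) b)
        go : parity m ≡ true → Interleaving (VR Rx) (VR Ry) k → Q
        go oddₘ (gapˡ g) = no-R-gap cx g
        go oddₘ (gapʳ g) = no-R-gap cy g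
        go oddₘ (both zero m<k a b c d) =
          ⊥-elim (none 1 ≤-refl (≤-trans (s≤s (s≤s z≤n)) 5≤k) (both⇒complete 1 c d))
        go oddₘ (both (suc m) m<k a b c d) = ⊥-elim (none (suc m) (s≤s z≤n) m<k (both⇒complete (suc m) a b))
        go oddₘ (crossˡ g) = stretch-impossible oddₘ
          (stretchˡ (complete? Rx) (complete? Ry) (restrict cx c₀) (restrict cy c₀) (restrict cx cₖ) (restrict cy cₖ) g)
        go oddₘ (crossʳ g) = stretch-impossible oddₘ
          (stretchʳ (complete? Ry) (complete? Rx) (restrict cy c₀) (restrict cx c₀) (restrict cy cₖ) (restrict cx cₖ) g)

    -- Non-cut vertices are sought in turn outside a non-neighbour t of `f 1`, outside the first one
    -- found, and outside an antipath joining the first two. If T is just t, then t closes the path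
    -- to an odd hole. If the antipath exhausts T, the antipath argument applies; otherwise there
    -- are three non-cut vertices.
    minimal-impossible : Q
    minimal-impossible with t , t∈ , ¬e ← incomplete (none 1 ≤-refl (≤-trans (s≤s (s≤s z≤n)) 5≤k))
      with C.noncut-outside connT (λ v∈ → subst (_∈ T) (sym (x∈⁅y⁆⇒x≡y t v∈)) t∈) (C.connected-single t) (t , x∈⁅x⁆ t)
    ... | inj₁ T⊆ = ⊥-elim (true≢false (trans (sym oddₖ)
      (evenE k f t (≤-trans (s≤s (s≤s z≤n)) 5≤k) path (E-sym (c₀ t t∈)) (E-sym (cₖ t t∈))
        (λ i 0<i i<k → nonadjacent t∈ (<⇒≤ i<k) (λ e → none i 0<i i<k
          (λ s s∈ → subst (E (f i)) (sym (x∈⁅y⁆⇒x≡y t (T⊆ s∈))) (E-sym e)))))))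
    ... | inj₂ (x , cx , ⊆Rx)
      with C.noncut-outside connT (λ v∈ → subst (_∈ T) (sym (x∈⁅y⁆⇒x≡y x v∈)) (C.NonCut.x∈T cx)) (C.connected-single x) (x , x∈⁅x⁆ x)
    ... | inj₁ T⊆ = ⊥-elim (C.NonCut.x∉R cx (subst (_∈ C.NonCut.R cx) (x∈⁅y⁆⇒x≡y x (T⊆ t∈)) (⊆Rx (x∈⁅x⁆ t))))
    ... | inj₂ (y , cy , ⊆Ry) = from-path (C.shorten {X = _∈ T} (C.NonCut.x∈T cx) (connT (C.NonCut.x∈T cx) (C.NonCut.x∈T cy)))
      where
      x≢y : x ≢ y
      x≢y refl = C.NonCut.x∉R cy (⊆Ry (x∈⁅x⁆ x))
      from-path : C.PathIn (_∈ T) x y → Q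
      from-path record { len = zero ; start = refl ; end = end } = contradiction end x≢y
      from-path record { len = suc m ; f = g ; isPath = gp ; start = refl ; end = refl ; inside = inside }
        with C.noncut-outside connT image⊆T (C.connected-image (suc m) gp) (g 0 , ∈-image⁺ (suc m) g z≤n)
        where
        image⊆T : image (suc m) g ⊆ T
        image⊆T v∈ with i , i≤ , refl ← ∈-image⁻ (suc m) g v∈ = inside i i≤
      ... | inj₁ T⊆ = Antipath.antipath-impossible gp cx cy inside (λ t∈ → ∈-image⁻ (suc m) g (T⊆ t∈))
      ... | inj₂ (z , cz , ⊆Rz) = three-noncut cx cy cz x≢y
        (λ { refl → C.NonCut.x∉R cz (⊆Rz (∈-image⁺ (suc m) g z≤n)) })
        (λ { refl → C.NonCut.x∉R cz (⊆Rz (∈-image⁺ (suc m) g ≤-refl)) })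

  no-odd-path : ∀ T → Connected N T → NoOddPath leap T
  no-odd-path T = go (suc ∣ T ∣) T ≤-refl
    where
    go : ∀ m T → ∣ T ∣ < m → Connected N T → NoOddPath leap T
    go (suc m) T (s≤s ∣T∣≤m) conn path odd 5≤k c₀ cₖ none = Minimal.minimal-impossible conn
      (λ T′ lt → go m T′ (<-≤-trans lt ∣T∣≤m)) path odd 5≤k c₀ cₖ none

-- Skew partitions and odd links

record Partition {n : ℕ} (A X : Subset n) : Set where
  field
    disjoint : ∀ {v} → v ∈ A → v ∈ X → ⊥
    inA      : ∀ {v} → v ∉ X → v ∈ A
    inX      : ∀ {v} → v ∉ A → v ∈ X

partition-∁ : ∀ {n} (X : Subset n) → Partition (∁ X) X
partition-∁ X = record
  { disjoint = λ v∈∁ v∈ → x∈∁p⇒x∉p v∈∁ v∈ ; inA = x∉p⇒x∈∁p ; inX = x∉∁p⇒x∈p }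

flip-partition : ∀ {n} {A X : Subset n} → Partition A X → Partition X A
flip-partition p = record { disjoint = λ x a → disjoint a x ; inA = inX ; inX = inA }
  where open Partition p

-- A positive form of disconnectedness: with R nonadjacency, X is disconnected in the graph, with R
-- adjacency, in the complement. The set C is consulted only inside X.
record Split {n : ℕ} (R : Rel (Fin n) 0ℓ) (X : Subset n) : Set where
  field
    C     : Subset n
    c d   : Fin n
    c∈X   : c ∈ X
    c∈C   : c ∈ C
    d∈X   : d ∈ X
    d∉C   : d ∉ C
    cross : ∀ {x y} → x ∈ X → x ∈ C → y ∈ X → y ∉ C → R x y

-- The ends of an odd path are nonadjacent exactly when its length is at least three. So balance
-- means that neither `OddLink E N A X` nor `OddLink N E X A` is inhabited.
record OddLink {n : ℕ} (E N : Rel (Fin n) 0ℓ) (A X : Subset n) : Set where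
  field
    k      : ℕ
    f      : ℕ → Fin n
    isPath : IsPath E N f k
    odd    : parity k ≡ true
    3≤k    : 3 ≤ k
    start  : f 0 ∈ X
    end    : f k ∈ X
    inner  : ∀ i → 0 < i → i < k → f i ∈ A

-- A skew partition that is not balanced has an odd link of one of the two kinds, and the two
-- handlers turn each kind into the goal; a balanced one is itself an instance of the goal.
Balancing : ∀ {n} (E N : Rel (Fin n) 0ℓ) → Set₁ → Set₁
Balancing {n} E N Q = ∀ (A X : Subset n) → Partition A X → Split N A → Split E X →
  (OddLink E N A X → Q) → (OddLink N E X A → Q) → Q

record Escapes {n : ℕ} (B : BergePair n) (Q : Set₁) : Set₁ where
  open BergePair B
  field
    leapE    : Leap E N → Q
    leapN    : Leap N E → Q
    balanced : Balancing E N Q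

flip-escapes : ∀ {n} {B : BergePair n} {Q} → Escapes B Q → Escapes (op B) Q
flip-escapes x = record
  { leapE = leapN ; leapN = leapE
  ; balanced = λ A X part sA sX p q → balanced X A (flip-partition part) sX sA q p }
  where open Escapes x

odd≥2⇒≥3 : ∀ {k} → parity k ≡ true → 2 ≤ k → 3 ≤ k
odd≥2⇒≥3 {suc (suc (suc k))} _ _ = s≤s (s≤s (s≤s z≤n))
odd≥2⇒≥3 {suc zero} _ (s≤s ())

-- Balancing a partition in which a vertex of X misses a component

module Skew {n : ℕ} (B : BergePair n) {Q : Set₁} (escapes : Escapes B Q) where

  open BergePair B
  open Basics B
  open RousselRubio B
  open Escapes escapes
  private
    V = Fin n
    module C = Basics (op B)
    module R° = RousselRubio (op B)

  -- `A₁` is a component of the graph without X. The vertex r outside both keeps the graph without X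
  -- disconnected while X changes.
  record Side (X A₁ : Subset n) : Set where
    field
      avoids : ∀ {v} → v ∈ A₁ → v ∉ X
      conn   : Connected E A₁
      a₀     : V
      a₀∈    : a₀ ∈ A₁
      closed : ∀ {a v} → a ∈ A₁ → v ∉ X → E a v → v ∈ A₁
      r      : V
      r∉X    : r ∉ X
      r∉A₁   : r ∉ A₁

    apart : ∀ {a v} → a ∈ A₁ → v ∉ X → v ∉ A₁ → N a v
    apart a∈ v∉X v∉A₁ = notE (λ { refl → v∉A₁ a∈ }) (λ e → v∉A₁ (closed a∈ v∉X e))

  path-through-parity : ∀ {T a b k f} → IsPath E N f k → 2 ≤ k → f 0 ≡ a → f k ≡ b → N a b →
    (p : PathThrough T a b) → (∀ i j → 0 < i → i < k → j ∈ T → N (f i) j) → parity k ≡ parity (PathThrough.len p)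
  path-through-parity {k = k} {f} path 2≤k refl refl nab p apart = close-paths 2≤k
    (nonadjacent-length isPath (subst₂ N (sym start) (sym end) nab)) path isPath (sym start) (sym end)
    (λ i j 0<i i<k 0<j j<l → apart i _ 0<i i<k (inner j 0<j j<l))
    where open PathThrough p

  module _ {X A₁ : Subset n} (side : Side X A₁) (split : Split E X)
    (attached : ∀ {v w} → v ∈ X → w ∈ X → N v w → ∃ λ s → s ∈ A₁ × E v s)
    (no-path : OddLink E N A₁ X → Q) (no-antipath : OddLink N E X A₁ → Q) where

    open Side side

    private
      -- The interior is connected, so it lies in `A₁` or misses it. In the second case the
      -- nonadjacent ends both attach to `A₁`, and a path between them through `A₁` has the same
      -- parity.
      odd-path : OddLink E N (∁ X) X → Q
      odd-path p with f 1 ∈? A₁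
        where open OddLink p
      ... | yes f₁∈ = no-path record { OddLink p ; inner = λ { (suc i) _ i<k → inside i i<k } }
        where
        open OddLink p
        inside : ∀ i → suc i < k → f (suc i) ∈ A₁
        inside zero    _   = f₁∈
        inside (suc i) i<k = closed (inside i (<-trans (n<1+n _) i<k)) (x∈∁p⇒x∉p (inner (suc (suc i)) (s≤s z≤n) i<k))
          (IsPath.step isPath (suc i) (<-trans (n<1+n _) i<k))
      ... | no f₁∉ = via (path-through conn s∈ t∈ us (E-sym vt))
        where
        open OddLink p
        outside : ∀ i → suc i < k → f (suc i) ∉ A₁
        outside zero    _   = f₁∉
        outside (suc i) i<k i∈ = outside i (<-trans (n<1+n _) i<k)
          (closed i∈ (x∈∁p⇒x∉p (inner (suc i) (s≤s z≤n) (<-trans (n<1+n _) i<k)))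
            (E-sym (IsPath.step isPath (suc i) (<-trans (n<1+n _) i<k))))
        nab : N (f 0) (f k)
        nab = IsPath.far isPath 0 k (≤-trans (s≤s (s≤s z≤n)) 3≤k) ≤-refl
        at₀ = attached start end nab
        atₖ = attached end start (N-sym nab)
        s∈ = proj₁ (proj₂ at₀)
        us = proj₂ (proj₂ at₀)
        t∈ = proj₁ (proj₂ atₖ)
        vt = proj₂ (proj₂ atₖ)
        via : PathThrough A₁ (f 0) (f k) → Q
        via q = no-path record
          { k = q.len ; f = q.f ; isPath = q.isPath ; odd = oddq
          ; 3≤k = odd≥2⇒≥3 oddq (nonadjacent-length q.isPath (subst₂ N (sym q.start) (sym q.end) nab))
          ; start = subst (_∈ X) (sym q.start) start ; end = subst (_∈ X) (sym q.end) end ; inner = q.inner }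
          where
          module q = PathThrough q
          oddq : parity q.len ≡ true
          oddq = trans (sym (path-through-parity isPath (<⇒≤ 3≤k) refl refl nab q
            (λ { (suc i) j _ i<k j∈ → N-sym (apart j∈ (x∈∁p⇒x∉p (inner (suc i) (s≤s z≤n) i<k)) (outside i i<k)) }))) odd

      -- The ends are adjacent, so both or neither lie in `A₁`. If neither does, they are
      -- anticomplete to `A₁`, while each inner vertex has a neighbour there. In the complement this
      -- is an odd path with ends complete to the anticonnected set `A₁`, and the Roussel-Rubio
      -- lemma applies; in length three the antipath of the complement is an odd path through `A₁`.
      odd-antipath : OddLink N E X (∁ X) → Q
      odd-antipath p with f 0 ∈? A₁
        where open OddLink p
      ... | yes f₀∈ = no-antipath record { OddLink p ; start = f₀∈ ; end = closed f₀∈ (x∈∁p⇒x∉p end)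
              (IsPath.far isPath 0 k (≤-trans (s≤s (s≤s z≤n)) 3≤k) ≤-refl) }
        where open OddLink p
      ... | no f₀∉ = by-length (odd-cases odd)
        where
        open OddLink p
        fₖ∉ : f k ∉ A₁
        fₖ∉ fₖ∈ = f₀∉ (closed fₖ∈ (x∈∁p⇒x∉p start)
          (E-sym (IsPath.far isPath 0 k (≤-trans (s≤s (s≤s z≤n)) 3≤k) ≤-refl)))
        touched : ∀ i → 0 < i → i < k → ∃ λ s → s ∈ A₁ × E (f i) s
        touched (suc zero) _ i<k = attached (inner 1 ≤-refl i<k) (inner 2 (s≤s z≤n) 3≤k)
          (IsPath.step isPath 1 (<⇒≤ 3≤k))
        touched (suc (suc i)) _ i<k = attached (inner (suc (suc i)) (s≤s z≤n) i<k)
          (inner (suc i) (s≤s z≤n) (<-trans (n<1+n _) i<k)) (N-sym (IsPath.step isPath (suc i) (<-trans (n<1+n _) i<k)))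
        incomplete° : ∀ i → 0 < i → i < k → ¬ C.Complete A₁ (f i)
        incomplete° i 0<i i<k c = let s , s∈ , e = touched i 0<i i<k in EN e (c s s∈)
        c₀ : C.Complete A₁ (f 0)
        c₀ t t∈ = N-sym (apart t∈ (x∈∁p⇒x∉p start) f₀∉)
        cₖ : C.Complete A₁ (f k)
        cₖ t t∈ = N-sym (apart t∈ (x∈∁p⇒x∉p end) fₖ∉)
        by-length : k ≡ 1 ⊎ k ≡ 3 ⊎ 5 ≤ k → Q
        by-length (inj₁ eq) = contradiction (subst (3 ≤_) eq 3≤k) λ { (s≤s ()) }
        by-length (inj₂ (inj₂ 5≤k)) = Shortest.no-odd-path (op B) leapN A₁ conn isPath odd 5≤k c₀ cₖ incomplete°
        by-length (inj₂ (inj₁ k≡3)) = no-path record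
          { k = q.len ; f = q.f ; isPath = q.isPath ; odd = q.odd ; 3≤k = odd≥2⇒≥3 q.odd q.2≤len
          ; start = subst (_∈ X) (sym q.start) (inner 1 ≤-refl (<⇒≤ 3≤k))
          ; end = subst (_∈ X) (sym q.end) (inner 2 (s≤s z≤n) 3≤k) ; inner = q.inner }
          where
          module h = IsPath (subst (IsPath N E f) k≡3 isPath)
          module q = R°.OddAntipath (R°.square-antipath conn
            (h.step 0 (s≤s z≤n)) (h.step 1 (s≤s (s≤s z≤n))) (h.step 2 (s≤s (s≤s (s≤s z≤n))))
            (h.far 0 2 ≤-refl (s≤s (s≤s z≤n))) (h.far 1 3 ≤-refl ≤-refl) (h.far 0 3 (s≤s (s≤s z≤n)) ≤-refl)
            c₀ (subst (C.Complete A₁ ∘ f) k≡3 cₖ) (incomplete° 1 ≤-refl (<⇒≤ 3≤k)) (incomplete° 2 (s≤s z≤n) 3≤k))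

    -- Links involving the single component `A₁` control all others, provided that every vertex of X
    -- with a non-neighbour in X attaches to `A₁`.
    kernel : Q
    kernel = balanced (∁ X) X (partition-∁ X)
      record { C = A₁ ; c = a₀ ; d = r ; c∈X = x∉p⇒x∈∁p (avoids a₀∈) ; c∈C = a₀∈ ; d∈X = x∉p⇒x∈∁p r∉X ; d∉C = r∉A₁
             ; cross = λ _ x∈ y∈ y∉ → apart x∈ (x∈∁p⇒x∉p y∈) y∉ }
      split odd-path odd-antipath

  -- An anticomponent of X, in a form that survives the addition to X of a vertex complete to D.
  record Block (X D : Subset n) : Set where
    field
      D⊆X   : D ⊆ X
      conn  : Connected N D
      d     : V
      d∈D   : d ∈ D
      joined : ∀ {x y} → x ∈ D → y ∈ X → y ∉ D → E x y

  module _ {X A₁ D : Subset n} (side : Side X A₁) (block : Block X D)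
    {b} (b∈X : b ∈ X) (b∉D : b ∉ D) (b-far : ∀ {a} → a ∈ A₁ → N b a) where

    open Side side
    private module D = Block block

    private
      Neighbour : V → Set
      Neighbour v = v ∈ X × ∃ λ s → s ∈ A₁ × E v s
      neighbour? : U.Decidable Neighbour
      neighbour? v = (v ∈? X) ×-dec Fin.any? (λ s → (s ∈? A₁) ×-dec E? v s)
      M : Subset n
      M = comprehension neighbour?
      M⁻ : ∀ {v} → v ∈ M → Neighbour v
      M⁻ = ∈-comprehension⁻ neighbour?
      M⁺ : ∀ {v} → Neighbour v → v ∈ M
      M⁺ = ∈-comprehension⁺ neighbour?

      side-shrink : ∀ {X′} → X′ ⊆ X → M ⊆ X′ → Side X′ A₁
      side-shrink {X′} ⊆X M⊆ = record
        { Side side ; avoids = λ v∈ v∈X′ → avoids v∈ (⊆X v∈X′) ; closed = closed′ ; r∉X = λ r∈ → r∉X (⊆X r∈) }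
        where
        closed′ : ∀ {a v} → a ∈ A₁ → v ∉ X′ → E a v → v ∈ A₁
        closed′ {a} {v} a∈ v∉ e with v ∈? X
        ... | yes v∈X = contradiction (M⊆ (M⁺ (v∈X , a , a∈ , E-sym e))) v∉
        ... | no  v∉X = closed a∈ v∉X e

    module _ (no-path : OddLink E N A₁ X → Q) (no-antipath : OddLink N E X A₁ → Q) where

      private
        shrink : ∀ {X′} → X′ ⊆ X → M ⊆ X′ → Split E X′ →
                 (∀ {v w} → v ∈ X′ → w ∈ X′ → N v w → ∃ λ s → s ∈ A₁ × E v s) → Q
        shrink ⊆X M⊆ split attached = kernel (side-shrink ⊆X M⊆) split attached
          (λ p → no-path record { OddLink p ; start = ⊆X (OddLink.start p) ; end = ⊆X (OddLink.end p) })
          (λ p → no-antipath record { OddLink p ; inner = λ i 0<i i<k → ⊆X (OddLink.inner p i 0<i i<k) })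

        -- As e is complete to Y, it splits off from Y in the complement, and nonadjacent pairs of
        -- distinct vertices lie inside Y, where attachment to `A₁` is known.
        cone : ∀ {Y e m} → Y ⊆ X → e ∈ X → M ⊆ Y → m ∈ Y → (∀ {y} → y ∈ Y → E y e) →
               (∀ {v w} → v ∈ Y → w ∈ Y → N v w → ∃ λ s → s ∈ A₁ × E v s) → Q
        cone {Y} {e} {m} Y⊆X e∈X M⊆Y m∈Y ye attached = shrink (insert-⊆ Y⊆X e∈X) (λ v∈ → ∪-insert Y (M⊆Y v∈))
          record { C = Y ; c = m ; d = e ; c∈X = ∪-insert Y m∈Y ; c∈C = m∈Y ; d∈X = ∈-insert Y e
                 ; d∉C = λ e∈ → E-irr (ye e∈) ; cross = cross }
          attached′
          where
          cross : ∀ {x y} → x ∈ Y ∪ ⁅ e ⁆ → x ∈ Y → y ∈ Y ∪ ⁅ e ⁆ → y ∉ Y → E x y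
          cross _ x∈ y∈ y∉ with insert⁻ Y y∈
          ... | inj₁ y∈Y  = contradiction y∈Y y∉
          ... | inj₂ refl = ye x∈
          attached′ : ∀ {v w} → v ∈ Y ∪ ⁅ e ⁆ → w ∈ Y ∪ ⁅ e ⁆ → N v w → ∃ λ s → s ∈ A₁ × E v s
          attached′ v∈ w∈ nvw with insert⁻ Y v∈ | insert⁻ Y w∈
          ... | inj₁ v∈Y  | inj₁ w∈Y  = attached v∈Y w∈Y nvw
          ... | inj₁ v∈Y  | inj₂ refl = contradiction nvw (EN (ye v∈Y))
          ... | inj₂ refl | inj₁ w∈Y  = contradiction (N-sym nvw) (EN (ye w∈Y))
          ... | inj₂ refl | inj₂ refl = contradiction nvw N-irr

        M⊆X : M ⊆ X
        M⊆X v∈ = proj₁ (M⁻ v∈)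

      -- M consists of the attachments of A₁ in X, and X is replaced by M. If D or X ∖ D misses M, then
      -- a vertex complete to M is added; if both do, then X is replaced by two adjacent vertices.
      shrink-to-attachments : Q
      shrink-to-attachments with Fin.any? (λ v → (v ∈? M) ×-dec (v ∈? D)) | Fin.any? (λ v → (v ∈? M) ×-dec ¬? (v ∈? D))
      ... | yes (v , v∈M , v∈D) | yes (w , w∈M , w∉D) = shrink M⊆X (λ v∈ → v∈)
        record { C = D ; c = v ; d = w ; c∈X = v∈M ; c∈C = v∈D ; d∈X = w∈M ; d∉C = w∉D
               ; cross = λ _ x∈D y∈M y∉D → D.joined x∈D (M⊆X y∈M) y∉D }
        (λ v∈ _ _ → proj₂ (M⁻ v∈))
      ... | yes (v , v∈M , _) | no ¬out = cone M⊆X b∈X (λ v∈ → v∈) v∈M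
        (λ {y} y∈ → case y ∈? D of λ { (yes y∈D) → D.joined y∈D b∈X b∉D ; (no y∉D) → contradiction (y , y∈ , y∉D) ¬out })
        (λ v∈ _ _ → proj₂ (M⁻ v∈))
      ... | no ¬in | yes (v , v∈M , _) = cone M⊆X (D.D⊆X D.d∈D) (λ v∈ → v∈) v∈M
        (λ {y} y∈ → E-sym (D.joined D.d∈D (M⊆X y∈) (λ y∈D → ¬in (y , y∈ , y∈D))))
        (λ v∈ _ _ → proj₂ (M⁻ v∈))
      ... | no ¬in | no ¬out = cone {Y = ⁅ D.d ⁆} {e = b}
        (λ v∈ → subst (_∈ X) (sym (x∈⁅y⁆⇒x≡y D.d v∈)) (D.D⊆X D.d∈D)) b∈X
        (λ {v} v∈ → case v ∈? D of λ { (yes v∈D) → contradiction (v , v∈ , v∈D) ¬in ; (no v∉D) → contradiction (v , v∈ , v∉D) ¬out })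
        (x∈⁅x⁆ D.d)
        (λ y∈ → subst (λ y → E y b) (sym (x∈⁅y⁆⇒x≡y D.d y∈)) (D.joined D.d∈D b∈X b∉D))
        (λ v∈ w∈ nvw → contradiction nvw (λ nvw → N-irr (subst₂ N (x∈⁅y⁆⇒x≡y D.d v∈) (x∈⁅y⁆⇒x≡y D.d w∈) nvw)))

    module _ (¬complete : ∀ {a} → a ∈ A₁ → ¬ Complete D a) where

      private
        b-complete : Complete D b
        b-complete t t∈ = E-sym (D.joined t∈ b∈X b∉D)

        -- The ends are nonadjacent, so both or neither lie in D. If both do, b is adjacent to both
        -- and closes an odd hole. If neither does, they are complete to D and the Roussel-Rubio
        -- lemma applies; in length three b closes the odd antipath through D.
        no-path : OddLink E N A₁ X → Q
        no-path p with f 0 ∈? D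
          where open OddLink p
        ... | yes f₀∈ = ⊥-elim (true≢false (trans (sym odd)
          (evenE k f b (<⇒≤ 3≤k) isPath (b-complete _ f₀∈) (b-complete _ fₖ∈) (λ i 0<i i<k → b-far (inner i 0<i i<k)))))
          where
          open OddLink p
          fₖ∈ : f k ∈ D
          fₖ∈ with f k ∈? D
          ... | yes q = q
          ... | no fₖ∉ = ⊥-elim (EN (D.joined f₀∈ end fₖ∉) (IsPath.far isPath 0 k (≤-trans (s≤s (s≤s z≤n)) 3≤k) ≤-refl))
        ... | no f₀∉ = by-length (odd-cases odd)
          where
          open OddLink p
          fₖ∉ : f k ∉ D
          fₖ∉ fₖ∈ = EN (E-sym (D.joined fₖ∈ start f₀∉)) (IsPath.far isPath 0 k (≤-trans (s≤s (s≤s z≤n)) 3≤k) ≤-refl)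
          c₀ : Complete D (f 0)
          c₀ t t∈ = E-sym (D.joined t∈ start f₀∉)
          cₖ : Complete D (f k)
          cₖ t t∈ = E-sym (D.joined t∈ end fₖ∉)
          by-length : k ≡ 1 ⊎ k ≡ 3 ⊎ 5 ≤ k → Q
          by-length (inj₁ eq) = contradiction (subst (3 ≤_) eq 3≤k) λ { (s≤s ()) }
          by-length (inj₂ (inj₂ 5≤k)) = Shortest.no-odd-path B leapE D D.conn isPath odd 5≤k c₀ cₖ
            (λ i 0<i i<k → ¬complete (inner i 0<i i<k))
          by-length (inj₂ (inj₁ k≡3)) = ⊥-elim (odd-antipath-closed (square-antipath D.conn
            (h.step 0 (s≤s z≤n)) (h.step 1 (s≤s (s≤s z≤n))) (h.step 2 (s≤s (s≤s (s≤s z≤n))))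
            (h.far 0 2 ≤-refl (s≤s (s≤s z≤n))) (h.far 1 3 ≤-refl ≤-refl) (h.far 0 3 (s≤s (s≤s z≤n)) ≤-refl)
            c₀ (subst (Complete D ∘ f) k≡3 cₖ) (¬complete f₁∈) (¬complete f₂∈)) b-complete (b-far f₁∈) (b-far f₂∈))
            where
            module h = IsPath (subst (IsPath E N f) k≡3 isPath)
            f₁∈ = inner 1 ≤-refl (<⇒≤ 3≤k)
            f₂∈ = inner 2 (s≤s z≤n) 3≤k

        -- The interior is anticonnected, so it lies in D or misses it. In the second case an
        -- antipath through D with the same ends has the same parity, since D is complete to the
        -- rest of X. Either way b, complete to D and anticomplete to `A₁`, closes an odd antihole.
        no-antipath : OddLink N E X A₁ → Q
        no-antipath p with f 1 ∈? D
          where open OddLink p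
        ... | yes f₁∈ = ⊥-elim (true≢false (trans (sym odd)
          (evenN k f b (<⇒≤ 3≤k) isPath (b-far start) (b-far end) (λ { (suc i) _ i<k → b-complete _ (inside i i<k) }))))
          where
          open OddLink p
          inside : ∀ i → suc i < k → f (suc i) ∈ D
          inside zero    _   = f₁∈
          inside (suc i) i<k with f (suc (suc i)) ∈? D
          ... | yes q = q
          ... | no ∉D = ⊥-elim (EN (D.joined (inside i (<-trans (n<1+n _) i<k)) (inner (suc (suc i)) (s≤s z≤n) i<k) ∉D)
            (IsPath.step isPath (suc i) (<-trans (n<1+n _) i<k)))
        ... | no f₁∉ with incomplete (¬complete (OddLink.start p)) | incomplete (¬complete (OddLink.end p))
        ... | s , s∈ , ¬es | t , t∈ , ¬et = ⊥-elim (true≢false (trans (sym odd) (trans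
            (same-parity q) (evenN q.len q.f b q-long q.isPath
              (subst (N b) (sym q.start) (b-far start)) (subst (N b) (sym q.end) (b-far end))
              (λ i 0<i i<l → b-complete _ (q.inner i 0<i i<l))))))
          where
          open OddLink p
          outside : ∀ i → suc i < k → f (suc i) ∉ D
          outside zero    _   = f₁∉
          outside (suc i) i<k i∈ = EN (E-sym (D.joined i∈ (inner (suc i) (s≤s z≤n) (<-trans (n<1+n _) i<k)) (outside i (<-trans (n<1+n _) i<k))))
            (IsPath.step isPath (suc i) (<-trans (n<1+n _) i<k))
          distinct : ∀ {a t} → a ∈ A₁ → t ∈ D → a ≢ t
          distinct a∈ t∈ refl = avoids a∈ (D.D⊆X t∈)
          q : C.PathThrough D (f 0) (f k)
          q = C.path-through D.conn s∈ t∈ (notE (distinct start s∈) ¬es) (N-sym (notE (distinct end t∈) ¬et))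
          module q = C.PathThrough q
          eab : E (f 0) (f k)
          eab = IsPath.far isPath 0 k (≤-trans (s≤s (s≤s z≤n)) 3≤k) ≤-refl
          q-long : 2 ≤ q.len
          q-long = C.nonadjacent-length q.isPath (subst₂ E (sym q.start) (sym q.end) eab)
          same-parity : (q : C.PathThrough D (f 0) (f k)) → parity k ≡ parity (C.PathThrough.len q)
          same-parity q = C.close-paths (<⇒≤ 3≤k)
            (C.nonadjacent-length isPath′ (subst₂ E (sym start′) (sym end′) eab)) isPath isPath′ (sym start′) (sym end′)
            (λ { (suc i) j _ i<k 0<j j<l → E-sym (D.joined (inner′ j 0<j j<l) (inner (suc i) (s≤s z≤n) i<k) (outside i i<k)) })
            where open C.PathThrough q renaming (isPath to isPath′; start to start′; end to end′; inner to inner′)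

      no-complete-vertex : Q
      no-complete-vertex = shrink-to-attachments no-path no-antipath

  -- A vertex of A₁ complete to D is moved into X until none is left.
  loose : ∀ m {X A₁ D} → ∣ A₁ ∣ < m → Side X A₁ → Block X D →
          ∀ {b} → b ∈ X → b ∉ D → (∀ {a} → a ∈ A₁ → N b a) → Q
  loose (suc m) {X} {A₁} {D} (s≤s ∣A₁∣≤m) side block {b} b∈X b∉D b-far
    with Fin.any? (λ a → (a ∈? A₁) ×-dec complete? D a)
  ... | no none = no-complete-vertex side block b∈X b∉D b-far (λ {a} a∈ c → none (a , a∈ , c))
  ... | yes (a , a∈ , ca) with Fin.any? (λ v → (v ∈? A₁) ×-dec ¬? (v Fin.≟ a))
  -- Here `A₁` is just a, whereas an odd path needs two inner vertices and an odd antipath two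
  -- distinct ends in `A₁`.
  ... | no only = shrink-to-attachments side block b∈X b∉D b-far
    (λ p → let open OddLink p in ⊥-elim (path-distinct isPath (≤-refl {2}) (<⇒≤ 3≤k)
      (trans (≡a (inner 1 ≤-refl (<⇒≤ 3≤k))) (sym (≡a (inner 2 (s≤s z≤n) 3≤k))))))
    (λ p → let open OddLink p in ⊥-elim (C.path-distinct isPath (≤-trans (s≤s z≤n) 3≤k) ≤-refl (trans (≡a start) (sym (≡a end)))))
    where
    ≡a : ∀ {v} → v ∈ A₁ → v ≡ a
    ≡a {v} v∈ with v Fin.≟ a
    ... | yes eq = eq
    ... | no v≢a = contradiction (v , v∈ , v≢a) only
  -- The new side is a component of `A₁` without a. D stays a block because a is complete to it, and
  -- b still misses the new side.
  ... | yes (v , v∈ , v≢a) = loose m (<-≤-trans (≤-<-trans (p⊆q⇒∣p∣≤∣q∣ S⊆X) (x∈p⇒∣p-x∣<∣p∣ a∈)) ∣A₁∣≤m)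
    side′ block′ (∪-insert X b∈X) b∉D (λ s∈ → b-far (S⊆A₁ s∈))
    where
    open Side side using (avoids; closed; r; r∉X; r∉A₁)
    open Block block using (D⊆X; joined)
    open Component (component (A₁ - a) (x∈p∧x≢y⇒x∈p-y v∈ v≢a)) renaming (closed to S-closed)
    S⊆A₁ : S ⊆ A₁
    S⊆A₁ s∈ = p─q⊆p A₁ ⁅ a ⁆ (S⊆X s∈)
    a∉S : a ∉ S
    a∉S a∈S = <-irrefl refl (<-≤-trans (x∈p⇒∣p-x∣<∣p∣ a∈) (p⊆q⇒∣p∣≤∣q∣ A₁⊆))
      where
      A₁⊆ : A₁ ⊆ A₁ - a
      A₁⊆ {v} v∈ with v Fin.≟ a
      ... | yes refl = S⊆X a∈S
      ... | no v≢a   = x∈p∧x≢y⇒x∈p-y v∈ v≢a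
    side′ : Side (X ∪ ⁅ a ⁆) S
    side′ = record
      { avoids = λ s∈ s∈X → [ avoids (S⊆A₁ s∈) , (λ { refl → a∉S s∈ }) ]′ (insert⁻ X s∈X)
      ; conn = conn ; a₀ = v ; a₀∈ = a∈S
      ; closed = λ s∈ w∉ e → S-closed s∈ (x∈p∧x≢y⇒x∈p-y (closed (S⊆A₁ s∈) (λ w∈ → w∉ (∪-insert X w∈)) e)
                   (λ { refl → w∉ (∈-insert X a) })) e
      ; r = r ; r∉X = λ r∈ → [ r∉X , (λ { refl → r∉A₁ a∈ }) ]′ (insert⁻ X r∈)
      ; r∉A₁ = λ r∈ → r∉A₁ (S⊆A₁ r∈) }
    block′ : Block (X ∪ ⁅ a ⁆) D
    block′ = record { Block block ; D⊆X = λ d∈ → ∪-insert X (D⊆X d∈)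
      ; joined = λ x∈ y∈ y∉ → [ (λ y∈X → joined x∈ y∈X y∉) , (λ { refl → E-sym (ca _ x∈) }) ]′ (insert⁻ X y∈) }

-- The eight vertices that remain

-- The pairs x, y and z, w come from two components of A, the pairs u, v and p, q from two
-- anticomponents of X. Two paths u-x-y-v and p-z-w-q are tied together by the antipath x-p-q-y.
-- Only the four adjacencies between u, v and z, w are left open.
record Frame {n : ℕ} (E N : Rel (Fin n) 0ℓ) : Set where
  field
    u v x y p q z w : Fin n
    ux : E u x
    xy : E x y
    yv : E y v
    uy : N u y
    xv : N x v
    uv : N u v
    xp : N x p
    pq : N p q
    qy : N q y
    xq : E x q
    py : E p y
    pz : E p z
    zw : E z w
    wq : E w q
    pw : N p w
    zq : N z q
    xz : N x z
    xw : N x w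
    yz : N y z
    yw : N y w
    up : E u p
    uq : E u q
    vp : E v p
    vq : E v q

record Skewed {n : ℕ} (B : BergePair n) (A X : Subset n) : Set where
  open BergePair B
  field
    part   : Partition A X
    splitA : Split N A
    splitX : Split E X

flip-skewed : ∀ {n} {B : BergePair n} {A X} → Skewed B A X → Skewed (op B) X A
flip-skewed s = record { part = flip-partition part ; splitA = splitX ; splitX = splitA }
  where open Skewed s

module Components {n : ℕ} (B : BergePair n) where

  open BergePair B
  open Basics B

  module _ {A : Subset n} {a} (K : Component A a) where

    open Component K

    separated : ∀ {s v} → s ∈ S → v ∈ A → v ∉ S → N s v
    separated s∈ v∈ v∉ = notE (λ { refl → v∉ s∈ }) (λ e → v∉ (closed s∈ v∈ e))

    -- The component of a cannot meet both sides of the split.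
    outsider : Split N A → ∃ λ r → r ∈ A × r ∉ S
    outsider split with Split.c split ∈? S | Split.d split ∈? S
    ... | no c∉  | _      = _ , Split.c∈X split , c∉
    ... | yes _  | no d∉  = _ , Split.d∈X split , d∉
    ... | yes c∈ | yes d∈ with crossing (Split.C split) (conn c∈ d∈) (Split.c∈C split) (Split.d∉C split)
    ... | _ , _ , x∈C , y∉C , e , x∈ , y∈ = contradiction (Split.cross split (S⊆X x∈) x∈C (S⊆X y∈) y∉C) (EN e)

    disjoint-component : ∀ {r} → r ∉ S → (L : Component A r) → ∀ {v} → v ∈ Component.S L → v ∉ S
    disjoint-component r∉ L v∈L v∈S with crossing S (Component.conn L v∈L (Component.a∈S L)) v∈S r∉
    ... | _ , _ , x∈S , y∉S , e , _ , y∈L = y∉S (closed x∈S (Component.S⊆X L y∈L) e)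

module Loose {n : ℕ} (B : BergePair n) {Q : Set₁} (escapes : Escapes B Q) where

  open BergePair B
  open Basics B
  open RousselRubio B
  open Escapes escapes
  open Components B
  private
    V = Fin n
    module C = Basics (op B)
    module C° = Components (op B)

  -- The block is an anticomponent of X other than that of b; b is complete to it.
  component-loose : ∀ {A X a b} → Skewed B A X → (K : Component A a) → b ∈ X →
                    (∀ {s} → s ∈ Component.S K → N b s) → Q
  component-loose {A} {X} {a} {b} skew K b∈ far
    with outsider K (Skewed.splitA skew) | C°.outsider (C.component X b∈) (Skewed.splitX skew)
  ... | r , r∈ , r∉ | d , d∈ , d∉ = Skew.loose B escapes (suc ∣ S ∣) ≤-refl
    record { avoids = λ s∈ s∈X → disjoint (S⊆X s∈) s∈X ; conn = conn ; a₀ = a ; a₀∈ = a∈S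
           ; closed = λ s∈ v∉ e → closed s∈ (inA v∉) e ; r = r ; r∉X = λ r∈X → disjoint r∈ r∈X ; r∉A₁ = r∉ }
    record { D⊆X = L.S⊆X ; conn = L.conn ; d = d ; d∈D = L.a∈S ; joined = C°.separated L }
    b∈ (λ b∈L → C°.disjoint-component (C.component X b∈) d∉ L b∈L (C.Component.a∈S (C.component X b∈))) far
    where
    open Component K
    open Partition (Skewed.part skew)
    L = C.component X d∈
    module L = C.Component L

module OddLinks {n : ℕ} (B : BergePair n) {Q : Set₁} (escapes : Escapes B Q) where

  open BergePair B
  open Basics B
  open RousselRubio B
  open Escapes escapes
  open Components B
  private
    module C = Basics (op B)
    module C° = Components (op B)

  -- A vertex of K complete to L is, in the complement, a vertex that misses a component, so the
  -- partition can be balanced. If there is none, no inner vertex of the path is complete to L while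
  -- its ends are, and the Roussel-Rubio lemma applies.
  length-three : ∀ {A X a d k f} → Skewed B A X → (K : Component A a) (L : C.Component X d) →
    IsPath E N f k → parity k ≡ true → 3 ≤ k →
    f 0 ∈ X → f 0 ∉ C.Component.S L → f k ∈ X → f k ∉ C.Component.S L →
    (∀ i → 0 < i → i < k → f i ∈ Component.S K) →
    (k ≡ 3 → OddAntipath (C.Component.S L) (f 1) (f 2) → Q) → Q
  length-three {A} {X} {k = k} {f} skew K L path odd 3≤k f₀∈ f₀∉ fₖ∈ fₖ∉ inner found
    with Fin.any? (λ s → (s ∈? Component.S K) ×-dec complete? (C.Component.S L) s)
  ... | yes (s , s∈ , cs) = Loose.component-loose (op B) (flip-escapes escapes) (flip-skewed skew) L
    (Component.S⊆X K s∈) (λ t∈ → cs _ t∈)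
  ... | no none = by-length (odd-cases odd)
    where
    D = C.Component.S L
    incomplete′ : ∀ i → 0 < i → i < k → ¬ Complete D (f i)
    incomplete′ i 0<i i<k c = none (f i , inner i 0<i i<k , c)
    c₀ : Complete D (f 0)
    c₀ t t∈ = E-sym (C°.separated L t∈ f₀∈ f₀∉)
    cₖ : Complete D (f k)
    cₖ t t∈ = E-sym (C°.separated L t∈ fₖ∈ fₖ∉)
    by-length : k ≡ 1 ⊎ k ≡ 3 ⊎ 5 ≤ k → Q
    by-length (inj₁ eq) = contradiction (subst (3 ≤_) eq 3≤k) λ { (s≤s ()) }
    by-length (inj₂ (inj₂ 5≤k)) = Shortest.no-odd-path B leapE D (C.Component.conn L) path odd 5≤k c₀ cₖ incomplete′
    by-length (inj₂ (inj₁ k≡3)) = found k≡3 (square-antipath (C.Component.conn L)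
      (h.step 0 (s≤s z≤n)) (h.step 1 (s≤s (s≤s z≤n))) (h.step 2 (s≤s (s≤s (s≤s z≤n))))
      (h.far 0 2 ≤-refl (s≤s (s≤s z≤n))) (h.far 1 3 ≤-refl ≤-refl) (h.far 0 3 (s≤s (s≤s z≤n)) ≤-refl)
      c₀ (subst (Complete D ∘ f) k≡3 cₖ) (incomplete′ 1 ≤-refl (<⇒≤ 3≤k)) (incomplete′ 2 (s≤s z≤n) 3≤k))
      where module h = IsPath (subst (IsPath E N f) k≡3 path)

Straight Crossed : ∀ {n} (E N : Rel (Fin n) 0ℓ) → Frame E N → Set
Straight E N F = E u z × E v w × N u w × N v z
  where
  open Frame F
Crossed E N F = E u w × E v z × N u z × N v w
  where
  open Frame F

module Conclusion {n : ℕ} (B : BergePair n) {Q : Set₁} (escapes : Escapes B Q)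
  (straight : ∀ F → Straight (BergePair.E B) (BergePair.N B) F → Q)
  (crossed  : ∀ F → Crossed (BergePair.E B) (BergePair.N B) F → Q) where

  open BergePair B
  open Basics B
  open Components B
  private
    V = Fin n
    module C = Basics (op B)
    module C° = Components (op B)
    module R = RousselRubio B
    module R° = RousselRubio (op B)

  private
    5-hole : ∀ {f : ℕ → V} {v} → IsPath E N f 3 → E v (f 0) → E v (f 3) → N v (f 1) → N v (f 2) → ⊥
    5-hole path e₀ e₃ n₁ n₂ = true≢false (evenE 3 _ _ (s≤s (s≤s z≤n)) path e₀ e₃
      (λ { (suc zero) _ _ → n₁ ; (suc (suc zero)) _ _ → n₂ ; (suc (suc (suc i))) _ (s≤s (s≤s (s≤s ()))) }))

    5-antihole : ∀ {f : ℕ → V} {v} → IsPath N E f 3 → N v (f 0) → N v (f 3) → E v (f 1) → E v (f 2) → ⊥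
    5-antihole path e₀ e₃ n₁ n₂ = true≢false (evenN 3 _ _ (s≤s (s≤s z≤n)) path e₀ e₃
      (λ { (suc zero) _ _ → n₁ ; (suc (suc zero)) _ _ → n₂ ; (suc (suc (suc i))) _ (s≤s (s≤s (s≤s ()))) }))

    3-path : ∀ {E N : Rel V 0ℓ} {a b c d} → E a b → E b c → E c d → N a c → N b d → N a d →
             IsPath E N (a ◂ b ◂ c ◂ (λ _ → d)) 3
    3-path ab bc cd ac bd ad =
      cons ab (λ { (suc zero) _ _ → ac ; (suc (suc zero)) _ _ → ad ; (suc (suc (suc _))) _ (s≤s (s≤s ())) })
        (cons bc (λ { (suc zero) _ _ → bd ; (suc (suc _)) _ (s≤s ()) })
          (cons cd (λ { (suc _) _ () }) (single _)))

  -- If u or v missed both z and w, it would close p-z-w-q to a hole of length five. If z or w were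
  -- adjacent to both u and v, it would close u-x-y-v to a hole of length five, which is also an
  -- antihole. So the edges between u, v and z, w form a perfect matching.
  frame : (F : Frame E N) → let open Frame F in
          u ≢ z → u ≢ w → v ≢ z → v ≢ w → Q
  frame F u≢z u≢w v≢z v≢w with E? (Frame.u F) (Frame.z F) | E? (Frame.u F) (Frame.w F)
                             | E? (Frame.v F) (Frame.z F) | E? (Frame.v F) (Frame.w F)
  ... | yes uz | no ¬uw | no ¬vz | yes vw = straight F (uz , vw , notE u≢w ¬uw , notE v≢z ¬vz)
  ... | no ¬uz | yes uw | yes vz | no ¬vw = crossed F (uw , vz , notE u≢z ¬uz , notE v≢w ¬vw)
  ... | no ¬uz | no ¬uw | _ | _ = ⊥-elim (5-hole (3-path pz zw wq pw zq pq) up uq (notE u≢z ¬uz) (notE u≢w ¬uw))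
    where open Frame F
  ... | _ | _ | no ¬vz | no ¬vw = ⊥-elim (5-hole (3-path pz zw wq pw zq pq) vp vq (notE v≢z ¬vz) (notE v≢w ¬vw))
    where open Frame F
  ... | yes uz | _ | yes vz | _ = ⊥-elim (5-antihole (3-path xv (N-sym uv) uy (E-sym ux) (E-sym yv) xy)
    (N-sym xz) (N-sym yz) (E-sym vz) (E-sym uz))
    where open Frame F
  ... | _ | yes uw | _ | yes vw = ⊥-elim (5-antihole (3-path xv (N-sym uv) uy (E-sym ux) (E-sym yv) xy)
    (N-sym xw) (N-sym yw) (E-sym vw) (E-sym uw))
    where open Frame F

  odd-link : ∀ {A X} → Skewed B A X → OddLink E N A X → Q
  odd-link {A} {X} skew record { k = k ; f = f ; isPath = path ; odd = odd ; 3≤k = 3≤k ; start = f₀∈ ; end = fₖ∈ ; inner = inner } =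
    OddLinks.length-three B escapes skew A₁ B₂ path odd 3≤k f₀∈ f₀∉ fₖ∈ fₖ∉ inside₁ first
    where
    1<k : 1 < k
    1<k = <⇒≤ 3≤k
    A₁ = component A (inner 1 ≤-refl 1<k)
    out-A = outsider A₁ (Skewed.splitA skew)
    A₂ = component A (proj₁ (proj₂ out-A))
    B₁ = C.component X f₀∈
    out-X = C°.outsider B₁ (Skewed.splitX skew)
    B₂ = C.component X (proj₁ (proj₂ out-X))
    module A₁ = Component A₁
    module A₂ = Component A₂
    module B₁ = C.Component B₁
    module B₂ = C.Component B₂
    A₂∉A₁ : ∀ {v} → v ∈ A₂.S → v ∉ A₁.S
    A₂∉A₁ = disjoint-component A₁ (proj₂ (proj₂ out-A)) A₂
    B₂∉B₁ : ∀ {v} → v ∈ B₂.S → v ∉ B₁.S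
    B₂∉B₁ = C°.disjoint-component B₁ (proj₂ (proj₂ out-X)) B₂
    f₀∉ : f 0 ∉ B₂.S
    f₀∉ f₀∈₂ = B₂∉B₁ f₀∈₂ B₁.a∈S
    fₖ∈₁ : f k ∈ B₁.S
    fₖ∈₁ = B₁.closed B₁.a∈S fₖ∈ (IsPath.far path 0 k 1<k ≤-refl)
    fₖ∉ : f k ∉ B₂.S
    fₖ∉ fₖ∈₂ = B₂∉B₁ fₖ∈₂ fₖ∈₁
    inside₁ : ∀ i → 0 < i → i < k → f i ∈ A₁.S
    inside₁ (suc zero)    _ _   = A₁.a∈S
    inside₁ (suc (suc i)) _ i<k = A₁.closed (inside₁ (suc i) (s≤s z≤n) (<-trans (n<1+n _) i<k))
      (inner (suc (suc i)) (s≤s z≤n) i<k) (IsPath.step path (suc i) (<-trans (n<1+n _) i<k))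

    first : k ≡ 3 → R.OddAntipath B₂.S (f 1) (f 2) → Q
    -- In the complement the antipath through `B₂` is an odd path with ends in `A₁`; it is tested
    -- against the other component `A₂`, which its ends miss.
    first k≡3 ap = OddLinks.length-three (op B) (flip-escapes escapes) (flip-skewed skew) B₂ A₂ ap.isPath ap.odd
        (odd≥2⇒≥3 ap.odd ap.2≤len)
        (subst (_∈ A) (sym ap.start) (A₁.S⊆X f₁∈)) (λ ∈A₂ → A₂∉A₁ ∈A₂ (subst (_∈ A₁.S) (sym ap.start) f₁∈))
        (subst (_∈ A) (sym ap.end) (A₁.S⊆X f₂∈)) (λ ∈A₂ → A₂∉A₁ ∈A₂ (subst (_∈ A₁.S) (sym ap.end) f₂∈))
        ap.inner second
      where
      module ap = R.OddAntipath ap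
      g = ap.f
      f₁∈ = inside₁ 1 ≤-refl 1<k
      f₂∈ = inside₁ 2 (s≤s z≤n) 3≤k
      second : ap.len ≡ 3 → R°.OddAntipath A₂.S (g 1) (g 2) → Q
      -- The path through `A₂` has its ends in `B₂` and is tested against `B₁`, which forces its
      -- length to be three as well.
      second l≡3 bp = OddLinks.length-three B escapes skew A₂ B₁ bp.isPath bp.odd (odd≥2⇒≥3 bp.odd bp.2≤len)
          (subst (_∈ X) (sym bp.start) (B₂.S⊆X g₁∈)) (λ ∈B₁ → B₂∉B₁ g₁∈ (subst (_∈ B₁.S) bp.start ∈B₁))
          (subst (_∈ X) (sym bp.end) (B₂.S⊆X g₂∈)) (λ ∈B₁ → B₂∉B₁ g₂∈ (subst (_∈ B₁.S) bp.end ∈B₁))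
          bp.inner (λ m≡3 _ → third m≡3)
        where
        module bp = R°.OddAntipath bp
        h = bp.f
        1<l : 1 < ap.len
        1<l = ap.2≤len
        2<l : 2 < ap.len
        2<l = odd≥2⇒≥3 ap.odd ap.2≤len
        g₁∈ = ap.inner 1 ≤-refl 1<l
        g₂∈ = ap.inner 2 (s≤s z≤n) 2<l
        third : bp.len ≡ 3 → Q
        third m≡3 = frame (record
          { u = f 0 ; v = f 3 ; x = f 1 ; y = f 2 ; p = g 1 ; q = g 2 ; z = h 1 ; w = h 2
          ; ux = F.step 0 (s≤s z≤n) ; xy = F.step 1 (s≤s (s≤s z≤n)) ; yv = F.step 2 ≤-refl
          ; uy = F.far 0 2 ≤-refl (s≤s (s≤s z≤n)) ; xv = F.far 1 3 ≤-refl ≤-refl ; uv = F.far 0 3 (s≤s (s≤s z≤n)) ≤-refl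
          ; xp = subst (λ t → N t (g 1)) ap.start (G.step 0 (s≤s z≤n)) ; pq = G.step 1 (s≤s (s≤s z≤n))
          ; qy = subst (N (g 2)) g₃≡ (G.step 2 ≤-refl)
          ; xq = subst (λ t → E t (g 2)) ap.start (G.far 0 2 ≤-refl (s≤s (s≤s z≤n)))
          ; py = subst (E (g 1)) g₃≡ (G.far 1 3 ≤-refl ≤-refl)
          ; pz = subst (λ t → E t (h 1)) bp.start (H.step 0 (s≤s z≤n)) ; zw = H.step 1 (s≤s (s≤s z≤n))
          ; wq = subst (E (h 2)) h₃≡ (H.step 2 ≤-refl)
          ; pw = subst (λ t → N t (h 2)) bp.start (H.far 0 2 ≤-refl (s≤s (s≤s z≤n)))
          ; zq = subst (N (h 1)) h₃≡ (H.far 1 3 ≤-refl ≤-refl)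
          ; xz = sep f₁∈ z∈ ; xw = sep f₁∈ w∈ ; yz = sep f₂∈ z∈ ; yw = sep f₂∈ w∈
          ; up = join B₁.a∈S g₁∈ ; uq = join B₁.a∈S g₂∈ ; vp = join f₃∈₁ g₁∈ ; vq = join f₃∈₁ g₂∈ })
          (apart f₀∈ z∈) (apart f₀∈ w∈) (apart (B₁.S⊆X f₃∈₁) z∈) (apart (B₁.S⊆X f₃∈₁) w∈)
          where
          module F = IsPath (subst (IsPath E N f) k≡3 path)
          module G = IsPath (subst (IsPath N E g) l≡3 ap.isPath)
          module H = IsPath (subst (IsPath E N h) m≡3 bp.isPath)
          g₃≡ : g 3 ≡ f 2
          g₃≡ = trans (cong g (sym l≡3)) ap.end
          h₃≡ : h 3 ≡ g 2
          h₃≡ = trans (cong h (sym m≡3)) bp.end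
          f₃∈₁ : f 3 ∈ B₁.S
          f₃∈₁ = subst (λ j → f j ∈ B₁.S) k≡3 fₖ∈₁
          z∈ : h 1 ∈ A₂.S
          z∈ = bp.inner 1 ≤-refl bp.2≤len
          w∈ : h 2 ∈ A₂.S
          w∈ = bp.inner 2 (s≤s z≤n) (odd≥2⇒≥3 bp.odd bp.2≤len)
          sep : ∀ {s t} → s ∈ A₁.S → t ∈ A₂.S → N s t
          sep s∈ t∈ = separated A₁ s∈ (A₂.S⊆X t∈) (A₂∉A₁ t∈)
          join : ∀ {s t} → s ∈ B₁.S → t ∈ B₂.S → E s t
          join s∈ t∈ = C°.separated B₁ s∈ (B₂.S⊆X t∈) (B₂∉B₁ t∈)
          apart : ∀ {s t} → s ∈ X → t ∈ A₂.S → s ≢ t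
          apart s∈ t∈ refl = Partition.disjoint (Skewed.part skew) (A₂.S⊆X t∈) s∈

-- Translation to and from graphs

open import Data.Bool.Base using (if_then_else_)
import Data.Bool.Properties as Bool
open import Data.Fin.Base using (zero; suc; toℕ; fromℕ; _↑ʳ_)
open import Data.List.Base using (List; []; _∷_)
import Data.List.Membership.Propositional as List
open import Data.List.Relation.Unary.All as All using (All; []; _∷_)
open import Data.List.Relation.Unary.AllPairs using (AllPairs; []; _∷_)
open import Data.List.Relation.Unary.Any as Any using (here; there)
import Data.Product.Properties as Prod
import Data.Sum.Properties as Sum
open import Data.Vec.Base using (Vec; []; _∷_; lookup)
open import Data.Vec.Properties.WithK using ([]=-irrelevant)
open import Function.Bundles using (mk⇔; Equivalence)
open import Function.Definitions using (Injective)

-- Saturates at k, so that a path indexed by `Fin (suc k)` becomes a function on all of ℕ.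
clamp : ∀ k → ℕ → Fin (suc k)
clamp k       zero    = zero
clamp zero    (suc i) = zero
clamp (suc k) (suc i) = suc (clamp k i)

toℕ-clamp : ∀ {k i} → i ≤ k → toℕ (clamp k i) ≡ i
toℕ-clamp z≤n       = refl
toℕ-clamp (s≤s i≤k) = cong suc (toℕ-clamp i≤k)

clamp-self : ∀ k → clamp k k ≡ fromℕ k
clamp-self zero    = refl
clamp-self (suc k) = cong suc (clamp-self k)

Apart : {V : Set} → SimpleGraph V → Rel V 0ℓ → Set
Apart H N = ∀ {u v} → N u v → u ≢ v × ¬ Adj H u v

-- Injectivity comes for free: distinct vertices of K go to vertices that are adjacent or N-related,
-- and either relation excludes equality.
embed : {W V : Set} (K : SimpleGraph W) (H : SimpleGraph V) {N : Rel V 0ℓ} → Apart H N →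
  DecidableEquality W → (t : W → V) → (∀ u v → Adj K u v → Adj H (t u) (t v)) →
  (∀ u v → u ≢ v → ¬ Adj K u v → N (t u) (t v)) → K ↪ H
embed K H apart _≟ʷ_ t e n = record
  { to = t ; injective = inj ; induced = λ u v → mk⇔ (e u v) (reflect u v) }
  where
  inj : Injective _≡_ _≡_ t
  inj {u} {v} eq with u ≟ʷ v
  ... | yes u≡v = u≡v
  ... | no u≢v with adj? K u v
  ... | yes a = contradiction (e u v a) (adj-irrefl H eq)
  ... | no ¬a = contradiction eq (proj₁ (apart (n u v u≢v ¬a)))
  reflect : ∀ u v → Adj H (t u) (t v) → Adj K u v
  reflect u v a with u ≟ʷ v
  ... | yes refl = contradiction a (adj-irrefl H refl)
  ... | no u≢v with adj? K u v
  ... | yes b = b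
  ... | no ¬b = contradiction a (proj₂ (apart (n u v u≢v ¬b)))

module _ {n : ℕ} (H : SimpleGraph (Fin n)) {N : Rel (Fin n) 0ℓ} (N-sym : Symmetric N) (apart : Apart H N) where

  embed-path : ∀ {k} (t : Fin (suc k) → Fin n) →
    (∀ i j → suc (toℕ i) ≡ toℕ j → Adj H (t i) (t j)) → (∀ i j → suc (toℕ i) < toℕ j → N (t i) (t j)) →
    pathGraph k ↪ H
  embed-path {k} t step far = embed (pathGraph k) H apart Fin._≟_ t
    (λ i j → [ step i j , (λ eq → adj-sym H (step j i eq)) ]′) distant
    where
    distant : ∀ i j → i ≢ j → ¬ Adj (pathGraph k) i j → N (t i) (t j)
    distant i j i≢j ¬a with <-cmp (toℕ i) (toℕ j)
    ... | tri< i<j _ _ = far i j (≤∧≢⇒< i<j (λ eq → ¬a (inj₁ eq)))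
    ... | tri≈ _ eq _  = contradiction (Fin.toℕ-injective eq) i≢j
    ... | tri> _ _ j<i = N-sym (far j i (≤∧≢⇒< j<i (λ eq → ¬a (inj₂ eq))))

  -- The vertex v takes position 0, so the wrap-around edge of the cycle is the one from `f k` to v.
  embed-hole : ∀ {k f v} → IsPath (Adj H) N f k → Adj H v (f 0) → Adj H v (f k) →
    (∀ i → 0 < i → i < k → N v (f i)) → cycleGraph (suc (suc k)) ↪ H
  embed-hole {k} {f} {v} path v₀ vₖ vn = embed (cycleGraph (suc (suc k))) H apart Fin._≟_ t adjacent distant
    where
    open IsPath path
    t : Fin (suc (suc k)) → Fin n
    t zero    = v
    t (suc i) = f (toℕ i)
    next : ∀ i j → Next (suc (suc k)) i j → Adj H (t i) (t j)
    next zero    (suc j) (inj₁ eq) = subst (Adj H v ∘ f) (suc-injective eq) v₀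
    next (suc i) zero    (inj₂ (eq , _)) = adj-sym H (subst (Adj H v ∘ f) (sym (suc-injective (suc-injective eq))) vₖ)
    next (suc i) (suc j) (inj₁ eq) = subst (Adj H (f (toℕ i)) ∘ f) (suc-injective eq)
      (step (toℕ i) (s≤s⁻¹ (subst (_< suc k) (sym (suc-injective eq)) (Fin.toℕ<n j))))
    adjacent : ∀ i j → Adj (cycleGraph (suc (suc k))) i j → Adj H (t i) (t j)
    adjacent i j (_ , inj₁ ij) = next i j ij
    adjacent i j (_ , inj₂ ji) = adj-sym H (next j i ji)
    v-distant : ∀ j → ¬ Next (suc (suc k)) zero (suc j) → ¬ Next (suc (suc k)) (suc j) zero → N v (f (toℕ j))
    v-distant j ¬a ¬b = vn (toℕ j) (n≢0⇒n>0 (λ eq → ¬a (inj₁ (cong suc (sym eq)))))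
      (≤∧≢⇒< (s≤s⁻¹ (Fin.toℕ<n j)) (λ eq → ¬b (inj₂ (cong (2 +_) eq , refl))))
    distant : ∀ i j → i ≢ j → ¬ Adj (cycleGraph (suc (suc k))) i j → N (t i) (t j)
    distant zero    zero    i≢j ¬a = contradiction refl i≢j
    distant zero    (suc j) i≢j ¬a = v-distant j (λ a → ¬a (i≢j , inj₁ a)) (λ a → ¬a (i≢j , inj₂ a))
    distant (suc i) zero    i≢j ¬a = N-sym (v-distant i (λ a → ¬a (i≢j , inj₂ a)) (λ a → ¬a (i≢j , inj₁ a)))
    distant (suc i) (suc j) i≢j ¬a with <-cmp (toℕ i) (toℕ j)
    ... | tri< i<j _ _ = far (toℕ i) (toℕ j) (≤∧≢⇒< i<j (λ eq → ¬a (i≢j , inj₁ (inj₁ (cong suc eq))))) (s≤s⁻¹ (Fin.toℕ<n j))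
    ... | tri≈ _ eq _  = contradiction (cong suc (Fin.toℕ-injective eq)) i≢j
    ... | tri> _ _ j<i = N-sym (far (toℕ j) (toℕ i) (≤∧≢⇒< j<i (λ eq → ¬a (i≢j , inj₂ (inj₁ (cong suc eq))))) (s≤s⁻¹ (Fin.toℕ<n i)))

  even-holes : (∀ k → Hole H k → Even k) → EvenHoles (Adj H) N
  even-holes even k f v 2≤k path v₀ vₖ vn = trans (sym (not-involutive (parity k)))
    (even⇒parity (even (suc (suc k)) (s≤s (s≤s 2≤k) , embed-hole path v₀ vₖ vn)))

  path-function : ∀ {k u v} (P : Path H k u v) →
    (∀ {u v} → u ≢ v → ¬ Adj H u v → N u v) → IsPath (Adj H) N (vertex P ∘ clamp k) k
  path-function {k} P complete = record { step = step ; far = far }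
    where
    open _↪_ (Path.embedding P)
    step : ∀ i → i < k → Adj H (vertex P (clamp k i)) (vertex P (clamp k (suc i)))
    step i i<k = Equivalence.to (induced (clamp k i) (clamp k (suc i)))
      (inj₁ (trans (cong suc (toℕ-clamp (<⇒≤ i<k))) (sym (toℕ-clamp i<k))))
    far : ∀ i j → suc i < j → j ≤ k → N (vertex P (clamp k i)) (vertex P (clamp k j))
    far i j i<j j≤k = complete
      (λ eq → <⇒≢ i<j′ (trans (sym i≡) (trans (cong toℕ (injective eq)) j≡)))
      (λ a → [ (λ eq → <⇒≢ i<j (trans (cong suc (sym i≡)) (trans eq j≡)))
             , (λ eq → <⇒≢ (<-trans i<j′ (n<1+n j)) (sym (trans (cong suc (sym j≡)) (trans eq i≡)))) ]′
             (Equivalence.from (induced (clamp k i) (clamp k j)) a))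
      where
      i<j′ = <-trans (n<1+n i) i<j
      i≡ = toℕ-clamp {k} (≤-trans (<⇒≤ i<j′) j≤k)
      j≡ = toℕ-clamp {k} j≤k

  odd-link-of-path : ∀ {A X : Subset n} {k u v} → (∀ {u v} → u ≢ v → ¬ Adj H u v → N u v) →
    u ∈ X → v ∈ X → ¬ Adj H u v → Odd k → (P : Path H k u v) → InteriorIn P A → OddLink (Adj H) N A X
  odd-link-of-path {A} {X} {k} {u} {v} complete u∈ v∈ ¬uv odd P inner = record
    { k = k ; f = vertex P ∘ clamp k ; isPath = path ; odd = oddₖ ; 3≤k = 3≤ (odd-cases oddₖ)
    ; start = subst (_∈ X) (sym start) u∈ ; end = subst (_∈ X) (sym end′) v∈
    ; inner = λ i 0<i i<k → inner (clamp k i)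
        (λ eq → <⇒≢ 0<i (trans (cong toℕ (sym eq)) (toℕ-clamp (<⇒≤ i<k))))
        (λ eq → <⇒≢ i<k (trans (sym (toℕ-clamp (<⇒≤ i<k))) (trans (cong toℕ eq) (Fin.toℕ-fromℕ k)))) }
    where
    open Path P using (start; end)
    oddₖ = odd⇒parity odd
    path = path-function P complete
    end′ : vertex P (clamp k k) ≡ v
    end′ = trans (cong (vertex P) (clamp-self k)) end
    3≤ : k ≡ 1 ⊎ k ≡ 3 ⊎ 5 ≤ k → 3 ≤ k
    3≤ (inj₁ k≡1) = contradiction (subst₂ (Adj H) start (trans (cong (vertex P ∘ clamp k) (sym k≡1)) end′)
      (IsPath.step path 0 (subst (0 <_) (sym k≡1) (s≤s z≤n)))) ¬uv
    3≤ (inj₂ (inj₁ k≡3)) = ≤-reflexive (sym k≡3)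
    3≤ (inj₂ (inj₂ 5≤k)) = ≤-trans (s≤s (s≤s (s≤s z≤n))) 5≤k

-- A path has at most n vertices, so the existence of an odd path is a bounded question.

any-vec? : ∀ {n} k {P : Vec (Fin n) k → Set} → U.Decidable P → Dec (∃ P)
any-vec? zero    P? with P? []
... | yes p = yes ([] , p)
... | no ¬p = no λ { ([] , p) → ¬p p }
any-vec? (suc k) P? with Fin.any? (λ x → any-vec? k (λ xs → P? (x ∷ xs)))
... | yes (x , xs , p) = yes (x ∷ xs , p)
... | no ¬p            = no λ { (x ∷ xs , p) → ¬p (x , xs , p) }

module _ {n : ℕ} {E N : Rel (Fin n) 0ℓ} (E? : Decidable E) (N? : Decidable N)
         (E-irr : ∀ {v} → ¬ E v v) (N-irr : ∀ {v} → ¬ N v v) (A X : Subset n) where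

  private
    -- The conditions of an odd link with all quantifiers bounded, so that each can be decided.
    IsOdd : ℕ → (ℕ → Fin n) → Set
    IsOdd k f = (parity k ≡ true × 3 ≤ k × f 0 ∈ X × f k ∈ X) ×
      (∀ {i} → i < k → E (f i) (f (suc i)) × (0 < i → f i ∈ A)) ×
      (∀ {j} → j < suc k → ∀ {i} → i < j → suc i < j → N (f i) (f j))

    isOdd? : ∀ k f → Dec (IsOdd k f)
    isOdd? k f = ((parity k Bool.≟ true) ×-dec (3 ≤? k) ×-dec (f 0 ∈? X) ×-dec (f k ∈? X)) ×-dec
      allUpTo? (λ i → E? (f i) (f (suc i)) ×-dec ((0 <? i) →-dec (f i ∈? A))) k ×-dec
      allUpTo? (λ j → allUpTo? (λ i → (suc i <? j) →-dec N? (f i) (f j)) j) (suc k)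

    IsOdd-cong : ∀ {k f g} → (∀ i → i ≤ k → f i ≡ g i) → IsOdd k f → IsOdd k g
    IsOdd-cong {k} {f} {g} eq ((o , 3≤k , s , e) , step , far) =
      (o , 3≤k , subst (_∈ X) (eq 0 z≤n) s , subst (_∈ X) (eq k ≤-refl) e)
      , (λ {i} i<k → subst₂ E (eq i (<⇒≤ i<k)) (eq (suc i) i<k) (proj₁ (step i<k))
                   , λ 0<i → subst (_∈ A) (eq i (<⇒≤ i<k)) (proj₂ (step i<k) 0<i))
      , (λ {j} j≤k {i} i<j si<j → subst₂ N (eq i (≤-trans (<⇒≤ i<j) (s≤s⁻¹ j≤k))) (eq j (s≤s⁻¹ j≤k)) (far j≤k i<j si<j))

    link : ∀ {k f} → IsOdd k f → OddLink E N A X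
    link {k} {f} ((o , 3≤k , s , e) , step , far) = record
      { k = k ; f = f ; odd = o ; 3≤k = 3≤k ; start = s ; end = e
      ; isPath = record { step = λ i i<k → proj₁ (step i<k)
                        ; far = λ i j si<j j≤k → far (s≤s j≤k) (<-trans (n<1+n i) si<j) si<j }
      ; inner = λ i 0<i i<k → proj₂ (step i<k) 0<i }

    unlink : (p : OddLink E N A X) → IsOdd (OddLink.k p) (OddLink.f p)
    unlink p = (odd , 3≤k , start , end)
      , (λ {i} i<k → IsPath.step isPath i i<k , λ 0<i → inner i 0<i i<k)
      , (λ j≤k _ si<j → IsPath.far isPath _ _ si<j (s≤s⁻¹ j≤k))
      where open OddLink p

    k<n : (p : OddLink E N A X) → OddLink.k p < n
    k<n p = Fin.injective⇒≤ {f = f ∘ toℕ} inj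
      where
      open OddLink p
      distinct : ∀ {i j} → i < j → j ≤ k → f i ≢ f j
      distinct {i} i<j j≤k eq with m≤n⇒m<n∨m≡n i<j
      ... | inj₁ si<j = N-irr (subst (N (f i)) (sym eq) (IsPath.far isPath i _ si<j j≤k))
      ... | inj₂ refl = E-irr (subst (E (f i)) (sym eq) (IsPath.step isPath i j≤k))
      inj : ∀ {i j : Fin (suc k)} → f (toℕ i) ≡ f (toℕ j) → i ≡ j
      inj {i} {j} eq with <-cmp (toℕ i) (toℕ j)
      ... | tri< i<j _ _ = contradiction eq (distinct i<j (s≤s⁻¹ (Fin.toℕ<n j)))
      ... | tri≈ _ i≡j _ = Fin.toℕ-injective i≡j
      ... | tri> _ _ j<i = contradiction (sym eq) (distinct j<i (s≤s⁻¹ (Fin.toℕ<n i)))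

  odd-link? : Dec (OddLink E N A X)
  odd-link? with anyUpTo? (λ k → any-vec? (suc k) (λ xs → isOdd? k (lookup xs ∘ clamp k))) n
  ... | yes (k , _ , xs , p) = yes (link p)
  ... | no none = no λ p → let open OddLink p in none (k , k<n p , tabulate (f ∘ toℕ) ,
    IsOdd-cong (λ i i≤k → sym (trans (lookup∘tabulate (f ∘ toℕ) (clamp k i)) (cong f (toℕ-clamp i≤k)))) (unlink p))

-- The long prism in a leap

module _ {n : ℕ} (H : SimpleGraph (Fin n)) {N : Rel (Fin n) 0ℓ} (N-sym : Symmetric N) (apart : Apart H N) where

  leap⇒long-prism : Leap (Adj H) N → ContainsLongPrism H
  leap⇒long-prism record { k = suc k ; 4≤k = s≤s (s≤s 2≤k) ; f = f ; path = path ; a = a ; b = b ; ab = ab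
                         ; a₀ = a₀ ; a₁ = a₁ ; aₖ = aₖ ; a- = a- ; b₀ = b₀ ; bₖ₋₁ = bₖ₋₁ ; bₖ = bₖ ; b- = b- } =
    -- With k now one less than in the leap, the path of the leap has k + 2 edges, at least four, so
    -- the part from `f 1` to `f (suc k)` has length k at least two and makes the prism long.
    4 + suc k , P , (prism , zero , 2≤k) , embedding
    where
    open IsPath path

    -- The vertices a, fₖ₊₂, f₀, b come first, then f₁, …, fₖ₊₁.
    φ : Fin (4 + suc k) → Fin n
    φ zero                         = a
    φ (suc zero)                   = f (2 + k)
    φ (suc (suc zero))             = f 0
    φ (suc (suc (suc zero)))       = b
    φ (suc (suc (suc (suc p))))    = f (1 + toℕ p)

    P : SimpleGraph (Fin (4 + suc k))
    P = record
      { Adj        = λ i j → Adj H (φ i) (φ j)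
      ; adj-sym    = adj-sym H
      ; adj-irrefl = λ eq → adj-irrefl H (cong φ eq)
      ; adj?       = λ i j → adj? H (φ i) (φ j)
      }

    inP : Rel (Fin (4 + suc k)) 0ℓ
    inP i j = N (φ i) (φ j)

    apartP : Apart P inP
    apartP n = (λ eq → proj₁ (apart n) (cong φ eq)) , proj₂ (apart n)

    pattern m₀ p = suc (suc (suc (suc p)))

    toℕ≤ : (p : Fin (suc k)) → toℕ p ≤ k
    toℕ≤ p = s≤s⁻¹ (Fin.toℕ<n p)

    first last : (p : Fin (suc k)) → Set
    first p = p ≡ zero
    last  p = p ≡ fromℕ k

    a-mid : ∀ p → Adj H (f (1 + toℕ p)) a → first p
    a-mid zero    _ = refl
    a-mid (suc p) e = contradiction (adj-sym H e) (proj₂ (apart (a- (2 + toℕ p) (s≤s (s≤s z≤n)) (s≤s (s≤s (toℕ≤ (suc p)))))))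

    f₀-mid : ∀ p → Adj H (f (1 + toℕ p)) (f 0) → first p
    f₀-mid zero    _ = refl
    f₀-mid (suc p) e = contradiction (adj-sym H e) (proj₂ (apart (far 0 (2 + toℕ p) (s≤s (s≤s z≤n)) (≤-trans (s≤s (toℕ≤ (suc p))) (n≤1+n (suc k))))))

    at-end : ∀ p → ¬ toℕ p < k → last p
    at-end p p≮k = Fin.toℕ-injective (trans (≤∧≮⇒≡ (toℕ≤ p) p≮k) (sym (Fin.toℕ-fromℕ k)))

    fₖ-mid : ∀ p → Adj H (f (1 + toℕ p)) (f (2 + k)) → last p
    fₖ-mid p e = at-end p λ p<k → proj₂ (apart (far (1 + toℕ p) (2 + k) (s≤s (s≤s p<k)) ≤-refl)) e

    b-mid : ∀ p → Adj H (f (1 + toℕ p)) b → last p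
    b-mid p e = at-end p λ p<k → proj₂ (apart (b- (1 + toℕ p) (s≤s z≤n) (s≤s p<k))) (adj-sym H e)

    f₀fₖ : N (f 0) (f (2 + k))
    f₀fₖ = far 0 (2 + k) (s≤s (s≤s z≤n)) ≤-refl

    Related : Rel (Fin n) 0ℓ
    Related u v = Adj H u v ⊎ N u v

    related-sym : ∀ {u v} → Related u v → Related v u
    related-sym = [ (λ e → inj₁ (adj-sym H e)) , (λ n → inj₂ (N-sym n)) ]′

    a~mid : ∀ p → Related a (f (1 + toℕ p))
    a~mid zero    = inj₁ a₁
    a~mid (suc p) = inj₂ (a- (2 + toℕ p) (s≤s (s≤s z≤n)) (s≤s (s≤s (toℕ≤ (suc p)))))

    f₀~mid : ∀ p → Related (f 0) (f (1 + toℕ p))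
    f₀~mid zero    = inj₁ (step 0 (s≤s z≤n))
    f₀~mid (suc p) = inj₂ (far 0 (2 + toℕ p) (s≤s (s≤s z≤n)) (≤-trans (s≤s (toℕ≤ (suc p))) (n≤1+n (suc k))))

    mid~fₖ : ∀ p → Related (f (1 + toℕ p)) (f (2 + k))
    mid~fₖ p with toℕ p <? k
    ... | yes p<k = inj₂ (far (1 + toℕ p) (2 + k) (s≤s (s≤s p<k)) ≤-refl)
    ... | no  p≮k = inj₁ (subst (λ j → Adj H (f (1 + j)) (f (2 + k))) (sym (≤∧≮⇒≡ (toℕ≤ p) p≮k)) (step (1 + k) ≤-refl))

    b~mid : ∀ p → Related b (f (1 + toℕ p))
    b~mid p with toℕ p <? k
    ... | yes p<k = inj₂ (b- (1 + toℕ p) (s≤s z≤n) (s≤s p<k))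
    ... | no  p≮k = inj₁ (subst (λ j → Adj H b (f (1 + j))) (sym (≤∧≮⇒≡ (toℕ≤ p) p≮k)) bₖ₋₁)

    mid~mid : ∀ p q → toℕ p < toℕ q → Related (f (1 + toℕ p)) (f (1 + toℕ q))
    mid~mid p q p<q with suc (toℕ p) ≟ toℕ q
    ... | yes eq = inj₁ (subst (λ j → Adj H (f (1 + toℕ p)) (f (1 + j))) eq (step (1 + toℕ p) (s≤s (s≤s (toℕ≤ p)))))
    ... | no  ne = inj₂ (far (1 + toℕ p) (1 + toℕ q) (s≤s (≤∧≢⇒< p<q ne)) (s≤s (≤-trans (toℕ≤ q) (n≤1+n k))))

    -- P only pulls adjacency back along `φ`. That distinct positions are adjacent or N-related is
    -- what makes `φ` injective.
    related : ∀ i j → i ≢ j → Related (φ i) (φ j)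
    related zero (suc zero)             _ = inj₁ aₖ
    related zero (suc (suc zero))       _ = inj₁ a₀
    related zero (suc (suc (suc zero))) _ = inj₂ ab
    related zero (m₀ p)                 _ = a~mid p
    related (suc zero) (suc (suc zero))       _ = inj₂ (N-sym f₀fₖ)
    related (suc zero) (suc (suc (suc zero))) _ = inj₁ (adj-sym H bₖ)
    related (suc zero) (m₀ p)                 _ = related-sym (mid~fₖ p)
    related (suc (suc zero)) (suc (suc (suc zero))) _ = inj₁ (adj-sym H b₀)
    related (suc (suc zero)) (m₀ p)                 _ = f₀~mid p
    related (suc (suc (suc zero))) (m₀ p)           _ = b~mid p
    related (m₀ p) (m₀ q) p≢q with <-cmp (toℕ p) (toℕ q)
    ... | tri< p<q _ _ = mid~mid p q p<q
    ... | tri≈ _ eq _  = contradiction (cong m₀ (Fin.toℕ-injective eq)) p≢q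
    ... | tri> _ _ q<p = related-sym (mid~mid q p q<p)
    related (suc zero) zero             _ = inj₁ (adj-sym H aₖ)
    related (suc (suc zero)) zero       _ = inj₁ (adj-sym H a₀)
    related (suc (suc (suc zero))) zero _ = inj₂ (N-sym ab)
    related (m₀ p) zero                 _ = related-sym (a~mid p)
    related (suc (suc zero)) (suc zero)       _ = inj₂ f₀fₖ
    related (suc (suc (suc zero))) (suc zero) _ = inj₁ bₖ
    related (m₀ p) (suc zero)                 _ = mid~fₖ p
    related (suc (suc (suc zero))) (suc (suc zero)) _ = inj₁ b₀
    related (m₀ p) (suc (suc zero))                 _ = related-sym (f₀~mid p)
    related (m₀ p) (suc (suc (suc zero)))           _ = related-sym (b~mid p)
    related zero zero i≢j = contradiction refl i≢j
    related (suc zero) (suc zero) i≢j = contradiction refl i≢j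
    related (suc (suc zero)) (suc (suc zero)) i≢j = contradiction refl i≢j
    related (suc (suc (suc zero))) (suc (suc (suc zero))) i≢j = contradiction refl i≢j

    embedding : P ↪ H
    embedding = embed P H apart Fin._≟_ φ (λ _ _ e → e) λ i j i≢j ¬e → [ (λ e → contradiction e ¬e) , (λ n → n) ]′ (related i j i≢j)

    edge-path : ∀ {i j} → Adj P i j → Path P 1 i j
    edge-path {i} {j} e = record
      { embedding = embed-path P {N = inP} N-sym apartP {1} ends
          (λ { zero (suc zero) _ → e ; zero zero () ; (suc zero) zero () ; (suc zero) (suc zero) () })
          (λ { zero (suc zero) (s≤s ()) ; (suc zero) (suc zero) (s≤s ()) })
      ; start = refl ; end = refl }
      where
      ends : Fin 2 → Fin (4 + suc k)
      ends zero       = i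
      ends (suc zero) = j

    middle : Path P k (m₀ zero) (m₀ (fromℕ k))
    middle = record
      { embedding = embed-path P {N = inP} N-sym apartP {k} (4 ↑ʳ_)
          (λ i j eq → subst (λ c → Adj H (f (1 + toℕ i)) (f (1 + c))) eq (step (1 + toℕ i) (s≤s (s≤s (toℕ≤ i)))))
          (λ i j lt → far (1 + toℕ i) (1 + toℕ j) (s≤s lt) (s≤s (≤-trans (toℕ≤ j) (n≤1+n k))))
      ; start = refl ; end = refl }

    A B : Fin 3 → Fin (4 + suc k)
    A zero             = m₀ zero
    A (suc zero)       = zero
    A (suc (suc zero)) = suc (suc zero)
    B zero             = m₀ (fromℕ k)
    B (suc zero)       = suc zero
    B (suc (suc zero)) = suc (suc (suc zero))

    length : Fin 3 → ℕ
    length zero    = k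
    length (suc _) = 1

    paths : ∀ i → Path P (length i) (A i) (B i)
    paths zero             = middle
    paths (suc zero)       = edge-path aₖ
    paths (suc (suc zero)) = edge-path (adj-sym H b₀)

    Only : ∀ i j → Set
    Only i j = ∀ p q → Adj P (vertex (paths i) p) (vertex (paths j) q) →
      (vertex (paths i) p ≡ A i × vertex (paths j) q ≡ A j) ⊎ (vertex (paths i) p ≡ B i × vertex (paths j) q ≡ B j)

    only-sym : ∀ {i j} → Only i j → Only j i
    only-sym o p q e with o q p (adj-sym H e)
    ... | inj₁ (x , y) = inj₁ (y , x)
    ... | inj₂ (x , y) = inj₂ (y , x)

    only₀₁ : Only zero (suc zero)
    only₀₁ p zero       e = inj₁ (cong (4 ↑ʳ_) (a-mid p e) , refl)
    only₀₁ p (suc zero) e = inj₂ (cong (4 ↑ʳ_) (fₖ-mid p e) , refl)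

    only₀₂ : Only zero (suc (suc zero))
    only₀₂ p zero       e = inj₁ (cong (4 ↑ʳ_) (f₀-mid p e) , refl)
    only₀₂ p (suc zero) e = inj₂ (cong (4 ↑ʳ_) (b-mid p e) , refl)

    only₁₂ : Only (suc zero) (suc (suc zero))
    only₁₂ zero       zero       e = inj₁ (refl , refl)
    only₁₂ zero       (suc zero) e = contradiction e (proj₂ (apart ab))
    only₁₂ (suc zero) zero       e = contradiction (adj-sym H e) (proj₂ (apart f₀fₖ))
    only₁₂ (suc zero) (suc zero) e = inj₂ (refl , refl)

    prism : Prism P
    prism = record
      { a = A ; b = B
      ; triangleᵃ = triᵃ ; triangleᵇ = triᵇ ; a≢b = a≢b′
      ; len = length ; path = paths ; cover = cover ; disjoint = disjoint ; onlyEdges = only }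
      where
      a₀₂ : Adj H (f 1) (f 0)
      a₀₂ = adj-sym H (step 0 (s≤s z≤n))
      fₑ : f (1 + toℕ (fromℕ k)) ≡ f (1 + k)
      fₑ = cong (f ∘ suc) (Fin.toℕ-fromℕ k)
      b₀₁ : Adj H (f (1 + toℕ (fromℕ k))) (f (2 + k))
      b₀₁ = subst (λ v → Adj H v (f (2 + k))) (sym fₑ) (step (1 + k) ≤-refl)
      b₀₂ : Adj H (f (1 + toℕ (fromℕ k))) b
      b₀₂ = subst (λ v → Adj H v b) (sym fₑ) (adj-sym H bₖ₋₁)
      triᵃ : ∀ i j → i ≢ j → Adj P (A i) (A j)
      triᵃ zero             zero             i≢j = contradiction refl i≢j
      triᵃ zero             (suc zero)       _   = adj-sym H a₁
      triᵃ zero             (suc (suc zero)) _   = a₀₂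
      triᵃ (suc zero)       zero             _   = a₁
      triᵃ (suc zero)       (suc zero)       i≢j = contradiction refl i≢j
      triᵃ (suc zero)       (suc (suc zero)) _   = a₀
      triᵃ (suc (suc zero)) zero             _   = adj-sym H a₀₂
      triᵃ (suc (suc zero)) (suc zero)       _   = adj-sym H a₀
      triᵃ (suc (suc zero)) (suc (suc zero)) i≢j = contradiction refl i≢j
      triᵇ : ∀ i j → i ≢ j → Adj P (B i) (B j)
      triᵇ zero             zero             i≢j = contradiction refl i≢j
      triᵇ zero             (suc zero)       _   = b₀₁
      triᵇ zero             (suc (suc zero)) _   = b₀₂
      triᵇ (suc zero)       zero             _   = adj-sym H b₀₁
      triᵇ (suc zero)       (suc zero)       i≢j = contradiction refl i≢j
      triᵇ (suc zero)       (suc (suc zero)) _   = adj-sym H bₖ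
      triᵇ (suc (suc zero)) zero             _   = adj-sym H b₀₂
      triᵇ (suc (suc zero)) (suc zero)       _   = bₖ
      triᵇ (suc (suc zero)) (suc (suc zero)) i≢j = contradiction refl i≢j
      zero≢end : zero ≢ fromℕ k
      zero≢end eq = <⇒≢ (≤-trans (s≤s z≤n) 2≤k) (trans (cong toℕ eq) (Fin.toℕ-fromℕ k))
      a≢b′ : ∀ i j → A i ≢ B j
      a≢b′ zero             zero             eq = zero≢end (Fin.↑ʳ-injective 4 zero (fromℕ k) eq)
      a≢b′ zero             (suc zero)       ()
      a≢b′ zero             (suc (suc zero)) ()
      a≢b′ (suc zero)       zero             ()
      a≢b′ (suc zero)       (suc zero)       ()
      a≢b′ (suc zero)       (suc (suc zero)) ()
      a≢b′ (suc (suc zero)) zero             ()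
      a≢b′ (suc (suc zero)) (suc zero)       ()
      a≢b′ (suc (suc zero)) (suc (suc zero)) ()
      cover : ∀ v → ∃ λ i → ∃ λ p → vertex (paths i) p ≡ v
      cover zero                   = suc zero , zero , refl
      cover (suc zero)             = suc zero , suc zero , refl
      cover (suc (suc zero))       = suc (suc zero) , zero , refl
      cover (suc (suc (suc zero))) = suc (suc zero) , suc zero , refl
      cover (m₀ p)                 = zero , p , refl
      disjoint : ∀ i j → i ≢ j → ∀ p q → vertex (paths i) p ≢ vertex (paths j) q
      disjoint zero             zero             i≢j = contradiction refl i≢j
      disjoint zero             (suc zero)       _ p zero ()
      disjoint zero             (suc zero)       _ p (suc zero) ()
      disjoint zero             (suc (suc zero)) _ p zero ()
      disjoint zero             (suc (suc zero)) _ p (suc zero) ()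
      disjoint (suc zero)       zero             _ zero q ()
      disjoint (suc zero)       zero             _ (suc zero) q ()
      disjoint (suc zero)       (suc zero)       i≢j = contradiction refl i≢j
      disjoint (suc zero)       (suc (suc zero)) _ zero zero ()
      disjoint (suc zero)       (suc (suc zero)) _ zero (suc zero) ()
      disjoint (suc zero)       (suc (suc zero)) _ (suc zero) zero ()
      disjoint (suc zero)       (suc (suc zero)) _ (suc zero) (suc zero) ()
      disjoint (suc (suc zero)) zero             _ zero q ()
      disjoint (suc (suc zero)) zero             _ (suc zero) q ()
      disjoint (suc (suc zero)) (suc zero)       _ zero zero ()
      disjoint (suc (suc zero)) (suc zero)       _ zero (suc zero) ()
      disjoint (suc (suc zero)) (suc zero)       _ (suc zero) zero ()
      disjoint (suc (suc zero)) (suc zero)       _ (suc zero) (suc zero) ()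
      disjoint (suc (suc zero)) (suc (suc zero)) i≢j = contradiction refl i≢j
      only : ∀ i j → i ≢ j → Only i j
      only zero             zero             i≢j = contradiction refl i≢j
      only zero             (suc zero)       _   = only₀₁
      only zero             (suc (suc zero)) _   = only₀₂
      only (suc zero)       zero             _   = only-sym {zero} {suc zero} only₀₁
      only (suc zero)       (suc zero)       i≢j = contradiction refl i≢j
      only (suc zero)       (suc (suc zero)) _   = only₁₂
      only (suc (suc zero)) zero             _   = only-sym {zero} {suc (suc zero)} only₀₂
      only (suc (suc zero)) (suc zero)       _   = only-sym {suc zero} {suc (suc zero)} only₁₂
      only (suc (suc zero)) (suc (suc zero)) i≢j = contradiction refl i≢j

-- Small induced subgraphs given by a list of their vertices

module _ {W V : Set} (K : SimpleGraph W) (E N : Rel V 0ℓ) (t : W → V) where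

  -- For concrete u and v the `if` reduces, so the type of a table of all pairs becomes the plain
  -- list of the edges and non-edges required.
  Matches : Rel W 0ℓ
  Matches u v = if does (adj? K u v) then E (t u) (t v) else N (t u) (t v)

  matches⁺ : ∀ {u v} → Matches u v → Adj K u v → E (t u) (t v)
  matches⁺ {u} {v} m a with adj? K u v
  ... | yes _ = m
  ... | no ¬a = contradiction a ¬a

  matches⁻ : ∀ {u v} → Matches u v → ¬ Adj K u v → N (t u) (t v)
  matches⁻ {u} {v} m ¬a with adj? K u v
  ... | yes a = contradiction a ¬a
  ... | no _  = m

all-pairs : ∀ {W : Set} {R : Rel W 0ℓ} {xs u v} → AllPairs R xs → u List.∈ xs → v List.∈ xs →
            u ≡ v ⊎ R u v ⊎ R v u
all-pairs (r ∷ rs) (here refl) (here refl) = inj₁ refl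
all-pairs (r ∷ rs) (here refl) (there v∈)  = inj₂ (inj₁ (All.lookup r v∈))
all-pairs (r ∷ rs) (there u∈)  (here refl) = inj₂ (inj₂ (All.lookup r u∈))
all-pairs (r ∷ rs) (there u∈)  (there v∈)  = all-pairs rs u∈ v∈

embed-list : ∀ {W V : Set} (K : SimpleGraph W) (H : SimpleGraph V) {N : Rel V 0ℓ} → Symmetric N → Apart H N →
  DecidableEquality W → (t : W → V) → ∀ {ws} → (∀ w → w List.∈ ws) → AllPairs (Matches K (Adj H) N t) ws → K ↪ H
embed-list K H {N} N-sym apart _≟ʷ_ t enum ms = embed K H apart _≟ʷ_ t
  (λ u v a → adjacent u v a (all-pairs ms (enum u) (enum v)))
  (λ u v u≢v ¬a → distant u v u≢v ¬a (all-pairs ms (enum u) (enum v)))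
  where
  M = Matches K (Adj H) N t
  adjacent : ∀ u v → Adj K u v → u ≡ v ⊎ M u v ⊎ M v u → Adj H (t u) (t v)
  adjacent u v a (inj₁ u≡v)      = contradiction a (adj-irrefl K u≡v)
  adjacent u v a (inj₂ (inj₁ m)) = matches⁺ K (Adj H) N t m a
  adjacent u v a (inj₂ (inj₂ m)) = adj-sym H (matches⁺ K (Adj H) N t m (adj-sym K a))
  distant : ∀ u v → u ≢ v → ¬ Adj K u v → u ≡ v ⊎ M u v ⊎ M v u → N (t u) (t v)
  distant u v u≢v ¬a (inj₁ u≡v)      = contradiction u≡v u≢v
  distant u v u≢v ¬a (inj₂ (inj₁ m)) = matches⁻ K (Adj H) N t m ¬a
  distant u v u≢v ¬a (inj₂ (inj₂ m)) = N-sym (matches⁻ K (Adj H) N t m (λ a → ¬a (adj-sym K a)))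

module _ {n : ℕ} (H : SimpleGraph (Fin n)) {N : Rel (Fin n) 0ℓ} (N-sym : Symmetric N) (apart : Apart H N)
         (F : Frame (Adj H) N) where

  open Frame F
  private
    E-sym = adj-sym H
    pattern 0F = zero
    pattern 1F = suc zero
    pattern 2F = suc (suc zero)
    pattern 3F = suc (suc (suc zero))
    pattern 4F = suc (suc (suc (suc zero)))
    pattern 5F = suc (suc (suc (suc (suc zero))))

  -- The vertices u, q, x, w serve as a₁, ..., a₄ and p, v, y, z as b₁, ..., b₄. The missing edges
  -- a₃a₄ and b₃b₄ are xw and yz.
  crossed⇒double-diamond : Crossed (Adj H) N F → doubleDiamond ↪ H
  crossed⇒double-diamond (uw , vz , uz , vw) = embed-list doubleDiamond H N-sym apart
    (Sum.≡-dec Fin._≟_ Fin._≟_) t {ws} enum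
    ( (uq ∷ ux ∷ uw ∷ up ∷ uv ∷ uy ∷ uz ∷ [])
    ∷ (E-sym xq ∷ E-sym wq ∷ N-sym pq ∷ E-sym vq ∷ qy ∷ N-sym zq ∷ [])
    ∷ (xw ∷ xp ∷ xv ∷ xy ∷ xz ∷ [])
    ∷ (N-sym pw ∷ N-sym vw ∷ N-sym yw ∷ E-sym zw ∷ [])
    ∷ (E-sym vp ∷ py ∷ pz ∷ [])
    ∷ (E-sym yv ∷ vz ∷ [])
    ∷ (yz ∷ [])
    ∷ []
    ∷ [] )
    where
    t : Fin 4 ⊎ Fin 4 → Fin n
    t (inj₁ 0F) = u
    t (inj₁ 1F) = q
    t (inj₁ 2F) = x
    t (inj₁ 3F) = w
    t (inj₂ 0F) = p
    t (inj₂ 1F) = v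
    t (inj₂ 2F) = y
    t (inj₂ 3F) = z
    ws : List (Fin 4 ⊎ Fin 4)
    ws = inj₁ 0F ∷ inj₁ 1F ∷ inj₁ 2F ∷ inj₁ 3F ∷ inj₂ 0F ∷ inj₂ 1F ∷ inj₂ 2F ∷ inj₂ 3F ∷ []
    enum : ∀ a → a List.∈ ws
    enum (inj₁ 0F) = here refl
    enum (inj₁ 1F) = there (here refl)
    enum (inj₁ 2F) = there (there (here refl))
    enum (inj₁ 3F) = there (there (there (here refl)))
    enum (inj₂ 0F) = there (there (there (there (here refl))))
    enum (inj₂ 1F) = there (there (there (there (there (here refl)))))
    enum (inj₂ 2F) = there (there (there (there (there (there (here refl))))))
    enum (inj₂ 3F) = there (there (there (there (there (there (there (here refl)))))))

  -- The cliques at the vertices 1, 2, 4, 5 of degree three are the triangles zup, wqv, xuq, ypv;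
  -- the vertices 0 and 3 of degree two give the edges xy and zw.
  straight⇒line-graph : Straight (Adj H) N F → L[K₃,₃∖e] ↪ H
  straight⇒line-graph (uz , vw , uw , vz) = embed-list L[K₃,₃∖e] H N-sym apart edge≟ t {ws} enum
    ( (xy ∷ ux′ ∷ xp ∷ xz ∷ xq ∷ xv ∷ xw ∷ [])
    ∷ (N-sym uy ∷ E-sym py ∷ yz ∷ N-sym qy ∷ yv ∷ yw ∷ [])
    ∷ (up ∷ uz ∷ uq ∷ uv ∷ uw ∷ [])
    ∷ (pz ∷ pq ∷ E-sym vp ∷ pw ∷ [])
    ∷ (zq ∷ N-sym vz ∷ zw ∷ [])
    ∷ (E-sym vq ∷ E-sym wq ∷ [])
    ∷ (vw ∷ [])
    ∷ []
    ∷ [] )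
    where
    ux′ = E-sym ux
    place : Fin 6 → Fin 6 → Fin n
    place 0F 4F = x
    place 0F _  = y
    place 1F 3F = z
    place 1F 4F = u
    place 1F _  = p
    place _  3F = w
    place _  4F = q
    place _  _  = v
    t : Edge K₃,₃∖e → Fin n
    t (edge i j _ _) = place i j
    mk : ∀ i j → {True (i Fin.<? j)} → {True (adj? K₃,₃∖e i j)} → Edge K₃,₃∖e
    mk i j {l} {a} = edge i j (toWitness l) (toWitness a)
    ws : List (Edge K₃,₃∖e)
    ws = mk 0F 4F ∷ mk 0F 5F ∷ mk 1F 4F ∷ mk 1F 5F ∷ mk 1F 3F ∷ mk 2F 4F ∷ mk 2F 5F ∷ mk 2F 3F ∷ []
    ends : Edge K₃,₃∖e → Fin 6 × Fin 6
    ends (edge i j _ _) = i , j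
    listed? : ∀ i j → Dec (Any.Any (λ e → ends e ≡ (i , j)) ws)
    listed? i j = Any.any? (λ e → Prod.≡-dec Fin._≟_ Fin._≟_ (ends e) (i , j)) ws
    listed : ∀ i j → toℕ i < toℕ j → Adj K₃,₃∖e i j → Any.Any (λ e → ends e ≡ (i , j)) ws
    listed = from-yes (Fin.all? λ i → Fin.all? λ j → (i Fin.<? j) →-dec adj? K₃,₃∖e i j →-dec listed? i j)
    -- The proofs stored in an edge are irrelevant: they are recomputed from decidability for the
    -- lookup, and equal ends then give equal edges.
    enum : ∀ e → e List.∈ ws
    enum e@(edge i j i<j ij) = Any.map (λ { {edge _ _ _ _} refl → refl })
      (listed i j (recompute (i Fin.<? j) i<j) (recompute (adj? K₃,₃∖e i j) ij))

-- Balanced skew partitions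

complement-apart : ∀ {n} (G : SimpleGraph (Fin n)) → Apart (complement G) (Adj G)
complement-apart G e = (λ eq → adj-irrefl G eq e) , (λ (_ , ¬e) → ¬e e)

graph-apart : ∀ {n} (G : SimpleGraph (Fin n)) → Apart G (Adj (complement G))
graph-apart G n = n

complement-complete : ∀ {n} (G : SimpleGraph (Fin n)) {u v} → u ≢ v → ¬ Adj (complement G) u v → Adj G u v
complement-complete G {u} {v} u≢v ¬n with adj? G u v
... | yes e = e
... | no ¬e = contradiction (u≢v , ¬e) ¬n

berge-pair : ∀ {n} (G : SimpleGraph (Fin n)) → Berge G → BergePair n
berge-pair G (holes , antiholes) = record
  { E = Adj G ; N = Adj (complement G)
  ; E-sym = adj-sym G ; N-sym = adj-sym (complement G)
  ; E? = adj? G ; N? = adj? (complement G)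
  ; E-irr = adj-irrefl G refl ; N-irr = adj-irrefl (complement G) refl
  ; EN = λ e (_ , ¬e) → ¬e e
  ; notE = _,_ ; notN = complement-complete G
  ; evenE = even-holes G (adj-sym (complement G)) (graph-apart G) holes
  ; evenN = even-holes (complement G) (adj-sym G) (complement-apart G) antiholes
  }

split⇒disconnected : ∀ {n} {H : SimpleGraph (Fin n)} {R : Rel (Fin n) 0ℓ} {A : Subset n} →
  (∀ {u v} → R u v → ¬ Adj H u v) → Split R A → Disconnected (H ∣ᴳ A)
split⇒disconnected {H = H} {A = A} R⇒¬ s = (c , c∈X) , (d , d∈X) , λ walk →
  let _ , _ , x∈C , y∉C , e , x∈ , y∈ = crossing C (gmap {U = Within (Adj H) (_∈ A)} proj₁
        (λ {(_ , x∈)} {(_ , y∈)} e → e , x∈ , y∈) walk) c∈C d∉C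
  in R⇒¬ (cross x∈ x∈C y∈ y∉C) e
  where open Split s

disconnected⇒split : ∀ {n} {H : SimpleGraph (Fin n)} {R : Rel (Fin n) 0ℓ} {A : Subset n} → Symmetric R →
  (∀ {u v} → u ≢ v → ¬ Adj H u v → R u v) → Disconnected (H ∣ᴳ A) → Split R A
disconnected⇒split {n} {H} {R} {A} R-sym complete ((u , u∈) , (v , v∈) , ¬walk) = record
  { C = S ; c = u ; d = v ; c∈X = u∈ ; c∈C = a∈S ; d∈X = v∈ ; d∉C = λ v∈S → ¬walk (lift (conn a∈S v∈S) u∈ v∈)
  ; cross = λ _ x∈S y∈ y∉S → complete (λ { refl → y∉S x∈S }) (λ e → y∉S (closed x∈S y∈ e)) }
  where
  open Connectivity {E = Adj H} {N = R} (adj-sym H) (adj? H) complete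
  open Component (component A u∈)
  -- A vertex of the induced subgraph carries its membership proof. Uniqueness of such proofs
  -- reconciles the one reached by the walk with the one prescribed.
  lift : ∀ {x y} → Star (Within (Adj H) (_∈ S)) x y → ∀ x∈ y∈ → Star (Adj (H ∣ᴳ A)) (x , x∈) (y , y∈)
  lift ε x∈ y∈ = subst (λ p → Star (Adj (H ∣ᴳ A)) (_ , x∈) (_ , p)) ([]=-irrelevant x∈ y∈) ε
  lift ((e , _ , w∈S) ◅ ws) x∈ y∈ = e ◅ lift ws (S⊆X w∈S) y∈

module _ {n : ℕ} (G : SimpleGraph (Fin n)) (berge : Berge G) where

  private
    B = berge-pair G berge
    open BergePair B

    Conclusion : Set₁
    Conclusion = HasBalancedSkewPartition G ⊎ (ContainsExceptional G ⊎ ContainsExceptional (complement G))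

    skewed : ∀ {A X} → SkewPartition G A X → Skewed B A X
    skewed s = record
      { part = record
        { disjoint = λ v∈A v∈X → disjoint _ (v∈A , v∈X)
        ; inA = λ {v} v∉X → [ (λ v∈A → v∈A) , (λ v∈X → contradiction v∈X v∉X) ]′ (cover v)
        ; inX = λ {v} v∉A → [ (λ v∈A → contradiction v∈A v∉A) , (λ v∈X → v∈X) ]′ (cover v) }
      ; splitA = disconnected⇒split {H = G} N-sym notE A-disconnected
      ; splitX = disconnected⇒split {H = complement G} E-sym notN B-disconnected }
      where open SkewPartition s

    -- Deciding the existence of odd links turns the failure of balance into an actual link for the
    -- handlers.
    balanced : ∀ A X → Partition A X → Split N A → Split E X →
               (OddLink E N A X → Conclusion) → (OddLink N E X A → Conclusion) → Conclusion
    balanced A X part splitA splitX path antipath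
      with odd-link? E? N? E-irr N-irr A X | odd-link? N? E? N-irr E-irr X A
    ... | yes p | _     = path p
    ... | no _  | yes q = antipath q
    ... | no ¬p | no ¬q = inj₁ (A , X
      , record
        { cover = λ v → case v ∈? A of λ { (yes v∈A) → inj₁ v∈A ; (no v∉A) → inj₂ (Partition.inX part v∉A) }
        ; disjoint = λ v (v∈A , v∈X) → Partition.disjoint part v∈A v∈X
        ; A-disconnected = split⇒disconnected {H = G} (λ n e → EN e n) splitA
        ; B-disconnected = split⇒disconnected {H = complement G} EN splitX }
      , record
        { noOddPath = λ u∈ v∈ ¬uv odd P inner →
            ¬p (odd-link-of-path G N-sym (graph-apart G) notE u∈ v∈ ¬uv odd P inner)
        ; noOddAntipath = λ u∈ v∈ uv odd P inner →
            ¬q (odd-link-of-path (complement G) E-sym (complement-apart G) notN u∈ v∈ (EN uv) odd P inner) })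

    in-graph : ContainsExceptional G → Conclusion
    in-graph x = inj₂ (inj₁ x)

    in-complement : ContainsExceptional (complement G) → Conclusion
    in-complement x = inj₂ (inj₂ x)

    escapes : Escapes B Conclusion
    escapes = record
      { leapE = λ l → in-graph (inj₁ (leap⇒long-prism G N-sym (graph-apart G) l))
      ; leapN = λ l → in-complement (inj₁ (leap⇒long-prism (complement G) E-sym (complement-apart G) l))
      ; balanced = balanced }

  skew-partition : HasSkewPartition G → HasBalancedSkewPartition G ⊎ (ContainsExceptional G ⊎ ContainsExceptional (complement G))
  skew-partition (A , X , s) = balanced A X part splitA splitX
    (Conclusion.odd-link B escapes
      (λ F s → in-graph (inj₂ (inj₂ (straight⇒line-graph G N-sym (graph-apart G) F s))))
      (λ F c → in-graph (inj₂ (inj₁ (crossed⇒double-diamond G N-sym (graph-apart G) F c))))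
      (skewed s))
    -- An odd antipath is an odd path of the complement with the two sides exchanged, so the
    -- exceptional subgraph is found in the complement.
    (Conclusion.odd-link (op B) (flip-escapes escapes)
      (λ F s → in-complement (inj₂ (inj₂ (straight⇒line-graph (complement G) E-sym (complement-apart G) F s))))
      (λ F c → in-complement (inj₂ (inj₁ (crossed⇒double-diamond (complement G) E-sym (complement-apart G) F c))))
      (flip-skewed (skewed s)))
    where open Skewed (skewed s)

theorem4p10 : ∀ {n : ℕ} (G : SimpleGraph (Fin n)) →
    Berge G →
    HasSkewPartition G →
    HasBalancedSkewPartition G
    ⊎ (ContainsExceptional G ⊎ ContainsExceptional (complement G))
theorem4p10 = skew-partition
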